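{- Let $G''$ be a digraph obtained from a digraph $G'$ by a T-operation. Then $X(G'')\simeq \Sigma X(G')$. Furthermore, with the vertices $t,t_1,t_2$ labelled as in gluing (A) of the definition of T-operation, if we identify $\Sigma X(G')$ with the subcomplex of $X(G'')$ given by $\{(t_2,t_1),(t,t_1)\}\ast X(G')$, then the natural inclusion map $\Sigma X(G')\hookrightarrow X(G'')$ is a homotopy equivalence.
   Context: A digraph has at most one edge $(v,w)$ from $v$ to $w$ for each ordered pair of vertices. For an edge $e=(v,w)$, $s(e)=v$ is its source and $t(e)=w$ its target. A simple path in a digraph is a sequence of edges $e_1,\dots,e_k$ with $s(e_{i+1})=t(e_i)$ for all $i<k$, such that $s(e_i)=s(e_j)$ or $t(e_i)=t(e_j)$ implies $i=j$, and which is not a cycle, i.e. $s(e_1)\neq t(e_k)$. A multipath of a digraph $G$ is a spanning subgraph each of whose connected components is either a single vertex or a simple path. The multipath complex $X(G)$ is the (abstract) simplicial complex whose simplices are the nonempty edge sets of multipaths of $G$ (the empty simplex corresponds to the multipath with no edges); topological statements refer to its geometric realization. $\Sigma$ denotes the topological (unreduced) suspension, i.e. the join with a two-point discrete space, and $\{a,b\}\ast K$ is the simplicial join of the discrete complex on two vertices $a,b$ with $K$. T-operation. Let $G'$ be a digraph with a vertex $v$ without self-loops, of valence $3$ (exactly three edges are incident to $v$), with indegree or outdegree of $v$ equal to $1$ (the indegree, resp. outdegree, of a vertex is the number of edges with that vertex as target, resp. source). Let $t\neq v$ be a vertex of $G'$ that is incident to exactly one edge of $G'$, this edge joining $t$ and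 $v$. Let $\mathtt{W}_2$ be the digraph with vertices $v_0,v_1,v_2,v_3$ and edges $(v_0,v_1),(v_1,v_2),(v_2,v_1),(v_2,v_3)$. The digraph $G''$ is obtained by gluing a copy of $\mathtt{W}_2$ to $G'$ as follows: (A) if the edge of $G'$ between $v$ and $t$ is $(v,t)$, identify $v_3$ with $v$ and $v_2$ with $t$, and write $t_1$ for $v_1$ and $t_2$ for $v_0$; so $G''$ is $G'$ with two new vertices $t_1,t_2$ and new edges $(t,v),(t_1,t),(t,t_1),(t_2,t_1)$; (B) if the edge of $G'$ between $v$ and $t$ is $(t,v)$, identify $v_0$ with $v$ and $v_1$ with $t$; so $G''$ is $G'$ with two new vertices (the images of $v_2$ and $v_3$) and the new edges $(v,t),(t,v_2),(v_2,t),(v_2,v_3)$. In either case $G''$ is said to be obtained from $G'$ by a T-operation. -}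

module Defs where

open import Level using (0ℓ; Lift; lift; lower) renaming (suc to lsuc)
open import Data.Empty using (⊥-elim)
open import Data.Unit using (⊤; tt)
open import Data.Product using (Σ; ∃-syntax; _×_; _,_; proj₁; proj₂; map₂)
open import Data.Sum as Sum using (_⊎_; inj₁; inj₂)
open import Data.Nat as ℕ using (ℕ; zero; suc; z≤n; s≤s; _∸_)
import Data.Nat.Properties as ℕₚ
open import Data.Fin as Fin using (Fin; zero; suc; toℕ; fromℕ; fromℕ<; inject₁)
import Data.Fin.Properties as Finₚ
open import Data.Fin.Subset as Subset using (Subset; Nonempty; inside; outside; ⁅_⁆) renaming (_∈_ to _∈ˢ_; _∉_ to _∉ˢ_; _⊆_ to _⊆ˢ_; _∪_ to _∪ˢ_; _∩_ to _∩ˢ_; ∣_∣ to card; ⊥ to ∅ˢ)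
import Data.Fin.Subset.Properties as Subₚ
open import Data.Vec as Vec using ([]; _∷_; _++_; here; there)
import Data.Vec.Properties as Vecₚ
open import Data.Vec.Functional using (Vector; foldr)
open import Data.Rational as ℚ using (ℚ; 0ℚ; 1ℚ; ½)
import Data.Rational.Properties as ℚₚ
open import Data.Rational.Solver using (module +-*-Solver)
open import Function using (_∘_; id; _⇔_; mk⇔; Equivalence)
open import Relation.Nullary using (¬_; yes; no; does; Dec)
open import Relation.Nullary.Decidable using (_⊎-dec_; dec-true)
open import Relation.Unary using (Pred; _≐_; _∩_; ⋃)
open import Relation.Binary.Bundles using (Setoid)
open import Relation.Binary.Definitions using (_Respects_)
open import Relation.Binary.PropositionalEquality using (_≡_; _≢_; refl; sym; trans; cong; subst; subst₂)
open import Relation.Binary.Construct.Closure.Equivalence using (EqClosure)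
open import Relation.Binary.Construct.Closure.ReflexiveTransitive using (_◅_; _◅◅_; reverse) renaming (ε to done)
open import Relation.Binary.Construct.Closure.Symmetric as SymC using (fwd; bwd)

-- Real numbers: Cauchy sequences of rationals, with operations defined
-- termwise, modulo the equivalence _≃_.

Eventually : Pred ℕ 0ℓ → Set
Eventually P = ∃[ N ] ∀ n → N ℕ.≤ n → P n

record ℝ : Set where
  constructor real
  field
    seq    : ℕ → ℚ
    cauchy : ∀ ε → 0ℚ ℚ.< ε →
             ∃[ N ] ∀ m n → N ℕ.≤ m → N ℕ.≤ n → ℚ.∣ seq m ℚ.- seq n ∣ ℚ.< ε
open ℝ public

infix 4 _≃_ _<_ _≤_
infixl 6 _+_

-- Records rather than plain definitions, so that x and y can be inferred.
record _≃_ (x y : ℝ) : Set where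
  constructor equal
  field
    apply : ∀ ε → 0ℚ ℚ.< ε → Eventually λ n → ℚ.∣ seq x n ℚ.- seq y n ∣ ℚ.< ε

record _<_ (x y : ℝ) : Set where
  constructor less
  field
    gap     : ℚ
    gap>0   : 0ℚ ℚ.< gap
    witness : Eventually λ n → seq x n ℚ.+ gap ℚ.≤ seq y n

record _≤_ (x y : ℝ) : Set where
  constructor less-equal
  field
    apply : ∀ ε → 0ℚ ℚ.< ε → Eventually λ n → seq x n ℚ.< seq y n ℚ.+ ε

private
  open +-*-Solver using (solve; _:=_; _:+_; _:*_; :-_; _:-_; con)

half>0 : ∀ {ε} → 0ℚ ℚ.< ε → 0ℚ ℚ.< ½ ℚ.* ε
half>0 {ε} ε>0 = subst (ℚ._< ½ ℚ.* ε) (ℚₚ.*-zeroʳ ½) (ℚₚ.*-monoʳ-<-pos ½ ε>0)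

half+half : ∀ ε → ½ ℚ.* ε ℚ.+ ½ ℚ.* ε ≡ ε
half+half = solve 1 (λ e → con ½ :* e :+ con ½ :* e := e) refl

∣-∣-sym : ∀ a b → ℚ.∣ a ℚ.- b ∣ ≡ ℚ.∣ b ℚ.- a ∣
∣-∣-sym a b = trans (cong ℚ.∣_∣ (solve 2 (λ a b → a :- b := :- (b :- a)) refl a b))
                    (ℚₚ.∣-p∣≡∣p∣ (b ℚ.- a))

-- If p = q + r with |q|, |r| < ε/2 then |p| < ε.
split-half : ∀ {ε} p q r → p ≡ q ℚ.+ r → ℚ.∣ q ∣ ℚ.< ½ ℚ.* ε → ℚ.∣ r ∣ ℚ.< ½ ℚ.* ε →
             ℚ.∣ p ∣ ℚ.< ε
split-half {ε} _ q r refl q< r< =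
  ℚₚ.≤-<-trans (ℚₚ.∣p+q∣≤∣p∣+∣q∣ q r) (subst (_ ℚ.<_) (half+half ε) (ℚₚ.+-mono-< q< r<))

p≤∣p∣ : ∀ p → p ℚ.≤ ℚ.∣ p ∣
p≤∣p∣ p with ℚₚ.≤-total 0ℚ p
... | inj₁ 0≤p = ℚₚ.≤-reflexive (sym (ℚₚ.0≤p⇒∣p∣≡p 0≤p))
... | inj₂ p≤0 = ℚₚ.≤-trans p≤0 (ℚₚ.0≤∣p∣ p)

∣p-p∣<ε : ∀ p {ε} → 0ℚ ℚ.< ε → ℚ.∣ p ℚ.- p ∣ ℚ.< ε
∣p-p∣<ε p {ε} = subst (λ q → ℚ.∣ q ∣ ℚ.< ε) (sym (ℚₚ.+-inverseʳ p))

≃-refl : ∀ {x} → x ≃ x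
≃-refl {x} = equal λ ε ε>0 → 0 , λ n _ → ∣p-p∣<ε (seq x n) ε>0

≃-sym : ∀ {x y} → x ≃ y → y ≃ x
≃-sym {x} {y} (equal h) = equal λ ε ε>0 →
  map₂ (λ f n N≤n → subst (ℚ._< ε) (∣-∣-sym (seq x n) (seq y n)) (f n N≤n)) (h ε ε>0)

≃-trans : ∀ {x y z} → x ≃ y → y ≃ z → x ≃ z
≃-trans {x} {y} {z} (equal h) (equal k) = equal λ ε ε>0 →
  let (M , f) = h _ (half>0 ε>0)
      (N , g) = k _ (half>0 ε>0)
  in M ℕ.⊔ N , λ n hn →
     split-half _ _ _ (solve 3 (λ a b c → a :- c := (a :- b) :+ (b :- c)) refl
                         (seq x n) (seq y n) (seq z n))
       (f n (ℕₚ.≤-trans (ℕₚ.m≤m⊔n M N) hn))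
       (g n (ℕₚ.≤-trans (ℕₚ.m≤n⊔m M N) hn))

fromℚ : ℚ → ℝ
fromℚ q = real (λ _ → q) λ ε ε>0 → 0 , λ _ _ _ _ → ∣p-p∣<ε q ε>0

0ℝ 1ℝ : ℝ
0ℝ = fromℚ 0ℚ
1ℝ = fromℚ 1ℚ

abstract
  +-cauchy : ∀ x y ε → 0ℚ ℚ.< ε → ∃[ N ] ∀ m n → N ℕ.≤ m → N ℕ.≤ n →
             ℚ.∣ (seq x m ℚ.+ seq y m) ℚ.- (seq x n ℚ.+ seq y n) ∣ ℚ.< ε
  +-cauchy x y ε ε>0 =
    let (M , f) = cauchy x _ (half>0 ε>0)
        (N , g) = cauchy y _ (half>0 ε>0)
    in M ℕ.⊔ N , λ m n hm hn →
       split-half _ _ _ (solve 4 (λ a b c d → (a :+ b) :- (c :+ d) := (a :- c) :+ (b :- d)) refl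
                           (seq x m) (seq y m) (seq x n) (seq y n))
         (f m n (ℕₚ.≤-trans (ℕₚ.m≤m⊔n M N) hm) (ℕₚ.≤-trans (ℕₚ.m≤m⊔n M N) hn))
         (g m n (ℕₚ.≤-trans (ℕₚ.m≤n⊔m M N) hm) (ℕₚ.≤-trans (ℕₚ.m≤n⊔m M N) hn))

_+_ : ℝ → ℝ → ℝ
x + y = real (λ n → seq x n ℚ.+ seq y n) (+-cauchy x y)

∑ : ∀ {m} → Vector ℝ m → ℝ
∑ = foldr _+_ 0ℝ

-- |x − y| < ε
record Near (ε : ℚ) (x y : ℝ) : Set where
  constructor near
  field
    x<y+ε : x < y + fromℚ ε
    y<x+ε : y < x + fromℚ ε

≃⇒< : ∀ {ε} x y → 0ℚ ℚ.< ε → x ≃ y → x < y + fromℚ ε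
≃⇒< {ε} x y ε>0 (equal h) =
  let (N , f) = h _ (half>0 ε>0)
  in less (½ ℚ.* ε) (half>0 ε>0) (N , λ n N≤n → step n (f n N≤n))
  where
  open ℚₚ.≤-Reasoning
  step : ∀ n → ℚ.∣ seq x n ℚ.- seq y n ∣ ℚ.< ½ ℚ.* ε →
         seq x n ℚ.+ ½ ℚ.* ε ℚ.≤ seq y n ℚ.+ ε
  step n h = begin
    a ℚ.+ ½ ℚ.* ε                       ≡⟨ solve 3 (λ a b e → a :+ e := (b :+ (a :- b)) :+ e) refl a b (½ ℚ.* ε) ⟩
    (b ℚ.+ (a ℚ.- b)) ℚ.+ ½ ℚ.* ε       ≤⟨ ℚₚ.+-monoˡ-≤ (½ ℚ.* ε) (ℚₚ.+-monoʳ-≤ b (ℚₚ.≤-trans (p≤∣p∣ _) (ℚₚ.<⇒≤ h))) ⟩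
    (b ℚ.+ ½ ℚ.* ε) ℚ.+ ½ ℚ.* ε         ≡⟨ solve 2 (λ b e → (b :+ con ½ :* e) :+ con ½ :* e := b :+ e) refl b ε ⟩
    b ℚ.+ ε                             ∎
    where
    a = seq x n
    b = seq y n

≃⇒Near : ∀ {ε x y} → 0ℚ ℚ.< ε → x ≃ y → Near ε x y
≃⇒Near {x = x} {y} ε>0 h = near (≃⇒< x y ε>0 h) (≃⇒< y x ε>0 (≃-sym h))

<+-mono : ∀ {δ ε} x y → δ ℚ.≤ ε → x < y + fromℚ δ → x < y + fromℚ ε
<+-mono x y δ≤ε (less η η>0 (N , f)) =
  less η η>0 (N , λ n h → ℚₚ.≤-trans (f n h) (ℚₚ.+-monoʳ-≤ (seq y n) δ≤ε))

Near-mono : ∀ {δ ε x y} → δ ℚ.≤ ε → Near δ x y → Near ε x y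
Near-mono {x = x} {y} δ≤ε (near p q) = near (<+-mono x y δ≤ε p) (<+-mono y x δ≤ε q)

-- Topological spaces, on setoids so that quotients exist.

record Space : Set₂ where
  field
    setoid : Setoid 0ℓ 0ℓ
  open Setoid setoid public
  field
    Open      : Pred Carrier 0ℓ → Set₁
    open-resp : ∀ {U} → Open U → U Respects _≈_
    open-ext  : ∀ {U V} → U ≐ V → Open U → Open V
    open-univ : Open (λ _ → ⊤)
    open-∩    : ∀ {U V} → Open U → Open V → Open (U ∩ V)
    open-⋃    : ∀ (I : Set) (U : I → Pred Carrier 0ℓ) → (∀ i → Open (U i)) → Open (⋃ I U)

infix 4 _⟶_

record _⟶_ (X Y : Space) : Set₁ where
  private
    module X = Space X
    module Y = Space Y
  field
    to         : X.Carrier → Y.Carrier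
    cong-to    : ∀ {x x′} → x X.≈ x′ → to x Y.≈ to x′
    continuous : ∀ {V} → Y.Open V → X.Open (V ∘ to)
open _⟶_ public

0<⊓ : ∀ {p q} → 0ℚ ℚ.< p → 0ℚ ℚ.< q → 0ℚ ℚ.< p ℚ.⊓ q
0<⊓ {p} {q} p>0 q>0 with ℚₚ.⊓-sel p q
... | inj₁ e = subst (0ℚ ℚ.<_) (sym e) p>0
... | inj₂ e = subst (0ℚ ℚ.<_) (sym e) q>0

-- The subspace { x ∈ ℝᵐ : P x } with the Euclidean topology.
Euclidean : (m : ℕ) → Pred (Vector ℝ m) 0ℓ → Space
Euclidean m P = record
  { setoid    = record
    { Carrier       = Σ (Vector ℝ m) P
    ; _≈_           = λ (x , _) (y , _) → ∀ i → x i ≃ y i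
    ; isEquivalence = record
      { refl  = λ i → ≃-refl
      ; sym   = λ h i → ≃-sym (h i)
      ; trans = λ h k i → ≃-trans (h i) (k i)
      }
    }
  ; Open      = λ U → Lift (lsuc 0ℓ) (IsOpen U)
  ; open-resp = λ {U} o h u → let (ε , ε>0 , ball) = lower o _ u in
                              ball _ λ i → ≃⇒Near ε>0 (h i)
  ; open-ext  = λ (U⊆V , V⊆U) o → lift λ x v →
                  let (ε , ε>0 , ball) = lower o x (V⊆U v) in ε , ε>0 , λ y h → U⊆V (ball y h)
  ; open-univ = lift λ _ _ → 1ℚ , ℚₚ.positive⁻¹ 1ℚ , λ _ _ → tt
  ; open-∩    = λ o o′ → lift λ x (u , v) →
                  let (ε , ε>0 , ball)  = lower o x u
                      (δ , δ>0 , ball′) = lower o′ x v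
                  in ε ℚ.⊓ δ , 0<⊓ ε>0 δ>0 ,
                     λ y h → ball  y (λ i → Near-mono (ℚₚ.p⊓q≤p ε δ) (h i))
                           , ball′ y (λ i → Near-mono (ℚₚ.p⊓q≤q ε δ) (h i))
  ; open-⋃    = λ I U o → lift λ x (i , u) →
                  let (ε , ε>0 , ball) = lower (o i) x u in ε , ε>0 , λ y h → i , ball y h
  }
  where
  IsOpen : Pred (Σ (Vector ℝ m) P) 0ℓ → Set
  IsOpen U = ∀ x → U x → ∃[ ε ] (0ℚ ℚ.< ε × ∀ y → (∀ i → Near ε (proj₁ x i) (proj₁ y i)) → U y)

𝕀 : Space
𝕀 = Euclidean 1 (λ s → 0ℝ ≤ s zero × s zero ≤ 1ℝ)

0≤1 : 0ℝ ≤ 1ℝ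
0≤1 = less-equal λ ε ε>0 → 0 , λ _ _ → ℚₚ.+-mono-< (ℚₚ.positive⁻¹ 1ℚ) ε>0

≤-refl : ∀ {x} → x ≤ x
≤-refl {x} = less-equal λ ε ε>0 → 0 , λ n _ →
  subst (ℚ._< seq x n ℚ.+ ε) (ℚₚ.+-identityʳ (seq x n)) (ℚₚ.+-monoʳ-< (seq x n) ε>0)

0𝕀 1𝕀 : Space.Carrier 𝕀
0𝕀 = (λ _ → 0ℝ) , ≤-refl , 0≤1
1𝕀 = (λ _ → 1ℝ) , 0≤1 , ≤-refl

infixr 5 _⊗_

_⊗_ : Space → Space → Space
X ⊗ Y = record
  { setoid    = record
    { Carrier       = X.Carrier × Y.Carrier
    ; _≈_           = λ (x , y) (x′ , y′) → x X.≈ x′ × y Y.≈ y′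
    ; isEquivalence = record
      { refl  = X.refl , Y.refl
      ; sym   = λ (p , q) → X.sym p , Y.sym q
      ; trans = λ (p , q) (p′ , q′) → X.trans p p′ , Y.trans q q′
      }
    }
  ; Open      = IsOpen
  ; open-resp = λ o (p , q) w → let (U , V , oU , oV , u , v , box) = o _ w in
                                box (X.open-resp oU p u) (Y.open-resp oV q v)
  ; open-ext  = λ (W⊆W′ , W′⊆W) o z w →
                  let (U , V , oU , oV , u , v , box) = o z (W′⊆W w) in
                  U , V , oU , oV , u , v , λ p q → W⊆W′ (box p q)
  ; open-univ = λ _ _ → (λ _ → ⊤) , (λ _ → ⊤) , X.open-univ , Y.open-univ , tt , tt , λ _ _ → tt
  ; open-∩    = λ o o′ z (w , w′) →
                  let (U  , V  , oU  , oV  , u  , v  , box)  = o  z w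
                      (U′ , V′ , oU′ , oV′ , u′ , v′ , box′) = o′ z w′
                  in U ∩ U′ , V ∩ V′ , X.open-∩ oU oU′ , Y.open-∩ oV oV′ , (u , u′) , (v , v′) ,
                     λ (p , p′) (q , q′) → box p q , box′ p′ q′
  ; open-⋃    = λ I W o z (i , w) →
                  let (U , V , oU , oV , u , v , box) = o i z w in
                  U , V , oU , oV , u , v , λ p q → i , box p q
  }
  where
  module X = Space X
  module Y = Space Y
  IsOpen : Pred (X.Carrier × Y.Carrier) 0ℓ → Set₁
  IsOpen W = ∀ z → W z → Σ (Pred X.Carrier 0ℓ) λ U → Σ (Pred Y.Carrier 0ℓ) λ V →
    X.Open U × Y.Open V × U (proj₁ z) × V (proj₂ z) × (∀ {x y} → U x → V y → W (x , y))

-- The unreduced suspension: X × [0,1] with X × {0} and X × {1} each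
-- collapsed to a point, in the quotient topology (for X nonempty this is the
-- join with a two-point space).
Susp : Space → Space
Susp X = record
  { setoid    = record
    { Carrier       = X×𝕀.Carrier
    ; _≈_           = _~_
    ; isEquivalence = record
      { refl  = ≃-refl , inj₂ (inj₂ X.refl)
      ; sym   = λ {p} {q} → ~-sym {p} {q}
      ; trans = λ {p} {q} {r} → ~-trans {p} {q} {r}
      }
    }
  ; Open      = λ U → U Respects _~_ × X×𝕀.Open U
  ; open-resp = proj₁
  ; open-ext  = λ (U⊆V , V⊆U) (resp , o) →
                  (λ p v → U⊆V (resp p (V⊆U v))) , X×𝕀.open-ext (U⊆V , V⊆U) o
  ; open-univ = (λ _ _ → tt) , X×𝕀.open-univ
  ; open-∩    = λ (r , o) (r′ , o′) → (λ p (u , v) → r p u , r′ p v) , X×𝕀.open-∩ o o′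
  ; open-⋃    = λ I U h → (λ p (i , u) → i , proj₁ (h i) p u) , X×𝕀.open-⋃ I U (proj₂ ∘ h)
  }
  where
  module X = Space X
  module X×𝕀 = Space (X ⊗ 𝕀)
  height : Space.Carrier 𝕀 → ℝ
  height s = proj₁ s zero
  _~_ : X×𝕀.Carrier → X×𝕀.Carrier → Set
  (x , s) ~ (y , t) = height s ≃ height t × (height s ≃ 0ℝ ⊎ height s ≃ 1ℝ ⊎ x X.≈ y)
  ~-sym : ∀ {p q} → p ~ q → q ~ p
  ~-sym (h , c) = ≃-sym h , Sum.map (≃-trans (≃-sym h)) (Sum.map (≃-trans (≃-sym h)) X.sym) c
  ~-trans : ∀ {p q r} → p ~ q → q ~ r → p ~ r
  ~-trans (h , inj₁ p)        (k , _)             = ≃-trans h k , inj₁ p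
  ~-trans (h , inj₂ (inj₁ p)) (k , _)             = ≃-trans h k , inj₂ (inj₁ p)
  ~-trans (h , inj₂ (inj₂ p)) (k , inj₁ q)        = ≃-trans h k , inj₁ (≃-trans h q)
  ~-trans (h , inj₂ (inj₂ p)) (k , inj₂ (inj₁ q)) = ≃-trans h k , inj₂ (inj₁ (≃-trans h q))
  ~-trans (h , inj₂ (inj₂ p)) (k , inj₂ (inj₂ q)) = ≃-trans h k , inj₂ (inj₂ (X.trans p q))

idₜ : ∀ {X} → X ⟶ X
idₜ = record { to = id ; cong-to = id ; continuous = id }

infixr 9 _∘ₜ_

_∘ₜ_ : ∀ {X Y Z} → Y ⟶ Z → X ⟶ Y → X ⟶ Z
g ∘ₜ f = record
  { to         = to g ∘ to f
  ; cong-to    = λ p → cong-to g (cong-to f p)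
  ; continuous = λ o → continuous f (continuous g o)
  }

record Homotopy {X Y : Space} (f g : X ⟶ Y) : Set₁ where
  private
    module Y = Space Y
  field
    H  : X ⊗ 𝕀 ⟶ Y
    H₀ : ∀ x → to H (x , 0𝕀) Y.≈ to f x
    H₁ : ∀ x → to H (x , 1𝕀) Y.≈ to g x

record IsHomotopyEquivalence {X Y : Space} (f : X ⟶ Y) : Set₁ where
  field
    inverse : Y ⟶ X
    left    : Homotopy (inverse ∘ₜ f) idₜ
    right   : Homotopy (f ∘ₜ inverse) idₜ

infix 4 _≃ₕ_

_≃ₕ_ : Space → Space → Set₁
X ≃ₕ Y = Σ (X ⟶ Y) IsHomotopyEquivalence

-- Simplicial complexes with vertices among Fin m; elements of Fin m that
-- lie in no simplex (e.g. self-loops, for multipath complexes) are not vertices.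

record SimplicialComplex (m : ℕ) : Set₁ where
  field
    Simplex  : Pred (Subset m) 0ℓ
    nonempty : ∀ {σ} → Simplex σ → Nonempty σ
    down     : ∀ {σ τ} → Simplex σ → Nonempty τ → τ ⊆ˢ σ → Simplex τ
open SimplicialComplex public

-- Geometric realization: barycentric coordinates supported on a simplex.
∥_∥ : ∀ {m} → SimplicialComplex m → Space
∥_∥ {m} K = Euclidean m λ x →
  (∀ i → 0ℝ ≤ x i) × ∑ x ≃ 1ℝ × ∃[ σ ] (Simplex K σ × ∀ i → i ∉ˢ σ → x i ≃ 0ℝ)

infix 4 _⊑_

_⊑_ : ∀ {m} → SimplicialComplex m → SimplicialComplex m → Set
L ⊑ K = ∀ {σ} → Simplex L σ → Simplex K σ

inclusion : ∀ {m} {L K : SimplicialComplex m} → L ⊑ K → ∥ L ∥ ⟶ ∥ K ∥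
inclusion L⊑K = record
  { to         = λ (x , x≥0 , ∑x≃1 , σ , σ∈L , x≃0) → x , x≥0 , ∑x≃1 , σ , L⊑K σ∈L , x≃0
  ; cong-to    = id
  ; continuous = λ o → lift λ x v → let (ε , ε>0 , ball) = lower o _ v in ε , ε>0 , λ y h → ball _ h
  }

Face : ∀ {m} → SimplicialComplex m → Pred (Subset m) 0ℓ
Face K σ = σ ≡ ∅ˢ ⊎ Simplex K σ

face-down : ∀ {m} (K : SimplicialComplex m) {σ τ} → Face K σ → τ ⊆ˢ σ → Face K τ
face-down K {σ} {τ} (inj₁ refl) τ⊆σ = inj₁ (Subₚ.⊆-antisym τ⊆σ Subₚ.⊥⊆)
face-down K {σ} {τ} (inj₂ s)    τ⊆σ with Subₚ.nonempty? τ
... | yes ne = inj₂ (down K s ne τ⊆σ)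
... | no  ¬ne = inj₁ (Subₚ.Empty-unique ¬ne)

infixr 6 _⋆_

-- Simplicial join of complexes with disjoint vertex sets inside Fin m.
_⋆_ : ∀ {m} → SimplicialComplex m → SimplicialComplex m → SimplicialComplex m
K ⋆ L = record
  { Simplex  = λ ρ → Nonempty ρ × ∃[ σ ] ∃[ τ ] (Face K σ × Face L τ × ρ ≡ σ ∪ˢ τ)
  ; nonempty = proj₁
  ; down     = λ { {τ = ρ′} (_ , σ , τ , s , t , refl) ne ρ′⊆ → ne , ρ′ ∩ˢ σ , ρ′ ∩ˢ τ ,
                   face-down K s (Subₚ.p∩q⊆q ρ′ σ) , face-down L t (Subₚ.p∩q⊆q ρ′ τ) ,
                   Subₚ.⊆-antisym
                     (λ x∈ → subst (_ ∈ˢ_) (Subₚ.∩-distribˡ-∪ ρ′ σ τ) (Subₚ.x∈p∩q⁺ (x∈ , ρ′⊆ x∈)))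
                     (λ x∈ → Subₚ.p∩q⊆p ρ′ (σ ∪ˢ τ) (subst (_ ∈ˢ_) (sym (Subₚ.∩-distribˡ-∪ ρ′ σ τ)) x∈)) }
  }

discrete : ∀ {m} → Fin m → Fin m → SimplicialComplex m
discrete a b = record
  { Simplex  = λ σ → σ ≡ ⁅ a ⁆ ⊎ σ ≡ ⁅ b ⁆
  ; nonempty = Sum.[ (λ { refl → a , Subₚ.x∈⁅x⁆ a }) , (λ { refl → b , Subₚ.x∈⁅x⁆ b }) ]
  ; down     = λ s ne τ⊆ → Sum.map (λ { refl → lemma ne τ⊆ }) (λ { refl → lemma ne τ⊆ }) s
  }
  where
  lemma : ∀ {m} {τ : Subset m} {c} → Nonempty τ → τ ⊆ˢ ⁅ c ⁆ → τ ≡ ⁅ c ⁆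
  lemma {τ = τ} {c} (x , x∈τ) τ⊆ = Subₚ.⊆-antisym τ⊆ λ y∈ →
    subst (_∈ˢ τ) (trans (Subₚ.x∈⁅y⁆⇒x≡y c (τ⊆ x∈τ)) (sym (Subₚ.x∈⁅y⁆⇒x≡y c y∈))) x∈τ

drop-pad : ∀ k {m} {σ : Subset m} {τ} → τ ⊆ˢ (∅ˢ {k} ++ σ) → ∃[ τ′ ] (τ′ ⊆ˢ σ × τ ≡ ∅ˢ {k} ++ τ′)
drop-pad zero    {τ = τ} h = τ , h , refl
drop-pad (suc k) {τ = inside ∷ τ} h with () ← h here
drop-pad (suc k) {τ = outside ∷ τ} h with drop-pad k (λ x∈ → Subₚ.drop-there (h (there x∈)))
... | τ′ , h′ , refl = τ′ , h′ , refl

pad-nonempty : ∀ k {m} {σ : Subset m} → Nonempty σ → Nonempty (∅ˢ {k} ++ σ)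
pad-nonempty zero    ne = ne
pad-nonempty (suc k) ne = let (x , x∈) = pad-nonempty k ne in suc x , there x∈

unpad-nonempty : ∀ k {m} {σ : Subset m} → Nonempty (∅ˢ {k} ++ σ) → Nonempty σ
unpad-nonempty zero    ne = ne
unpad-nonempty (suc k) (suc x , there x∈) = unpad-nonempty k (x , x∈)

-- The vertex i of K becomes k ↑ʳ i.
shift : ∀ k {m} → SimplicialComplex m → SimplicialComplex (k ℕ.+ m)
shift k K = record
  { Simplex  = λ ρ → ∃[ σ ] (Simplex K σ × ρ ≡ ∅ˢ {k} ++ σ)
  ; nonempty = λ { (σ , s , refl) → pad-nonempty k (nonempty K s) }
  ; down     = λ { (σ , s , refl) ne τ⊆ → pad s ne (drop-pad k τ⊆) }
  }
  where
  pad : ∀ {σ τ} → Simplex K σ → Nonempty τ → ∃[ τ′ ] (τ′ ⊆ˢ σ × τ ≡ ∅ˢ {k} ++ τ′) →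
        ∃[ τ′ ] (Simplex K τ′ × τ ≡ ∅ˢ {k} ++ τ′)
  pad s ne (τ′ , τ′⊆σ , refl) = τ′ , down K s (unpad-nonempty k ne) τ′⊆σ , refl

record Digraph : Set where
  field
    order size : ℕ
  Vertex = Fin order
  Edge   = Fin size
  field
    src tgt : Edge → Vertex
    simple  : ∀ {e f} → src e ≡ src f → tgt e ≡ tgt f → e ≡ f

module _ (G : Digraph) where
  open Digraph G

  record SimplePath {k : ℕ} (p : Fin (suc k) → Edge) : Set where
    field
      chain     : ∀ (i : Fin k) → src (p (suc i)) ≡ tgt (p (inject₁ i))
      injective : ∀ i j → src (p i) ≡ src (p j) ⊎ tgt (p i) ≡ tgt (p j) → i ≡ j
      non-cycle : src (p zero) ≢ tgt (p (fromℕ k))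

  -- A spanning subgraph is given by its set S of edges.

  Adjacent : Subset size → Vertex → Vertex → Set
  Adjacent S u w = ∃[ e ] (e ∈ˢ S × src e ≡ u × tgt e ≡ w)

  Connected : Subset size → Vertex → Vertex → Set
  Connected S = EqClosure (Adjacent S)

  -- The component of w has no other vertex, and no edge (i.e. no loop at w).
  record VertexComponent (S : Subset size) (w : Vertex) : Set where
    field
      vertices : ∀ u → Connected S w u → u ≡ w
      edges    : ∀ e → e ∈ˢ S → ¬ Connected S w (src e)

  record PathComponent (S : Subset size) (w : Vertex) : Set where
    field
      {length-1} : ℕ
      path       : Fin (suc length-1) → Edge
      simplePath : SimplePath path
      edges      : ∀ e → (e ∈ˢ S × Connected S w (src e)) ⇔ (∃[ i ] path i ≡ e)
      vertices   : ∀ u → Connected S w u ⇔ (∃[ i ] (src (path i) ≡ u ⊎ tgt (path i) ≡ u))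

  Multipath : Pred (Subset size) 0ℓ
  Multipath S = ∀ w → VertexComponent S w ⊎ PathComponent S w

clamp : ∀ k → ℕ → Fin (suc k)
clamp k       zero    = zero
clamp zero    (suc i) = zero
clamp (suc k) (suc i) = suc (clamp k i)

toℕ-clamp : ∀ {k i} → i ℕ.≤ k → toℕ (clamp k i) ≡ i
toℕ-clamp z≤n     = refl
toℕ-clamp (s≤s h) = cong suc (toℕ-clamp h)

clamp-toℕ : ∀ {k} (i : Fin (suc k)) → clamp k (toℕ i) ≡ i
clamp-toℕ {k}     zero    = refl
clamp-toℕ {suc k} (suc i) = cong suc (clamp-toℕ i)

≤-pred-≢ : ∀ {a b} → a ℕ.≤ b → a ≢ b → ∃[ k ] (b ≡ suc (k ℕ.+ a))
≤-pred-≢ {a} {b} a≤b a≢b =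
  let a<b = ℕₚ.≤∧≢⇒< a≤b a≢b in b ∸ suc a ,
  sym (trans (sym (ℕₚ.+-suc (b ∸ suc a) a)) (ℕₚ.m∸n+n≡m a<b))

-- A component of a smaller edge set is a segment of a component of S.
module _ (G : Digraph) {S S′ : Subset (Digraph.size G)} (S′⊆S : S′ ⊆ˢ S) where
  open Digraph G

  private
    connected-⊆ : ∀ {u w} → Connected G S′ u w → Connected G S u w
    connected-⊆ done                       = done
    connected-⊆ (fwd (e , e∈ , s , t) ◅ r) = fwd (e , S′⊆S e∈ , s , t) ◅ connected-⊆ r
    connected-⊆ (bwd (e , e∈ , s , t) ◅ r) = bwd (e , S′⊆S e∈ , s , t) ◅ connected-⊆ r

    module Segment (w : Vertex) (C : PathComponent G S w) where
      open PathComponent C renaming (length-1 to L)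
      open SimplePath simplePath

      p : ℕ → Edge
      p i = path (clamp L i)

      -- The successive vertices vx 0, …, vx (L + 1) of the path.
      vx : ℕ → Vertex
      vx zero    = src (p zero)
      vx (suc i) = tgt (p i)

      src-vx : ∀ {i} → i ℕ.≤ L → src (p i) ≡ vx i
      src-vx {zero}  _   = refl
      src-vx {suc i} i<L = subst₂ (λ a b → src (path a) ≡ tgt (path b))
        (Finₚ.toℕ-injective (trans (cong suc (Finₚ.toℕ-fromℕ< i<L)) (sym (toℕ-clamp i<L))))
        (Finₚ.toℕ-injective (trans (trans (Finₚ.toℕ-inject₁ (fromℕ< i<L)) (Finₚ.toℕ-fromℕ< i<L))
                                   (sym (toℕ-clamp (ℕₚ.<⇒≤ i<L)))))
        (chain (fromℕ< i<L))

      p-inj : ∀ {i j} → i ℕ.≤ L → j ℕ.≤ L → src (p i) ≡ src (p j) ⊎ tgt (p i) ≡ tgt (p j) → i ≡ j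
      p-inj i≤L j≤L h = trans (sym (toℕ-clamp i≤L)) (trans (cong toℕ (injective _ _ h)) (toℕ-clamp j≤L))

      first-≢ : ∀ {j} → j ℕ.≤ L → vx zero ≢ vx (suc j)
      first-≢ {j} j≤L h with j ℕ.≟ L
      ... | yes refl = non-cycle (trans h (cong (tgt ∘ path)
                         (Finₚ.toℕ-injective (trans (toℕ-clamp j≤L) (sym (Finₚ.toℕ-fromℕ L))))))
      ... | no j≢L = let j<L = ℕₚ.≤∧≢⇒< j≤L j≢L in
        ℕₚ.0≢1+n (p-inj z≤n j<L (inj₁ (trans h (sym (src-vx j<L)))))

      vx-inj : ∀ {i j} → i ℕ.≤ suc L → j ℕ.≤ suc L → vx i ≡ vx j → i ≡ j
      vx-inj {zero}  {zero}  _ _ _ = refl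
      vx-inj {zero}  {suc j} _ (s≤s j≤L) h = ⊥-elim (first-≢ j≤L h)
      vx-inj {suc i} {zero}  (s≤s i≤L) _ h = ⊥-elim (first-≢ i≤L (sym h))
      vx-inj {suc i} {suc j} (s≤s i≤L) (s≤s j≤L) h = cong suc (p-inj i≤L j≤L (inj₂ h))

      index : ∀ {e} → e ∈ˢ S → Connected G S w (src e) → ∃[ i ] (i ℕ.≤ L × p i ≡ e)
      index {e} e∈S c = let (i , eq) = Equivalence.to (edges e) (e∈S , c) in
        toℕ i , ℕₚ.≤-pred (Finₚ.toℕ<n i) , trans (cong path (clamp-toℕ i)) eq

      vertex-index : ∃[ j ] (j ℕ.≤ suc L × vx j ≡ w)
      vertex-index with Equivalence.to (vertices w) done
      ... | i , inj₁ h = toℕ i , ℕₚ.<⇒≤ (Finₚ.toℕ<n i) ,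
            trans (sym (src-vx (ℕₚ.≤-pred (Finₚ.toℕ<n i)))) (trans (cong (src ∘ path) (clamp-toℕ i)) h)
      ... | i , inj₂ h = suc (toℕ i) , Finₚ.toℕ<n i , trans (cong (tgt ∘ path) (clamp-toℕ i)) h

      Run : ℕ → ℕ → Set
      Run a b = ∀ i → a ℕ.≤ i → i ℕ.< b → p i ∈ˢ S′

      lower-end : ∀ j → ∃[ a ] (a ℕ.≤ j × Run a j × (∀ {i} → suc i ≡ a → p i ∉ˢ S′))
      lower-end zero = zero , z≤n , (λ _ _ ()) , λ ()
      lower-end (suc j) with p j Subₚ.∈? S′
      ... | no ∉ = suc j , ℕₚ.≤-refl , (λ i h k → ⊥-elim (ℕₚ.<-irrefl refl (ℕₚ.≤-trans k h))) ,
                   λ { refl → ∉ }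
      ... | yes ∈ = let (a , a≤j , run , stop) = lower-end j in
        a , ℕₚ.m≤n⇒m≤1+n a≤j , extend run , stop
        where
        extend : ∀ {a} → Run a j → Run a (suc j)
        extend run i a≤i (s≤s i≤j) with i ℕ.≟ j
        ... | yes refl = ∈
        ... | no i≢j   = run i a≤i (ℕₚ.≤∧≢⇒< i≤j i≢j)

      upper-end : ∀ d j → d ℕ.+ j ≡ suc L →
                  ∃[ b ] (j ℕ.≤ b × b ℕ.≤ suc L × Run j b × (b ℕ.≤ L → p b ∉ˢ S′))
      upper-end zero j refl = j , ℕₚ.≤-refl , ℕₚ.≤-refl ,
        (λ i h k → ⊥-elim (ℕₚ.<-irrefl refl (ℕₚ.≤-trans k h))) , λ h → ⊥-elim (ℕₚ.<-irrefl refl h)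
      upper-end (suc d) j eq with p j Subₚ.∈? S′
      ... | no ∉ = j , ℕₚ.≤-refl , subst (j ℕ.≤_) eq (ℕₚ.m≤n+m j (suc d)) ,
        (λ i h k → ⊥-elim (ℕₚ.<-irrefl refl (ℕₚ.≤-trans k h))) , λ _ → ∉
      ... | yes ∈ = let (b , j<b , b≤ , run , stop) = upper-end d (suc j) (trans (ℕₚ.+-suc d j) eq) in
        b , ℕₚ.<⇒≤ j<b , b≤ , extend run , stop
        where
        extend : ∀ {b} → Run (suc j) b → Run j b
        extend run i j≤i i<b with j ℕ.≟ i
        ... | yes refl = ∈
        ... | no j≢i   = run i (ℕₚ.≤∧≢⇒< j≤i j≢i) i<b

      j₀ : ℕ
      j₀ = proj₁ vertex-index
      j₀≤ : j₀ ℕ.≤ suc L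
      j₀≤ = proj₁ (proj₂ vertex-index)
      vx-j₀ : vx j₀ ≡ w
      vx-j₀ = proj₂ (proj₂ vertex-index)

      module Ends
        (a b : ℕ) (a≤j : a ℕ.≤ j₀) (j≤b : j₀ ℕ.≤ b) (b≤ : b ℕ.≤ suc L) (run : Run a b)
        (stop-a : ∀ {i} → suc i ≡ a → p i ∉ˢ S′) (stop-b : b ℕ.≤ L → p b ∉ˢ S′)
        where

        In : Vertex → Set
        In u = ∃[ i ] (a ℕ.≤ i × i ℕ.≤ b × vx i ≡ u)

        below : ∀ {i} → i ℕ.< b → i ℕ.≤ L
        below i<b = ℕₚ.≤-pred (ℕₚ.≤-trans i<b b≤)

        down-to-a : ∀ d → d ℕ.+ a ℕ.≤ b → Connected G S′ (vx a) (vx (d ℕ.+ a))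
        down-to-a zero    _ = done
        down-to-a (suc d) h = down-to-a d (ℕₚ.<⇒≤ h) ◅◅
          (fwd (p (d ℕ.+ a) , run _ (ℕₚ.m≤n+m a d) h , src-vx (below h) , refl) ◅ done)

        from-a : ∀ {i} → a ℕ.≤ i → i ℕ.≤ b → Connected G S′ (vx a) (vx i)
        from-a {i} a≤i i≤b = subst (λ k → Connected G S′ (vx a) (vx k)) (ℕₚ.m∸n+n≡m a≤i)
          (down-to-a (i ∸ a) (subst (ℕ._≤ b) (sym (ℕₚ.m∸n+n≡m a≤i)) i≤b))

        In⇒connected : ∀ {u} → In u → Connected G S′ w u
        In⇒connected (i , a≤i , i≤b , refl) =
          subst (λ v → Connected G S′ v (vx i)) vx-j₀
            (reverse (SymC.symmetric (Adjacent G S′)) (from-a a≤j j≤b) ◅◅ from-a a≤i i≤b)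

        edge-in : ∀ {e} → e ∈ˢ S′ → In (src e) ⊎ In (tgt e) →
                  ∃[ i ] (a ℕ.≤ i × i ℕ.< b × p i ≡ e)
        edge-in {e} e∈ h = locate (index (S′⊆S e∈) (connected-⊆ (conn h))) h
          where
          conn : In (src e) ⊎ In (tgt e) → Connected G S′ w (src e)
          conn (inj₁ q) = In⇒connected q
          conn (inj₂ q) = In⇒connected q ◅◅ (bwd (e , e∈ , refl , refl) ◅ done)
          locate : ∃[ l ] (l ℕ.≤ L × p l ≡ e) → In (src e) ⊎ In (tgt e) →
                   ∃[ i ] (a ℕ.≤ i × i ℕ.< b × p i ≡ e)
          locate (l , l≤L , refl) (inj₁ (i , a≤i , i≤b , eq))
            with refl ← vx-inj (ℕₚ.≤-trans i≤b b≤) (ℕₚ.m≤n⇒m≤1+n l≤L) (trans eq (src-vx l≤L))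
            = l , a≤i , ℕₚ.≤∧≢⇒< i≤b (λ { refl → stop-b l≤L e∈ }) , refl
          locate (l , l≤L , refl) (inj₂ (i , a≤i , i≤b , eq))
            with refl ← vx-inj (ℕₚ.≤-trans i≤b b≤) (s≤s l≤L) eq
            = l , ℕₚ.≤-pred (ℕₚ.≤∧≢⇒< a≤i (λ { refl → stop-a refl e∈ })) , i≤b , refl

        connected⇒In : ∀ {u v} → In u → Connected G S′ u v → In v
        connected⇒In q done = q
        connected⇒In q (fwd (e , e∈ , refl , refl) ◅ r) =
          let (i , a≤i , i<b , eq) = edge-in e∈ (inj₁ q) in
          connected⇒In (suc i , ℕₚ.m≤n⇒m≤1+n a≤i , i<b , cong tgt eq) r
        connected⇒In q (bwd (e , e∈ , refl , refl) ◅ r) =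
          let (i , a≤i , i<b , eq) = edge-in e∈ (inj₂ q) in
          connected⇒In (i , a≤i , ℕₚ.<⇒≤ i<b , trans (sym (src-vx (below i<b))) (cong src eq)) r

        In-w : In w
        In-w = j₀ , a≤j , j≤b , vx-j₀

        result : Dec (a ≡ b) → VertexComponent G S′ w ⊎ PathComponent G S′ w
        result (yes refl) = inj₁ record
          { vertices = λ u c → only (connected⇒In In-w c)
          ; edges    = λ e e∈ c → let (i , a≤i , i<a , _) = edge-in e∈ (inj₁ (connected⇒In In-w c)) in
                                  ℕₚ.<-irrefl refl (ℕₚ.≤-trans i<a a≤i)
          }
          where
          only : ∀ {u} → In u → u ≡ w
          only (i , a≤i , i≤a , refl) =
            trans (cong vx (trans (ℕₚ.≤-antisym i≤a a≤i) (ℕₚ.≤-antisym a≤j j≤b))) vx-j₀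
        result (no a≢b) = inj₂ record
          { path       = q
          ; simplePath = record
            { chain     = λ i → trans (src-vx (below (idx<b (suc i))))
                                      (cong (λ k → tgt (p (k ℕ.+ a))) (sym (Finₚ.toℕ-inject₁ i)))
            ; injective = λ i j h → Finₚ.toℕ-injective
                (ℕₚ.+-cancelʳ-≡ a _ _ (p-inj (below (idx<b i)) (below (idx<b j)) h))
            ; non-cycle = λ h → ℕₚ.m≢1+n+m a
                (vx-inj (ℕₚ.≤-trans (ℕₚ.<⇒≤ (idx<b zero)) b≤) (ℕₚ.≤-trans (idx<b (fromℕ k)) b≤)
                        (trans (sym (src-vx (below (idx<b zero)))) h))
            }
          ; edges      = λ e → mk⇔
              (λ (e∈ , c) → to-q (edge-in e∈ (inj₁ (connected⇒In In-w c))))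
              (λ { (i , refl) → run _ (ℕₚ.m≤n+m a _) (idx<b i) , In⇒connected (src-in i) })
          ; vertices   = λ u → mk⇔ (λ c → vertex-of (connected⇒In In-w c))
              (λ { (i , inj₁ refl) → In⇒connected (src-in i)
                 ; (i , inj₂ refl) → In⇒connected (suc (toℕ i ℕ.+ a) ,
                     ℕₚ.m≤n⇒m≤1+n (ℕₚ.m≤n+m a _) , idx<b i , refl) })
          }
          where
          k : ℕ
          k = proj₁ (≤-pred-≢ (ℕₚ.≤-trans a≤j j≤b) a≢b)
          b≡ : b ≡ suc (k ℕ.+ a)
          b≡ = proj₂ (≤-pred-≢ (ℕₚ.≤-trans a≤j j≤b) a≢b)
          q : Fin (suc k) → Edge
          q i = p (toℕ i ℕ.+ a)
          idx<b : ∀ (i : Fin (suc k)) → toℕ i ℕ.+ a ℕ.< b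
          idx<b i = subst (toℕ i ℕ.+ a ℕ.<_) (sym b≡) (ℕₚ.+-monoˡ-≤ a (Finₚ.toℕ<n i))
          src-in : ∀ i → In (src (q i))
          src-in i = toℕ i ℕ.+ a , ℕₚ.m≤n+m a _ , ℕₚ.<⇒≤ (idx<b i) , sym (src-vx (below (idx<b i)))
          to-q : ∀ {e} → ∃[ i ] (a ℕ.≤ i × i ℕ.< b × p i ≡ e) → ∃[ i ] (q i ≡ e)
          to-q (i , a≤i , i<b , refl) = fromℕ< i∸a< ,
            cong p (trans (cong (ℕ._+ a) (Finₚ.toℕ-fromℕ< i∸a<)) (ℕₚ.m∸n+n≡m a≤i))
            where
            i∸a< : i ∸ a ℕ.< suc k
            i∸a< = ℕₚ.+-cancelʳ-< a (i ∸ a) (suc k)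
                     (subst₂ ℕ._<_ (sym (ℕₚ.m∸n+n≡m a≤i)) b≡ i<b)
          vertex-of : ∀ {u} → In u → ∃[ i ] (src (q i) ≡ u ⊎ tgt (q i) ≡ u)
          vertex-of (i , a≤i , i≤b , refl) with i ℕ.≟ b
          ... | no i≢b = let (l , eq) = to-q (i , a≤i , ℕₚ.≤∧≢⇒< i≤b i≢b , refl) in
            l , inj₁ (trans (cong src eq) (src-vx (below (ℕₚ.≤∧≢⇒< i≤b i≢b))))
          ... | yes refl = fromℕ k , inj₂ (trans (cong (λ l → vx (suc (l ℕ.+ a))) (Finₚ.toℕ-fromℕ k))
                                                 (cong vx (sym b≡)))

      segment : VertexComponent G S′ w ⊎ PathComponent G S′ w
      segment =
        let (a , a≤j , run-a , stop-a)       = lower-end j₀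
            (b , j≤b , b≤ , run-b , stop-b) = upper-end (suc L ∸ j₀) j₀ (ℕₚ.m∸n+n≡m j₀≤)
        in Ends.result a b a≤j j≤b b≤ (λ i a≤i i<b → Sum.[ run-a i a≤i , (λ h → run-b i h i<b) ]′
                                                       (ℕₚ.<-≤-connex i j₀))
             stop-a stop-b (a ℕ.≟ b)

  multipath-⊆ : Multipath G S → Multipath G S′
  multipath-⊆ mp w with mp w
  ... | inj₁ C = inj₁ record
    { vertices = λ u c → VertexComponent.vertices C u (connected-⊆ c)
    ; edges    = λ e e∈ c → VertexComponent.edges C e (S′⊆S e∈) (connected-⊆ c)
    }
  ... | inj₂ C = Segment.segment w C

multipathComplex : (G : Digraph) → SimplicialComplex (Digraph.size G)
multipathComplex G = record
  { Simplex  = λ S → Multipath G S × Nonempty S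
  ; nonempty = proj₂
  ; down     = λ (mp , _) ne τ⊆σ → multipath-⊆ G τ⊆σ mp , ne
  }

module _ (G : Digraph) where
  open Digraph G

  incident inEdges outEdges : Vertex → Subset size
  incident w = Vec.tabulate λ e → does ((src e Fin.≟ w) ⊎-dec (tgt e Fin.≟ w))
  inEdges  w = Vec.tabulate λ e → does (tgt e Fin.≟ w)
  outEdges w = Vec.tabulate λ e → does (src e Fin.≟ w)

  record GluingSite (v t : Vertex) : Set where
    field
      no-loop   : ∀ e → ¬ (src e ≡ v × tgt e ≡ v)
      valence   : card (incident v) ≡ 3
      degree    : card (inEdges v) ≡ 1 ⊎ card (outEdges v) ≡ 1
      t≢v       : t ≢ v
      t-valence : card (incident t) ≡ 1

  record GluingA : Set where
    field
      v t  : Vertex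
      site : GluingSite v t
      edge : ∃[ e ] (src e ≡ v × tgt e ≡ t)
    open GluingSite site public

  record GluingB : Set where
    field
      v t  : Vertex
      site : GluingSite v t
      edge : ∃[ e ] (src e ≡ t × tgt e ≡ v)
    open GluingSite site public

  ∈incident : ∀ {w e} → src e ≡ w ⊎ tgt e ≡ w → e ∈ˢ incident w
  ∈incident {w} {e} h = Vecₚ.lookup⇒[]= e (incident w)
    (trans (Vecₚ.lookup∘tabulate _ e) (dec-true ((src e Fin.≟ w) ⊎-dec (tgt e Fin.≟ w)) h))

  unique-incident : ∀ {w e f} → card (incident w) ≡ 1 →
                    src e ≡ w ⊎ tgt e ≡ w → src f ≡ w ⊎ tgt f ≡ w → e ≡ f
  unique-incident {w} {e} {f} one he hf with f Fin.≟ e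
  ... | yes f≡e = sym f≡e
  ... | no  f≢e = ⊥-elim (ℕₚ.<-irrefl (trans (Subₚ.∣⁅x⁆∣≡1 e) (sym one)) (Subₚ.p⊂q⇒∣p∣<∣q∣
        ((λ x∈ → subst (_∈ˢ incident w) (sym (Subₚ.x∈⁅y⁆⇒x≡y e x∈)) (∈incident he)) ,
         f , ∈incident hf , λ f∈ → f≢e (Subₚ.x∈⁅y⁆⇒x≡y e f∈))))

  Vertex″ Edge″ : Set
  Vertex″ = Fin (2 ℕ.+ order)
  Edge″   = Fin (4 ℕ.+ size)

  -- Vertices of G in the glued digraph; 0 and 1 are the two new vertices.
  old : Vertex → Vertex″
  old = 2 Fin.↑ʳ_

  old-inj : ∀ {u w} → old u ≡ old w → u ≡ w
  old-inj = Finₚ.↑ʳ-injective 2 _ _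

  -- An edge e of G becomes 4 ↑ʳ e; the new edges are 0, 1, 2, 3.

  module GlueA (D : GluingA) where
    open GluingA D

    t₁ t₂ : Vertex″
    t₁ = zero
    t₂ = suc zero

    ends : Edge″ → Vertex″ × Vertex″
    ends zero                      = old t , old v
    ends (suc zero)                = t₁ , old t
    ends (suc (suc zero))          = old t , t₁
    ends (suc (suc (suc zero)))    = t₂ , t₁
    ends (suc (suc (suc (suc e)))) = old (src e) , old (tgt e)

    -- G has no edge (t , v) already.
    fresh : ∀ e → ¬ (t ≡ src e × v ≡ tgt e)
    fresh e (p , q) with edge
    ... | f , f-v , f-t with refl ← unique-incident t-valence (inj₁ (sym p)) (inj₂ f-t) =
      t≢v (trans p f-v)

    ends-inj : ∀ e f → proj₁ (ends e) ≡ proj₁ (ends f) → proj₂ (ends e) ≡ proj₂ (ends f) → e ≡ f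
    ends-inj zero zero _ _ = refl
    ends-inj zero (suc zero) () _
    ends-inj zero (suc (suc zero)) _ ()
    ends-inj zero (suc (suc (suc zero))) _ ()
    ends-inj zero (suc (suc (suc (suc f)))) p q = ⊥-elim (fresh f (old-inj p , old-inj q))
    ends-inj (suc zero) zero () _
    ends-inj (suc zero) (suc zero) _ _ = refl
    ends-inj (suc zero) (suc (suc zero)) () _
    ends-inj (suc zero) (suc (suc (suc zero))) () _
    ends-inj (suc zero) (suc (suc (suc (suc f)))) () _
    ends-inj (suc (suc zero)) zero _ ()
    ends-inj (suc (suc zero)) (suc zero) () _
    ends-inj (suc (suc zero)) (suc (suc zero)) _ _ = refl
    ends-inj (suc (suc zero)) (suc (suc (suc zero))) () _
    ends-inj (suc (suc zero)) (suc (suc (suc (suc f)))) _ ()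
    ends-inj (suc (suc (suc zero))) zero () _
    ends-inj (suc (suc (suc zero))) (suc zero) () _
    ends-inj (suc (suc (suc zero))) (suc (suc zero)) () _
    ends-inj (suc (suc (suc zero))) (suc (suc (suc zero))) _ _ = refl
    ends-inj (suc (suc (suc zero))) (suc (suc (suc (suc f)))) () _
    ends-inj (suc (suc (suc (suc e)))) zero p q =
      ⊥-elim (fresh e (sym (old-inj p) , sym (old-inj q)))
    ends-inj (suc (suc (suc (suc e)))) (suc zero) () _
    ends-inj (suc (suc (suc (suc e)))) (suc (suc zero)) _ ()
    ends-inj (suc (suc (suc (suc e)))) (suc (suc (suc zero))) () _
    ends-inj (suc (suc (suc (suc e)))) (suc (suc (suc (suc f)))) p q =
      cong (4 Fin.↑ʳ_) (simple (old-inj p) (old-inj q))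

    glued : Digraph
    glued = record
      { order  = 2 ℕ.+ order
      ; size   = 4 ℕ.+ size
      ; src    = proj₁ ∘ ends
      ; tgt    = proj₂ ∘ ends
      ; simple = λ {e} {f} → ends-inj e f
      }

    [t,t₁] [t₂,t₁] : Digraph.Edge glued
    [t,t₁]  = suc (suc zero)
    [t₂,t₁] = suc (suc (suc zero))

  module GlueB (D : GluingB) where
    open GluingB D

    v₂ v₃ : Vertex″
    v₂ = zero
    v₃ = suc zero

    ends : Edge″ → Vertex″ × Vertex″
    ends zero                      = old v , old t
    ends (suc zero)                = old t , v₂
    ends (suc (suc zero))          = v₂ , old t
    ends (suc (suc (suc zero)))    = v₂ , v₃
    ends (suc (suc (suc (suc e)))) = old (src e) , old (tgt e)

    -- G has no edge (v , t) already.
    fresh : ∀ e → ¬ (v ≡ src e × t ≡ tgt e)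
    fresh e (p , q) with edge
    ... | f , f-t , f-v with refl ← unique-incident t-valence (inj₂ (sym q)) (inj₁ f-t) =
      t≢v (trans q f-v)

    ends-inj : ∀ e f → proj₁ (ends e) ≡ proj₁ (ends f) → proj₂ (ends e) ≡ proj₂ (ends f) → e ≡ f
    ends-inj zero zero _ _ = refl
    ends-inj zero (suc zero) _ ()
    ends-inj zero (suc (suc zero)) () _
    ends-inj zero (suc (suc (suc zero))) () _
    ends-inj zero (suc (suc (suc (suc f)))) p q = ⊥-elim (fresh f (old-inj p , old-inj q))
    ends-inj (suc zero) zero _ ()
    ends-inj (suc zero) (suc zero) _ _ = refl
    ends-inj (suc zero) (suc (suc zero)) () _
    ends-inj (suc zero) (suc (suc (suc zero))) () _
    ends-inj (suc zero) (suc (suc (suc (suc f)))) _ ()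
    ends-inj (suc (suc zero)) zero () _
    ends-inj (suc (suc zero)) (suc zero) () _
    ends-inj (suc (suc zero)) (suc (suc zero)) _ _ = refl
    ends-inj (suc (suc zero)) (suc (suc (suc zero))) _ ()
    ends-inj (suc (suc zero)) (suc (suc (suc (suc f)))) () _
    ends-inj (suc (suc (suc zero))) zero () _
    ends-inj (suc (suc (suc zero))) (suc zero) () _
    ends-inj (suc (suc (suc zero))) (suc (suc zero)) _ ()
    ends-inj (suc (suc (suc zero))) (suc (suc (suc zero))) _ _ = refl
    ends-inj (suc (suc (suc zero))) (suc (suc (suc (suc f)))) () _
    ends-inj (suc (suc (suc (suc e)))) zero p q =
      ⊥-elim (fresh e (sym (old-inj p) , sym (old-inj q)))
    ends-inj (suc (suc (suc (suc e)))) (suc zero) _ ()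
    ends-inj (suc (suc (suc (suc e)))) (suc (suc zero)) () _
    ends-inj (suc (suc (suc (suc e)))) (suc (suc (suc zero))) () _
    ends-inj (suc (suc (suc (suc e)))) (suc (suc (suc (suc f)))) p q =
      cong (4 Fin.↑ʳ_) (simple (old-inj p) (old-inj q))

    glued : Digraph
    glued = record
      { order  = 2 ℕ.+ order
      ; size   = 4 ℕ.+ size
      ; src    = proj₁ ∘ ends
      ; tgt    = proj₂ ∘ ends
      ; simple = λ {e} {f} → ends-inj e f
      }

data TOperation (G : Digraph) : Digraph → Set where
  gluingA : (D : GluingA G) → TOperation G (GlueA.glued G D)
  gluingB : (D : GluingB G) → TOperation G (GlueB.glued G D)

-- The subcomplex {(t₂,t₁), (t,t₁)} ∗ X(G) on the edges of the glued digraph.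
suspensionSubcomplex : (G : Digraph) (D : GluingA G) → SimplicialComplex (4 ℕ.+ Digraph.size G)
suspensionSubcomplex G D =
  discrete (GlueA.[t₂,t₁] G D) (GlueA.[t,t₁] G D) ⋆ shift 4 (multipathComplex G)

{-# OPTIONS --safe #-}
module Submission where

open import Level using (0ℓ; lift; lower)
open import Data.Empty using (⊥; ⊥-elim)
open import Data.Unit using (⊤; tt)
open import Data.Product using (Σ; ∃-syntax; _×_; _,_; proj₁; proj₂)
open import Data.Sum as Sum using (_⊎_; inj₁; inj₂)
open import Data.Integer using (+_)
open import Data.Nat as ℕ using (ℕ; zero; suc; _∸_)
import Data.Nat.Properties as ℕₚ
open import Data.Fin as Fin using (Fin; zero; suc; toℕ; fromℕ; inject₁)
import Data.Fin.Properties as Finₚ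
open import Data.Fin.Induction using (<-weakInduction; >-weakInduction)
open import Data.Fin.Relation.Unary.Top using (view; ‵fromℕ; ‵inject₁)
open import Data.Fin.Subset using (Subset; Nonempty; inside; outside; ⁅_⁆) renaming (_∈_ to _∈ˢ_; _∉_ to _∉ˢ_; _⊆_ to _⊆ˢ_; _∪_ to _∪ˢ_; ⊥ to ∅ˢ)
import Data.Fin.Subset.Properties as Subₚ
open import Data.Vec using (_∷_; _++_; here; there)
open import Data.Vec.Functional using (Vector)
open import Data.Rational as ℚ using (ℚ; 0ℚ; 1ℚ; ½)
import Data.Rational.Properties as ℚₚ
open import Data.Rational.Solver using (module +-*-Solver)
open import Function using (_∘_; id; _⇔_; mk⇔; Equivalence)
open import Relation.Nullary using (yes; no)
open import Relation.Nullary.Decidable using (_×-dec_; from-yes)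
open import Relation.Unary using (Pred; _∩_)
open import Relation.Binary.PropositionalEquality using (_≡_; _≢_; refl; sym; trans; cong; cong₂; subst; subst₂)
open import Relation.Binary.Construct.Closure.ReflexiveTransitive using (_◅_; _◅◅_; reverse) renaming (ε to done)
open import Relation.Binary.Construct.Closure.Symmetric as SymC using (fwd; bwd)
open import Defs
open +-*-Solver using (solve; _:=_; _:+_; _:*_; :-_; _:-_; con)

-- Put δ = (t , t₁) and η = (t₂ , t₁).  A multipath of G″ without δ can be
-- extended by η, and one with δ contains no other new edge.  Hence X(G″) is
-- the union of the cone over X(G′) with apex δ and of a cone with apex η whose
-- base contains X(G′), and such a union is a suspension of X(G′): the
-- barycentric coordinate of δ determines the suspension coordinate, and the
-- remaining coordinates, renormalized, a point of X(G′).  Since {δ, η} ∗ X(G′)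
-- is a union of the same kind, the composite of the equivalences given by
-- these formulas is an inverse of its inclusion into X(G″).  Multipaths are
-- characterized as the edge sets without branching and cycles; this is
-- symmetric under reversal of all edges, which exchanges (A) and (B).
--
-- A map to a realization has to find a simplex supporting its value, although
-- s ≤ ½ is undecidable for a real s.  Therefore the formulas are such
-- that only overlapping cases, like s ≤ ⅔ and ⅓ ≤ s, have to be distinguished.

-- Rational arithmetic

-- The constants depend on each other. Where the δ-coordinate is at most ¾, the other coordinates
-- sum to at least ¼, the range in which `inv` is the true inverse. From ⅝ on, with a margin of ⅛ to
-- spare, `ht` is 1 and the point of X(G′) no longer matters; ⅝ < ¾ is the overlap that a decision
-- needs. Since `ht` also vanishes up to ¼, all points near a simplex point without δ can be sent to
-- one pole, whatever their other coordinates. The price of these flat pieces is that the composite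
-- on the suspension is not the identity but rescales the suspension coordinate by `ht ∘ hi`.
-- Undoing this takes a homotopy on the product of a quotient with 𝕀, whose continuity does not
-- follow from continuity before passing to the quotient; it is proved by hand. On the side of the
-- complex, the homotopy is a formula in barycentric coordinates that does not mention the complex.
-- Hence one computation serves both the suspension and the inclusion, and only supports have to be
-- checked in each complex.

⅛ ¼ ⅓ ⅜ ⅝ ⅔ ¾ 3ℚ 4ℚ : ℚ
⅓ = + 1 ℚ./ 3
⅔ = + 2 ℚ./ 3
¼ = + 1 ℚ./ 4
⅛ = + 1 ℚ./ 8
⅜ = + 3 ℚ./ 8
⅝ = + 5 ℚ./ 8
¾ = + 3 ℚ./ 4
3ℚ = + 3 ℚ./ 1
4ℚ = + 4 ℚ./ 1

*-nonNeg : ∀ {p q} → 0ℚ ℚ.≤ p → 0ℚ ℚ.≤ q → 0ℚ ℚ.≤ p ℚ.* q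
*-nonNeg {p} {q} 0≤p 0≤q =
  subst (ℚ._≤ p ℚ.* q) (ℚₚ.*-zeroʳ p) (ℚₚ.*-monoˡ-≤-nonNeg p ⦃ ℚ.nonNegative 0≤p ⦄ 0≤q)

*-monoʳ : ∀ {p q r} → 0ℚ ℚ.≤ r → p ℚ.≤ q → r ℚ.* p ℚ.≤ r ℚ.* q
*-monoʳ {r = r} 0≤r = ℚₚ.*-monoˡ-≤-nonNeg r ⦃ ℚ.nonNegative 0≤r ⦄

*-monoˡ : ∀ {p q r} → 0ℚ ℚ.≤ r → p ℚ.≤ q → p ℚ.* r ℚ.≤ q ℚ.* r
*-monoˡ {r = r} 0≤r = ℚₚ.*-monoʳ-≤-nonNeg r ⦃ ℚ.nonNegative 0≤r ⦄

p≤q⇒0≤q-p : ∀ {p q} → p ℚ.≤ q → 0ℚ ℚ.≤ q ℚ.- p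
p≤q⇒0≤q-p {p} {q} h = subst (ℚ._≤ q ℚ.- p) (ℚₚ.+-inverseʳ p) (ℚₚ.+-monoˡ-≤ (ℚ.- p) h)

0≤q-p⇒p≤q : ∀ {p q} → 0ℚ ℚ.≤ q ℚ.- p → p ℚ.≤ q
0≤q-p⇒p≤q {p} {q} h = subst₂ ℚ._≤_ (ℚₚ.+-identityˡ p)
  (solve 2 (λ p q → (q :- p) :+ p := q) refl p q) (ℚₚ.+-monoˡ-≤ p h)

p<q⇒0<q-p : ∀ {p q} → p ℚ.< q → 0ℚ ℚ.< q ℚ.- p
p<q⇒0<q-p {p} {q} h = subst (ℚ._< q ℚ.- p) (ℚₚ.+-inverseʳ p) (ℚₚ.+-monoˡ-< (ℚ.- p) h)

+-cancelʳ-< : ∀ r {p q} → p ℚ.+ r ℚ.< q ℚ.+ r → p ℚ.< q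
+-cancelʳ-< r {p} {q} h = subst₂ ℚ._<_ (cancel p) (cancel q) (ℚₚ.+-monoˡ-< (ℚ.- r) h)
  where
  cancel : ∀ p → p ℚ.+ r ℚ.- r ≡ p
  cancel p = solve 2 (λ p r → p :+ r :- r := p) refl p r

∣-∣<⇒<+ : ∀ p q {e} → ℚ.∣ p ℚ.- q ∣ ℚ.< e → p ℚ.< q ℚ.+ e
∣-∣<⇒<+ p q {e} h = subst (ℚ._< q ℚ.+ e) (solve 2 (λ p q → q :+ (p :- q) := p) refl p q)
  (ℚₚ.+-monoʳ-< q (ℚₚ.≤-<-trans (p≤∣p∣ _) h))

<+⇒∣-∣< : ∀ p q {e} → p ℚ.< q ℚ.+ e → q ℚ.< p ℚ.+ e → ℚ.∣ p ℚ.- q ∣ ℚ.< e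
<+⇒∣-∣< p q {e} h k with ℚₚ.∣p∣≡p∨∣p∣≡-p (p ℚ.- q)
... | inj₁ eq = subst (ℚ._< e) (sym eq) (subst (p ℚ.- q ℚ.<_)
      (solve 2 (λ q e → (q :+ e) :- q := e) refl q e) (ℚₚ.+-monoˡ-< (ℚ.- q) h))
... | inj₂ eq = subst (ℚ._< e) (sym eq) (subst₂ ℚ._<_ (solve 2 (λ p q → q :- p := :- (p :- q)) refl p q)
      (solve 2 (λ q e → (q :+ e) :- q := e) refl p e) (ℚₚ.+-monoˡ-< (ℚ.- p) k))

0≤1ℚ : 0ℚ ℚ.≤ 1ℚ
0≤1ℚ = ℚₚ.nonNegative⁻¹ 1ℚ

divide : ∀ {B ε} → 0ℚ ℚ.< B → 0ℚ ℚ.< ε → ∃[ δ ] (0ℚ ℚ.< δ × B ℚ.* δ ≡ ε)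
divide {B} {ε} B>0 ε>0 = δ , δ>0 , eq
  where
  instance
    B⁺ : ℚ.Positive B
    B⁺ = ℚ.positive B>0
    B≠0 : ℚ.NonZero B
    B≠0 = ℚₚ.pos⇒nonZero B
  δ : ℚ
  δ = ℚ.1/ B ℚ.* ε
  δ>0 : 0ℚ ℚ.< δ
  δ>0 = ℚₚ.positive⁻¹ δ ⦃ ℚₚ.pos*pos⇒pos (ℚ.1/ B) ⦃ ℚₚ.1/pos⇒pos B ⦄ ε ⦃ ℚ.positive ε>0 ⦄ ⦄
  eq : B ℚ.* δ ≡ ε
  eq = trans (sym (ℚₚ.*-assoc B (ℚ.1/ B) ε))
             (trans (cong (ℚ._* ε) (ℚₚ.*-inverseʳ B)) (ℚₚ.*-identityˡ ε))

-- Termwise application to a Cauchy sequence needs uniform continuity; Lipschitz bounds provide it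
-- and compose without further estimates.
record Lipschitz (φ : ℚ → ℚ) : Set where
  constructor lipschitz
  field
    constant   : ℚ
    constant>0 : 0ℚ ℚ.< constant
    bound      : ∀ p q → ℚ.∣ φ p ℚ.- φ q ∣ ℚ.≤ constant ℚ.* ℚ.∣ p ℚ.- q ∣
open Lipschitz

Lipschitz-∘ : ∀ {φ χ} → Lipschitz φ → Lipschitz χ → Lipschitz (φ ∘ χ)
Lipschitz-∘ {φ} {χ} (lipschitz C C>0 f) (lipschitz D D>0 g) = lipschitz (C ℚ.* D)
  (ℚₚ.positive⁻¹ _ ⦃ ℚₚ.pos*pos⇒pos C ⦃ ℚ.positive C>0 ⦄ D ⦃ ℚ.positive D>0 ⦄ ⦄)
  λ p q → ℚₚ.≤-trans (f (χ p) (χ q))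
    (ℚₚ.≤-trans (*-monoʳ (ℚₚ.<⇒≤ C>0) (g p q)) (ℚₚ.≤-reflexive (sym (ℚₚ.*-assoc C D _))))

Lipschitz-uniform : ∀ {φ} → Lipschitz φ → ∀ {ε} → 0ℚ ℚ.< ε → ∃[ δ ] (0ℚ ℚ.< δ ×
  ∀ p q → ℚ.∣ p ℚ.- q ∣ ℚ.< δ → ℚ.∣ φ p ℚ.- φ q ∣ ℚ.< ε)
Lipschitz-uniform (lipschitz C C>0 f) ε>0 = let (δ , δ>0 , Cδ≡ε) = divide C>0 ε>0 in
  δ , δ>0 , λ p q h → ℚₚ.≤-<-trans (f p q)
    (subst (C ℚ.* _ ℚ.<_) Cδ≡ε (ℚₚ.*-monoʳ-<-pos C ⦃ ℚ.positive C>0 ⦄ h))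

-- Once p and q are ordered, both absolute values resolve, so a one-sided slope bound is enough.
increasing⇒Lipschitz : ∀ {φ C} → 0ℚ ℚ.< C → (∀ {p q} → p ℚ.≤ q → φ p ℚ.≤ φ q) →
  (∀ {p q} → p ℚ.≤ q → φ q ℚ.≤ φ p ℚ.+ C ℚ.* (q ℚ.- p)) → Lipschitz φ
increasing⇒Lipschitz {φ} {C} C>0 mono slope = lipschitz C C>0 λ p q →
  Sum.[ (λ p≤q → subst₂ ℚ._≤_ (∣-∣-sym (φ q) (φ p)) (cong (C ℚ.*_) (∣-∣-sym q p)) (ordered p≤q))
      , ordered ]′ (ℚₚ.≤-total p q)
  where
  ordered : ∀ {p q} → p ℚ.≤ q → ℚ.∣ φ q ℚ.- φ p ∣ ℚ.≤ C ℚ.* ℚ.∣ q ℚ.- p ∣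
  ordered {p} {q} p≤q
    rewrite ℚₚ.0≤p⇒∣p∣≡p (p≤q⇒0≤q-p (mono p≤q)) | ℚₚ.0≤p⇒∣p∣≡p (p≤q⇒0≤q-p p≤q) =
    subst (φ q ℚ.- φ p ℚ.≤_)
      (solve 2 (λ a b → (a :+ b) :- a := b) refl (φ p) (C ℚ.* (q ℚ.- p)))
      (ℚₚ.+-monoˡ-≤ (ℚ.- φ p) (slope p≤q))

unit : ℚ → ℚ
unit q = 0ℚ ℚ.⊔ (q ℚ.⊓ 1ℚ)

unit-mono : ∀ {p q} → p ℚ.≤ q → unit p ℚ.≤ unit q
unit-mono p≤q = ℚₚ.⊔-mono-≤ (ℚₚ.≤-refl {0ℚ}) (ℚₚ.⊓-mono-≤ p≤q (ℚₚ.≤-refl {1ℚ}))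

0≤unit : ∀ q → 0ℚ ℚ.≤ unit q
0≤unit q = ℚₚ.p≤p⊔q 0ℚ (q ℚ.⊓ 1ℚ)

unit≤1 : ∀ q → unit q ℚ.≤ 1ℚ
unit≤1 q = ℚₚ.⊔-lub 0≤1ℚ (ℚₚ.p⊓q≤q q 1ℚ)

unit≡0 : ∀ {q} → q ℚ.≤ 0ℚ → unit q ≡ 0ℚ
unit≡0 {q} h = ℚₚ.≤-antisym (unit-mono h) (0≤unit q)

unit≡1 : ∀ {q} → 1ℚ ℚ.≤ q → unit q ≡ 1ℚ
unit≡1 {q} h = ℚₚ.≤-antisym (unit≤1 q) (unit-mono h)

unit-Lipschitz : Lipschitz unit
unit-Lipschitz = increasing⇒Lipschitz (ℚₚ.positive⁻¹ 1ℚ) unit-mono λ {p} {q} p≤q →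
  let 0≤d = subst (0ℚ ℚ.≤_) (sym (ℚₚ.*-identityˡ (q ℚ.- p))) (p≤q⇒0≤q-p p≤q) in
  ℚₚ.⊔-lub (ℚₚ.+-mono-≤ (0≤unit p) 0≤d)
    (ℚₚ.≤-trans (⊓-slope p q _ (ℚₚ.≤-reflexive (solve 2 (λ p q → q := p :+ con 1ℚ :* (q :- p)) refl p q)) 0≤d)
      (ℚₚ.+-monoˡ-≤ _ (ℚₚ.p≤q⊔p 0ℚ (p ℚ.⊓ 1ℚ))))
  where
  ⊓-slope : ∀ p q d → q ℚ.≤ p ℚ.+ d → 0ℚ ℚ.≤ d → q ℚ.⊓ 1ℚ ℚ.≤ (p ℚ.⊓ 1ℚ) ℚ.+ d
  ⊓-slope p q d h 0≤d with ℚₚ.⊓-sel p 1ℚ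
  ... | inj₁ eq rewrite eq = ℚₚ.≤-trans (ℚₚ.p⊓q≤p q 1ℚ) h
  ... | inj₂ eq rewrite eq = ℚₚ.≤-trans (ℚₚ.p⊓q≤q q 1ℚ) (ℚₚ.+-mono-≤ (ℚₚ.≤-refl {1ℚ}) 0≤d)

ramp : ℚ → ℚ → ℚ → ℚ
ramp c d q = c ℚ.* (q ℚ.- d)

ramp-mono : ∀ {c} d {p q} → 0ℚ ℚ.≤ c → p ℚ.≤ q → ramp c d p ℚ.≤ ramp c d q
ramp-mono d 0≤c p≤q = *-monoʳ 0≤c (ℚₚ.+-monoˡ-≤ (ℚ.- d) p≤q)

ramp-Lipschitz : ∀ {c} d → 0ℚ ℚ.< c → Lipschitz (ramp c d)
ramp-Lipschitz {c} d c>0 = increasing⇒Lipschitz c>0 (ramp-mono d (ℚₚ.<⇒≤ c>0)) λ {p} {q} _ →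
  ℚₚ.≤-reflexive (solve 4 (λ c d p q → c :* (q :- d) := c :* (p :- d) :+ c :* (q :- p)) refl c d p q)

neg-Lipschitz : Lipschitz (ℚ.-_)
neg-Lipschitz = lipschitz 1ℚ (ℚₚ.positive⁻¹ 1ℚ) λ p q → ℚₚ.≤-reflexive
  (trans (cong ℚ.∣_∣ (solve 2 (λ p q → :- p :- :- q := :- (p :- q)) refl p q))
    (trans (ℚₚ.∣-p∣≡∣p∣ (p ℚ.- q)) (sym (ℚₚ.*-identityˡ _))))

-- On [0, 1], hi rises from 0 to 1 on [⅔, 1], lo falls from 1 to 0 on [0, ⅓],
-- and ht rises from 0 to 1 on [¼, ½].
hi lo ht : ℚ → ℚ
hi q = unit (ramp 3ℚ ⅔ q)
lo q = hi (1ℚ ℚ.- q)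
ht q = unit (ramp 4ℚ ¼ q)

1-_ : ℚ → ℚ
1- q = 1ℚ ℚ.- q

1-Lipschitz : Lipschitz 1-_
1-Lipschitz = lipschitz 1ℚ (ℚₚ.positive⁻¹ 1ℚ) λ p q → ℚₚ.≤-reflexive
  (trans (cong ℚ.∣_∣ (solve 2 (λ p q → (con 1ℚ :- p) :- (con 1ℚ :- q) := :- (p :- q)) refl p q))
    (trans (ℚₚ.∣-p∣≡∣p∣ (p ℚ.- q)) (sym (ℚₚ.*-identityˡ _))))

hi-Lipschitz : Lipschitz hi
hi-Lipschitz = Lipschitz-∘ unit-Lipschitz (ramp-Lipschitz ⅔ (ℚₚ.positive⁻¹ 3ℚ))

lo-Lipschitz : Lipschitz lo
lo-Lipschitz = Lipschitz-∘ hi-Lipschitz 1-Lipschitz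

ht-Lipschitz : Lipschitz ht
ht-Lipschitz = Lipschitz-∘ unit-Lipschitz (ramp-Lipschitz ¼ (ℚₚ.positive⁻¹ 4ℚ))

hi≡0 : ∀ {q} → q ℚ.≤ ⅔ → hi q ≡ 0ℚ
hi≡0 h = unit≡0 (ramp-mono ⅔ (ℚₚ.nonNegative⁻¹ 3ℚ) h)

lo≡0 : ∀ {q} → ⅓ ℚ.≤ q → lo q ≡ 0ℚ
lo≡0 h = hi≡0 (ℚₚ.+-monoʳ-≤ 1ℚ (ℚₚ.neg-antimono-≤ h))

ht≡0 : ∀ {q} → q ℚ.≤ ¼ → ht q ≡ 0ℚ
ht≡0 h = unit≡0 (ramp-mono ¼ (ℚₚ.nonNegative⁻¹ 4ℚ) h)

ht≡1 : ∀ {q} → ½ ℚ.≤ q → ht q ≡ 1ℚ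
ht≡1 h = unit≡1 (ramp-mono ¼ (ℚₚ.nonNegative⁻¹ 4ℚ) h)

⊔¼-positive : ∀ q → ℚ.Positive (q ℚ.⊔ ¼)
⊔¼-positive q = ℚ.positive (ℚₚ.<-≤-trans (ℚₚ.positive⁻¹ ¼) (ℚₚ.p≤q⊔p q ¼))

-- The inverse, except that arguments below ¼ are replaced by ¼.
inv : ℚ → ℚ
inv q = (ℚ.1/ (q ℚ.⊔ ¼)) ⦃ ℚₚ.pos⇒nonZero (q ℚ.⊔ ¼) ⦃ ⊔¼-positive q ⦄ ⦄

inv-⊔ : ∀ q → inv q ℚ.* (q ℚ.⊔ ¼) ≡ 1ℚ
inv-⊔ q = ℚₚ.*-inverseˡ (q ℚ.⊔ ¼) ⦃ ℚₚ.pos⇒nonZero (q ℚ.⊔ ¼) ⦃ ⊔¼-positive q ⦄ ⦄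

inv-* : ∀ {q} → ¼ ℚ.≤ q → inv q ℚ.* q ≡ 1ℚ
inv-* {q} h = trans (cong (inv q ℚ.*_) (sym (ℚₚ.p≥q⇒p⊔q≡p h))) (inv-⊔ q)

0≤inv : ∀ q → 0ℚ ℚ.≤ inv q
0≤inv q = ℚₚ.<⇒≤ (ℚₚ.positive⁻¹ (inv q) ⦃ ℚₚ.1/pos⇒pos (q ℚ.⊔ ¼) ⦃ ⊔¼-positive q ⦄ ⦄)

inv≤4 : ∀ q → inv q ℚ.≤ 4ℚ
inv≤4 q = subst₂ ℚ._≤_ (solve 1 (λ i → con 4ℚ :* (i :* con ¼) := i) refl (inv q))
  (cong (4ℚ ℚ.*_) (inv-⊔ q))
  (*-monoʳ {r = 4ℚ} (ℚₚ.nonNegative⁻¹ 4ℚ) (*-monoʳ (0≤inv q) (ℚₚ.p≤q⊔p q ¼)))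

⊔¼-Lipschitz : Lipschitz (ℚ._⊔ ¼)
⊔¼-Lipschitz = increasing⇒Lipschitz (ℚₚ.positive⁻¹ 1ℚ) (λ p≤q → ℚₚ.⊔-mono-≤ p≤q (ℚₚ.≤-refl {¼}))
  λ {p} {q} p≤q → ℚₚ.⊔-lub
    (ℚₚ.≤-trans (ℚₚ.≤-reflexive (solve 2 (λ p q → q := p :+ con 1ℚ :* (q :- p)) refl p q))
      (ℚₚ.+-monoˡ-≤ _ (ℚₚ.p≤p⊔q p ¼)))
    (ℚₚ.+-mono-≤ (ℚₚ.p≤q⊔p p ¼) (subst (0ℚ ℚ.≤_) (sym (ℚₚ.*-identityˡ (q ℚ.- p))) (p≤q⇒0≤q-p p≤q)))

-- For the truncated arguments x and y, 1/x - 1/y = (1/x)(1/y)(y - x), and both inverses are at most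
-- 4.
inv-Lipschitz : Lipschitz inv
inv-Lipschitz = lipschitz (4ℚ ℚ.* 4ℚ) (ℚₚ.positive⁻¹ (4ℚ ℚ.* 4ℚ)) λ p q →
  let a = inv p ; b = inv q ; x = p ℚ.⊔ ¼ ; y = q ℚ.⊔ ¼
      0≤4 = ℚₚ.nonNegative⁻¹ 4ℚ
      eq : a ℚ.- b ≡ (a ℚ.* b) ℚ.* (y ℚ.- x)
      eq = trans (cong₂ ℚ._-_ (trans (sym (ℚₚ.*-identityʳ a)) (cong (a ℚ.*_) (sym (inv-⊔ q))))
                              (trans (sym (ℚₚ.*-identityʳ b)) (cong (b ℚ.*_) (sym (inv-⊔ p)))))
             (solve 4 (λ a b x y → a :* (b :* y) :- b :* (a :* x) := (a :* b) :* (y :- x)) refl a b x y)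
      y-x : ℚ.∣ y ℚ.- x ∣ ℚ.≤ ℚ.∣ p ℚ.- q ∣
      y-x = subst₂ ℚ._≤_ (∣-∣-sym x y) (ℚₚ.*-identityˡ _) (bound ⊔¼-Lipschitz p q)
  in ℚₚ.≤-trans (ℚₚ.≤-reflexive (trans (cong ℚ.∣_∣ eq) (trans (ℚₚ.∣p*q∣≡∣p∣*∣q∣ (a ℚ.* b) (y ℚ.- x))
        (cong (ℚ._* ℚ.∣ y ℚ.- x ∣) (ℚₚ.0≤p⇒∣p∣≡p (*-nonNeg (0≤inv p) (0≤inv q)))))))
     (ℚₚ.≤-trans (*-monoˡ (ℚₚ.0≤∣p∣ _) (ℚₚ.≤-trans (*-monoˡ (0≤inv q) (inv≤4 p)) (*-monoʳ 0≤4 (inv≤4 q))))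
       (*-monoʳ (ℚₚ.nonNegative⁻¹ (4ℚ ℚ.* 4ℚ)) y-x))

lerp : ℚ → ℚ → ℚ → ℚ
lerp u p q = p ℚ.+ unit u ℚ.* (q ℚ.+ ℚ.- p)

lerp-sym : ∀ u p q → lerp u p q ≡ (1ℚ ℚ.- unit u) ℚ.* p ℚ.+ unit u ℚ.* q
lerp-sym u p q = solve 3 (λ c p q → p :+ c :* (q :- p) := (con 1ℚ :- c) :* p :+ c :* q) refl (unit u) p q

lerp-≥ : ∀ {c p q} u → c ℚ.≤ p → c ℚ.≤ q → c ℚ.≤ lerp u p q
lerp-≥ {c} {p} {q} u c≤p c≤q = subst₂ ℚ._≤_
  (solve 2 (λ u c → (con 1ℚ :- u) :* c :+ u :* c := c) refl (unit u) c) (sym (lerp-sym u p q))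
  (ℚₚ.+-mono-≤ (*-monoʳ (p≤q⇒0≤q-p (unit≤1 u)) c≤p) (*-monoʳ (0≤unit u) c≤q))

lerp-≤ : ∀ {c p q} u → p ℚ.≤ c → q ℚ.≤ c → lerp u p q ℚ.≤ c
lerp-≤ {c} {p} {q} u p≤c q≤c = subst₂ ℚ._≤_ (sym (lerp-sym u p q))
  (solve 2 (λ u c → (con 1ℚ :- u) :* c :+ u :* c := c) refl (unit u) c)
  (ℚₚ.+-mono-≤ (*-monoʳ (p≤q⇒0≤q-p (unit≤1 u)) p≤c) (*-monoʳ (0≤unit u) q≤c))

-- By ab - a′b′ = a(b - b′) + b′(a - a′), one unprimed and one primed factor have to be bounded.
*-close : ∀ {a b a′ b′ B δ ε} → 0ℚ ℚ.< B → B ℚ.* δ ≡ ½ ℚ.* ε → ℚ.∣ a ∣ ℚ.≤ B → ℚ.∣ b′ ∣ ℚ.≤ B →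
  ℚ.∣ a ℚ.- a′ ∣ ℚ.< δ → ℚ.∣ b ℚ.- b′ ∣ ℚ.< δ → ℚ.∣ a ℚ.* b ℚ.- a′ ℚ.* b′ ∣ ℚ.< ε
*-close {a} {b} {a′} {b′} {B} {δ} {ε} B>0 Bδ a≤B b′≤B ha hb = split-half _ _ _
  (solve 4 (λ a b a′ b′ → a :* b :- a′ :* b′ := a :* (b :- b′) :+ b′ :* (a :- a′)) refl a b a′ b′)
  (part a≤B hb) (part b′≤B ha)
  where
  part : ∀ {c d} → ℚ.∣ c ∣ ℚ.≤ B → ℚ.∣ d ∣ ℚ.< δ → ℚ.∣ c ℚ.* d ∣ ℚ.< ½ ℚ.* ε
  part {c} {d} c≤B d<δ = subst₂ ℚ._<_ (sym (ℚₚ.∣p*q∣≡∣p∣*∣q∣ c d)) Bδ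
    (ℚₚ.≤-<-trans (*-monoˡ (ℚₚ.0≤∣p∣ d) c≤B) (ℚₚ.*-monoʳ-<-pos B ⦃ ℚ.positive B>0 ⦄ d<δ))

-- Real arithmetic

ev-map : ∀ {P Q} → (∀ n → P n → Q n) → Eventually P → Eventually Q
ev-map f (N , h) = N , λ n N≤n → f n (h n N≤n)

ev-zip : ∀ {P Q R} → (∀ n → P n → Q n → R n) → Eventually P → Eventually Q → Eventually R
ev-zip f (M , h) (N , k) = M ℕ.⊔ N , λ n hn →
  f n (h n (ℕₚ.m⊔n≤o⇒m≤o M N hn)) (k n (ℕₚ.m⊔n≤o⇒n≤o M N hn))

eventual : ∀ {x y} → Eventually (λ n → seq x n ≡ seq y n) → x ≃ y
eventual {x} {y} h = equal λ ε ε>0 →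
  ev-map (λ n eq → subst (λ q → ℚ.∣ seq x n ℚ.- q ∣ ℚ.< ε) eq (∣p-p∣<ε (seq x n) ε>0)) h

termwise : ∀ {x y} → (∀ n → seq x n ≡ seq y n) → x ≃ y
termwise h = eventual (0 , λ n _ → h n)

-- `Near` asks for a gap uniform in n, `Close` does not. Estimates are made with `Close`; half of ε
-- pays for the gap on the way back to `Near`.
record Close (ε : ℚ) (x y : ℝ) : Set where
  constructor close
  field
    within : Eventually λ n → ℚ.∣ seq x n ℚ.- seq y n ∣ ℚ.< ε
open Close

≃⇒Close : ∀ {ε x y} → 0ℚ ℚ.< ε → x ≃ y → Close ε x y
≃⇒Close ε>0 (equal h) = close (h _ ε>0)

Close⇒≃ : ∀ {x y} → (∀ ε → 0ℚ ℚ.< ε → Close ε x y) → x ≃ y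
Close⇒≃ h = equal λ ε ε>0 → within (h ε ε>0)

Close-sym : ∀ {ε x y} → Close ε x y → Close ε y x
Close-sym {ε} {x} {y} (close h) = close (ev-map (λ n → subst (ℚ._< ε) (∣-∣-sym (seq x n) (seq y n))) h)

Close-mono : ∀ {δ ε x y} → δ ℚ.≤ ε → Close δ x y → Close ε x y
Close-mono δ≤ε (close h) = close (ev-map (λ n k → ℚₚ.<-≤-trans k δ≤ε) h)

Close-trans : ∀ {ε x y z} → Close (½ ℚ.* ε) x y → Close (½ ℚ.* ε) y z → Close ε x z
Close-trans {ε} {x} {y} {z} (close h) (close k) = close (ev-zip
  (λ n → split-half _ _ _ (solve 3 (λ a b c → a :- c := (a :- b) :+ (b :- c)) refl (seq x n) (seq y n) (seq z n)))
  h k)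

<+⇒ev : ∀ {ε x y} → x < y + fromℚ ε → Eventually λ n → seq x n ℚ.< seq y n ℚ.+ ε
<+⇒ev {ε} {x} {y} (less g g>0 h) = ev-map
  (λ n k → ℚₚ.<-≤-trans (subst (ℚ._< seq x n ℚ.+ g) (ℚₚ.+-identityʳ _) (ℚₚ.+-monoʳ-< (seq x n) g>0)) k) h

Near⇒Close : ∀ {ε x y} → Near ε x y → Close ε x y
Near⇒Close {x = x} {y} (near h k) = close (ev-zip (λ n → <+⇒∣-∣< (seq x n) (seq y n)) (<+⇒ev h) (<+⇒ev k))

Close⇒Near : ∀ {ε x y} → 0ℚ ℚ.< ε → Close (½ ℚ.* ε) x y → Near ε x y
Close⇒Near {ε} {x} {y} ε>0 h = near (half h) (half (Close-sym h))
  where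
  half : ∀ {x y} → Close (½ ℚ.* ε) x y → x < y + fromℚ ε
  half {x} {y} (close h) = less (½ ℚ.* ε) (half>0 ε>0) (ev-map
    (λ n k → ℚₚ.≤-trans (ℚₚ.<⇒≤ (ℚₚ.+-monoˡ-< (½ ℚ.* ε) (∣-∣<⇒<+ (seq x n) (seq y n) k)))
      (ℚₚ.≤-reflexive (solve 2 (λ y e → (y :+ con ½ :* e) :+ con ½ :* e := y :+ e) refl (seq y n) ε))) h)

half≤ : ∀ {ε} → 0ℚ ℚ.< ε → ½ ℚ.* ε ℚ.≤ ε
half≤ {ε} ε>0 = subst (½ ℚ.* ε ℚ.≤_) (ℚₚ.*-identityˡ ε)
  (*-monoˡ (ℚₚ.<⇒≤ ε>0) (ℚₚ.≤ᵇ⇒≤ {½} {1ℚ} _))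

-- Which of two overlapping half-lines contains x is decidable, unlike x ≤ p.
compare : ∀ x {p q} → p ℚ.< q →
  Eventually (λ n → seq x n ℚ.≤ q) ⊎ Eventually (λ n → p ℚ.≤ seq x n)
compare x {p} {q} p<q with cauchy x _ (half>0 (p<q⇒0<q-p p<q))
... | N , h with seq x N ℚ.≤? p ℚ.+ ½ ℚ.* (q ℚ.- p)
... | yes x≤ = inj₁ (N , λ n N≤n → ℚₚ.≤-trans (ℚₚ.<⇒≤ (∣-∣<⇒<+ (seq x n) (seq x N) (h n N N≤n ℕₚ.≤-refl)))
      (ℚₚ.≤-trans (ℚₚ.+-monoˡ-≤ (½ ℚ.* (q ℚ.- p)) x≤) (ℚₚ.≤-reflexive
        (solve 2 (λ p q → (p :+ con ½ :* (q :- p)) :+ con ½ :* (q :- p) := q) refl p q))))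
... | no  x≰ = inj₂ (N , λ n N≤n → ℚₚ.<⇒≤ (+-cancelʳ-< (½ ℚ.* (q ℚ.- p))
      (ℚₚ.<-trans (ℚₚ.≰⇒> x≰) (∣-∣<⇒<+ (seq x N) (seq x n) (h N n ℕₚ.≤-refl N≤n)))))

bounded : ∀ x → ∃[ B ] (0ℚ ℚ.< B × Eventually λ n → ℚ.∣ seq x n ∣ ℚ.≤ B)
bounded x with cauchy x 1ℚ (ℚₚ.positive⁻¹ 1ℚ)
... | N , h = ℚ.∣ seq x N ∣ ℚ.+ 1ℚ , ℚₚ.+-mono-≤-< (ℚₚ.0≤∣p∣ (seq x N)) (ℚₚ.positive⁻¹ 1ℚ) , N , λ n N≤n →
  ℚₚ.≤-trans (ℚₚ.≤-reflexive (cong ℚ.∣_∣ (solve 2 (λ a b → a := b :+ (a :- b)) refl (seq x n) (seq x N))))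
    (ℚₚ.≤-trans (ℚₚ.∣p+q∣≤∣p∣+∣q∣ (seq x N) _) (ℚₚ.+-monoʳ-≤ ℚ.∣ seq x N ∣ (ℚₚ.<⇒≤ (h n N N≤n ℕₚ.≤-refl))))

abstract
  ap-cauchy : ∀ {φ} → Lipschitz φ → ∀ x ε → 0ℚ ℚ.< ε → ∃[ N ] ∀ m n → N ℕ.≤ m → N ℕ.≤ n →
              ℚ.∣ φ (seq x m) ℚ.- φ (seq x n) ∣ ℚ.< ε
  ap-cauchy L x ε ε>0 =
    let (δ , δ>0 , u) = Lipschitz-uniform L ε>0
        (N , h) = cauchy x δ δ>0
    in N , λ m n N≤m N≤n → u _ _ (h m n N≤m N≤n)

  *-cauchy : ∀ x y ε → 0ℚ ℚ.< ε → ∃[ N ] ∀ m n → N ℕ.≤ m → N ℕ.≤ n →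
             ℚ.∣ seq x m ℚ.* seq y m ℚ.- seq x n ℚ.* seq y n ∣ ℚ.< ε
  *-cauchy x y ε ε>0 =
    let (B , B>0 , K , b) = bounded x
        (C , C>0 , L , c) = bounded y
        D = B ℚ.+ C
        (δ , δ>0 , Dδ) = divide {D} (ℚₚ.+-mono-< B>0 C>0) (half>0 ε>0)
        (M , f) = cauchy x δ δ>0
        (N , g) = cauchy y δ δ>0
    in (K ℕ.⊔ L) ℕ.⊔ (M ℕ.⊔ N) , λ m n hm hn →
       *-close {B = D} (ℚₚ.+-mono-< B>0 C>0) Dδ
         (ℚₚ.≤-trans (b m (ℕₚ.m⊔n≤o⇒m≤o K L (ℕₚ.m⊔n≤o⇒m≤o (K ℕ.⊔ L) (M ℕ.⊔ N) hm)))
           (subst (ℚ._≤ D) (ℚₚ.+-identityʳ B) (ℚₚ.+-monoʳ-≤ B (ℚₚ.<⇒≤ C>0))))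
         (ℚₚ.≤-trans (c n (ℕₚ.m⊔n≤o⇒n≤o K L (ℕₚ.m⊔n≤o⇒m≤o (K ℕ.⊔ L) (M ℕ.⊔ N) hn)))
           (subst (ℚ._≤ D) (ℚₚ.+-identityˡ C) (ℚₚ.+-monoˡ-≤ C (ℚₚ.<⇒≤ B>0))))
         (f m n (ℕₚ.m⊔n≤o⇒m≤o M N (ℕₚ.m⊔n≤o⇒n≤o (K ℕ.⊔ L) (M ℕ.⊔ N) hm))
                (ℕₚ.m⊔n≤o⇒m≤o M N (ℕₚ.m⊔n≤o⇒n≤o (K ℕ.⊔ L) (M ℕ.⊔ N) hn)))
         (g m n (ℕₚ.m⊔n≤o⇒n≤o M N (ℕₚ.m⊔n≤o⇒n≤o (K ℕ.⊔ L) (M ℕ.⊔ N) hm))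
                (ℕₚ.m⊔n≤o⇒n≤o M N (ℕₚ.m⊔n≤o⇒n≤o (K ℕ.⊔ L) (M ℕ.⊔ N) hn)))

infixl 7 _·_

ap : ∀ {φ} → Lipschitz φ → ℝ → ℝ
ap {φ} L x = real (φ ∘ seq x) (ap-cauchy L x)

_·_ : ℝ → ℝ → ℝ
x · y = real (λ n → seq x n ℚ.* seq y n) (*-cauchy x y)

ap-close : ∀ {φ} (L : Lipschitz φ) {ε} → 0ℚ ℚ.< ε →
  ∃[ δ ] (0ℚ ℚ.< δ × ∀ {x y} → Close δ x y → Close ε (ap L x) (ap L y))
ap-close L ε>0 = let (δ , δ>0 , u) = Lipschitz-uniform L ε>0 in
  δ , δ>0 , λ (close h) → close (ev-map (λ n → u _ _) h)

+-close : ∀ {ε x x′ y y′} → Close (½ ℚ.* ε) x x′ → Close (½ ℚ.* ε) y y′ → Close ε (x + y) (x′ + y′)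
+-close {x = x} {x′} {y} {y′} (close h) (close k) = close (ev-zip
  (λ n → split-half _ _ _ (solve 4 (λ a b c d → (a :+ b) :- (c :+ d) := (a :- c) :+ (b :- d)) refl
           (seq x n) (seq y n) (seq x′ n) (seq y′ n))) h k)

·-close : ∀ x y {ε} → 0ℚ ℚ.< ε → ∃[ δ ] (0ℚ ℚ.< δ × ∀ {x′ y′} →
  Close δ x x′ → Close δ y y′ → Close ε (x · y) (x′ · y′))
·-close x y {ε} ε>0 =
  let (B , B>0 , b) = bounded x
      (C , C>0 , c) = bounded y
      -- The summand 1 accounts for y′, which the radius δ ⊓ 1 keeps within 1 of y.
      D = B ℚ.+ C ℚ.+ 1ℚ
      D>0 : 0ℚ ℚ.< D
      D>0 = ℚₚ.+-mono-< (ℚₚ.+-mono-< B>0 C>0) (ℚₚ.positive⁻¹ 1ℚ)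
      (δ , δ>0 , Dδ) = divide D>0 (half>0 ε>0)
      B≤D : B ℚ.≤ D
      B≤D = subst₂ ℚ._≤_ (solve 1 (λ b → b :+ con 0ℚ :+ con 0ℚ := b) refl B) refl
              (ℚₚ.+-mono-≤ (ℚₚ.+-mono-≤ (ℚₚ.≤-refl {B}) (ℚₚ.<⇒≤ C>0)) 0≤1ℚ)
      C+1≤D : C ℚ.+ 1ℚ ℚ.≤ D
      C+1≤D = subst (ℚ._≤ D) (solve 1 (λ c → con 0ℚ :+ c :+ con 1ℚ := c :+ con 1ℚ) refl C)
                (ℚₚ.+-monoˡ-≤ 1ℚ (ℚₚ.+-monoˡ-≤ C (ℚₚ.<⇒≤ B>0)))
      near-bounded : ∀ {y′} n → ℚ.∣ seq y n ∣ ℚ.≤ C → ℚ.∣ seq y n ℚ.- seq y′ n ∣ ℚ.< δ ℚ.⊓ 1ℚ →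
                     ℚ.∣ seq y′ n ∣ ℚ.≤ D
      near-bounded {y′} n y≤C h = ℚₚ.≤-trans
        (ℚₚ.≤-reflexive (cong ℚ.∣_∣ (solve 2 (λ a b → b := a :- (a :- b)) refl (seq y n) (seq y′ n))))
        (ℚₚ.≤-trans (ℚₚ.∣p-q∣≤∣p∣+∣q∣ (seq y n) _)
          (ℚₚ.≤-trans (ℚₚ.+-mono-≤ y≤C (ℚₚ.≤-trans (ℚₚ.<⇒≤ h) (ℚₚ.p⊓q≤q δ 1ℚ))) C+1≤D))
  in δ ℚ.⊓ 1ℚ , 0<⊓ δ>0 (ℚₚ.positive⁻¹ 1ℚ) , λ {x′} {y′} (close h) (close k) → close
     (ev-zip {λ n → ℚ.∣ seq x n ∣ ℚ.≤ B × ℚ.∣ seq y n ∣ ℚ.≤ C}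
       (λ n (x≤B , y≤C) (h , k) → *-close {B = D} D>0 Dδ (ℚₚ.≤-trans x≤B B≤D) (near-bounded {y′} n y≤C k)
          (ℚₚ.<-≤-trans h (ℚₚ.p⊓q≤p δ 1ℚ)) (ℚₚ.<-≤-trans k (ℚₚ.p⊓q≤p δ 1ℚ)))
       (ev-zip (λ n → _,_) b c)
       (ev-zip (λ n → _,_) h k))

+-cong : ∀ {x x′ y y′} → x ≃ x′ → y ≃ y′ → x + y ≃ x′ + y′
+-cong p q = Close⇒≃ λ ε ε>0 → +-close (≃⇒Close (half>0 ε>0) p) (≃⇒Close (half>0 ε>0) q)

·-cong : ∀ {x x′ y y′} → x ≃ x′ → y ≃ y′ → x · y ≃ x′ · y′
·-cong {x} {x′} {y} p q = Close⇒≃ λ ε ε>0 → let (δ , δ>0 , h) = ·-close x y ε>0 in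
  h (≃⇒Close δ>0 p) (≃⇒Close δ>0 q)

·-0 : ∀ c {x} → x ≃ 0ℝ → c · x ≃ 0ℝ
·-0 c h = ≃-trans (·-cong {c} ≃-refl h) (termwise λ n → ℚₚ.*-zeroʳ (seq c n))

ap-cong : ∀ {φ} (L : Lipschitz φ) {x y} → x ≃ y → ap L x ≃ ap L y
ap-cong L p = Close⇒≃ λ ε ε>0 → let (δ , δ>0 , h) = ap-close L ε>0 in h (≃⇒Close δ>0 p)

infix 8 -_

-_ : ℝ → ℝ
- x = ap neg-Lipschitz x

-- (1 − u) p + u q with u truncated to [0, 1], hence always a convex combination.
mix : ℝ → ℝ → ℝ → ℝ
mix u p q = p + ap unit-Lipschitz u · (q + - p)

mix-cong : ∀ {u u′ p p′ q q′} → u ≃ u′ → p ≃ p′ → q ≃ q′ → mix u p q ≃ mix u′ p′ q′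
mix-cong hu hp hq = +-cong hp (·-cong (ap-cong unit-Lipschitz hu) (+-cong hq (ap-cong neg-Lipschitz hp)))

-- The weights 1 - u and u lie in [0, 1] after truncation, so errors are not amplified and the bound
-- does not depend on u.
mix-close : ∀ {ε u p p′ q q′} → Close (½ ℚ.* ε) p p′ → Close (½ ℚ.* ε) q q′ →
  Close ε (mix u p q) (mix u p′ q′)
mix-close {ε} {u} {p} {p′} {q} {q′} (close h) (close k) = close (ev-zip
  (λ n hp hq → let c = unit (seq u n) in
    split-half _ ((1ℚ ℚ.- c) ℚ.* (seq p n ℚ.- seq p′ n)) (c ℚ.* (seq q n ℚ.- seq q′ n))
      (solve 5 (λ c p p′ q q′ → (p :+ c :* (q :- p)) :- (p′ :+ c :* (q′ :- p′)) :=
                  (con 1ℚ :- c) :* (p :- p′) :+ c :* (q :- q′)) refl c (seq p n) (seq p′ n) (seq q n) (seq q′ n))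
      (shrink (p≤q⇒0≤q-p (unit≤1 (seq u n))) (0≤q-p⇒p≤q (subst (0ℚ ℚ.≤_)
        (solve 1 (λ c → c := con 1ℚ :- (con 1ℚ :- c)) refl c) (0≤unit (seq u n)))) hp)
      (shrink (0≤unit (seq u n)) (unit≤1 (seq u n)) hq)) h k)
  where
  shrink : ∀ {c d e} → 0ℚ ℚ.≤ c → c ℚ.≤ 1ℚ → ℚ.∣ d ∣ ℚ.< e → ℚ.∣ c ℚ.* d ∣ ℚ.< e
  shrink {c} {d} 0≤c c≤1 h = ℚₚ.≤-<-trans
    (subst₂ ℚ._≤_ (trans (cong (ℚ._* ℚ.∣ d ∣) (sym (ℚₚ.0≤p⇒∣p∣≡p 0≤c))) (sym (ℚₚ.∣p*q∣≡∣p∣*∣q∣ c d)))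
      (ℚₚ.*-identityˡ ℚ.∣ d ∣) (*-monoˡ (ℚₚ.0≤∣p∣ d) c≤1)) h

mix-close₁ : ∀ u p q {ε} → 0ℚ ℚ.< ε → ∃[ δ ] (0ℚ ℚ.< δ × ∀ {v} → Close δ u v → Close ε (mix u p q) (mix v p q))
mix-close₁ u p q ε>0 =
  let (η , η>0 , h) = ·-close (ap unit-Lipschitz u) (q + - p) (half>0 ε>0)
      (δ , δ>0 , k) = ap-close unit-Lipschitz η>0
  in δ , δ>0 , λ c → +-close (≃⇒Close (half>0 ε>0) ≃-refl) (h (k c) (≃⇒Close η>0 ≃-refl))

mix-0 : ∀ {u p q} → u ≃ 0ℝ → mix u p q ≃ p
mix-0 {u} {p} {q} h = ≃-trans (mix-cong {p = p} {p} {q} {q} h ≃-refl ≃-refl)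
  (termwise λ n → solve 2 (λ p q → p :+ con 0ℚ :* (q :- p) := p) refl (seq p n) (seq q n))

mix-1 : ∀ {u p q} → u ≃ 1ℝ → mix u p q ≃ q
mix-1 {u} {p} {q} h = ≃-trans (mix-cong {p = p} {p} {q} {q} h ≃-refl ≃-refl)
  (termwise λ n → solve 2 (λ p q → p :+ con 1ℚ :* (q :- p) := q) refl (seq p n) (seq q n))

mix-idem : ∀ {u p q c} → p ≃ c → q ≃ c → mix u p q ≃ c
mix-idem {u} {c = c} hp hq = ≃-trans (mix-cong {u} ≃-refl hp hq)
  (termwise λ n → solve 2 (λ u c → c :+ u :* (c :- c) := c) refl (unit (seq u n)) (seq c n))

-- The spare half of ε turns a weak inequality into the strict one that `_≤_` asks for.
≤-half : ∀ x c → (∀ {ε} → 0ℚ ℚ.< ε → Eventually λ n → seq x n ℚ.≤ seq c n ℚ.+ ½ ℚ.* ε) → x ≤ c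
≤-half x c h = less-equal λ ε ε>0 → ev-map (λ n k → ℚₚ.≤-<-trans k
  (ℚₚ.+-monoʳ-< (seq c n) (subst₂ ℚ._<_ (ℚₚ.+-identityˡ _) (half+half ε) (ℚₚ.+-monoˡ-< (½ ℚ.* ε) (half>0 ε>0)))))
  (h ε>0)

mix-≤ : ∀ {u p q} c → p ≤ fromℚ c → q ≤ fromℚ c → mix u p q ≤ fromℚ c
mix-≤ {u} c (less-equal h) (less-equal k) = ≤-half _ _ λ ε>0 →
  ev-zip (λ n hp hq → lerp-≤ (seq u n) (ℚₚ.<⇒≤ hp) (ℚₚ.<⇒≤ hq)) (h _ (half>0 ε>0)) (k _ (half>0 ε>0))

mix-≥ : ∀ {u p q} c → fromℚ c ≤ p → fromℚ c ≤ q → fromℚ c ≤ mix u p q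
mix-≥ {u} {p} {q} c (less-equal h) (less-equal k) = ≤-half _ _ λ {ε} ε>0 → ev-zip
  (λ n hp hq → lower-by _ (½ ℚ.* ε) (lerp-≥ (seq u n) (raise (seq p n) hp) (raise (seq q n) hq)))
  (h _ (half>0 ε>0)) (k _ (half>0 ε>0))
  where
  raise : ∀ {c} p {e} → c ℚ.< p ℚ.+ e → c ℚ.- e ℚ.≤ p
  raise {c} p {e} h = subst (c ℚ.- e ℚ.≤_) (solve 2 (λ p e → (p :+ e) :- e := p) refl p e)
    (ℚₚ.+-monoˡ-≤ (ℚ.- e) (ℚₚ.<⇒≤ h))
  lower-by : ∀ {c} p e → c ℚ.- e ℚ.≤ p → c ℚ.≤ p ℚ.+ e
  lower-by {c} p e h = subst (ℚ._≤ p ℚ.+ e) (solve 2 (λ c e → (c :- e) :+ e := c) refl c e)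
    (ℚₚ.+-monoˡ-≤ e h)

termwise-≤ : ∀ {x y} → (∀ n → seq x n ℚ.≤ seq y n) → x ≤ y
termwise-≤ {x} {y} h = less-equal λ ε ε>0 → 0 , λ n _ → ℚₚ.≤-<-trans (h n)
  (subst (ℚ._< seq y n ℚ.+ ε) (ℚₚ.+-identityʳ _) (ℚₚ.+-monoʳ-< (seq y n) ε>0))

invᵣ : ℝ → ℝ
invᵣ = ap inv-Lipschitz

inv·-nonneg : ∀ {x y} → 0ℝ ≤ y → 0ℝ ≤ invᵣ x · y
inv·-nonneg {x} {y} (less-equal h) = ≤-half _ _ λ {ε} ε>0 →
  -- 0 ≤ y only keeps the terms of y eventually above -δ; as `inv` is at most 4, the products stay
  -- above -4δ = -ε/2.
  let (δ , δ>0 , 4δ) = divide {4ℚ} (ℚₚ.positive⁻¹ 4ℚ) (half>0 ε>0) in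
  ev-map (λ n k → let i = inv (seq x n) in ℚₚ.≤-trans
    (subst (0ℚ ℚ.≤_) (ℚₚ.*-distribˡ-+ i (seq y n) δ) (*-nonNeg (0≤inv (seq x n)) (ℚₚ.<⇒≤ k)))
    (ℚₚ.+-monoʳ-≤ (i ℚ.* seq y n) (subst (i ℚ.* δ ℚ.≤_) 4δ (*-monoˡ (ℚₚ.<⇒≤ δ>0) (inv≤4 (seq x n))))))
  (h δ δ>0)

∑-cong : ∀ {m} {x y : Vector ℝ m} → (∀ i → x i ≃ y i) → ∑ x ≃ ∑ y
∑-cong {zero}  h = ≃-refl
∑-cong {suc m} h = +-cong (h zero) (∑-cong (h ∘ suc))

∑-mix : ∀ {m} u (x y : Vector ℝ m) → ∑ (λ i → mix u (x i) (y i)) ≃ mix u (∑ x) (∑ y)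
∑-mix u x y = termwise (go x y)
  where
  go : ∀ {m} (x y : Vector ℝ m) n → seq (∑ (λ i → mix u (x i) (y i))) n ≡ seq (mix u (∑ x) (∑ y)) n
  go {zero}  x y n = solve 1 (λ u → con 0ℚ := con 0ℚ :+ u :* (con 0ℚ :- con 0ℚ)) refl (unit (seq u n))
  go {suc m} x y n = trans (cong (seq (mix u (x zero) (y zero)) n ℚ.+_) (go (x ∘ suc) (y ∘ suc) n))
    (solve 5 (λ u p q a b → (p :+ u :* (q :- p)) :+ (a :+ u :* (b :- a)) :=
                (p :+ a) :+ u :* ((q :+ b) :- (p :+ a))) refl
      (unit (seq u n)) (seq (x zero) n) (seq (y zero) n) (seq (∑ (x ∘ suc)) n) (seq (∑ (y ∘ suc)) n))

∑-· : ∀ {m} c (x : Vector ℝ m) → ∑ (λ i → c · x i) ≃ c · ∑ x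
∑-· c x = termwise (go x)
  where
  go : ∀ {m} (x : Vector ℝ m) n → seq (∑ (λ i → c · x i)) n ≡ seq (c · ∑ x) n
  go {zero}  x n = sym (ℚₚ.*-zeroʳ (seq c n))
  go {suc m} x n = trans (cong (seq (c · x zero) n ℚ.+_) (go (x ∘ suc) n))
    (sym (ℚₚ.*-distribˡ-+ (seq c n) (seq (x zero) n) (seq (∑ (x ∘ suc)) n)))

∑-0 : ∀ {m} {x : Vector ℝ m} → (∀ i → x i ≃ 0ℝ) → ∑ x ≃ 0ℝ
∑-0 {zero}  h = ≃-refl
∑-0 {suc m} {x} h = ≃-trans (+-cong (h zero) (∑-0 (h ∘ suc))) (termwise λ n → refl)

-- Continuous maps

Neighbourhood : (X : Space) → Space.Carrier X → Pred (Space.Carrier X) 0ℓ → Set₁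
Neighbourhood X p U = Σ (Pred (Space.Carrier X) 0ℓ) λ N →
  Space.Open X N × N p × (∀ {q} → N q → U q)

-- U is the union of the chosen neighbourhoods, indexed by the pairs of a point and a proof that it
-- lies in U; these form a small set, as `open-⋃` requires.
locally⇒open : ∀ (X : Space) {U} → (∀ p → U p → Neighbourhood X p U) → Space.Open X U
locally⇒open X {U} h = X.open-ext
  ((λ { ((p , u) , n) → proj₂ (proj₂ (proj₂ (h p u))) n }) , λ {p} u → (p , u) , proj₁ (proj₂ (proj₂ (h p u))))
  (X.open-⋃ (Σ X.Carrier U) (λ (p , u) → proj₁ (h p u)) λ (p , u) → proj₁ (proj₂ (h p u)))
  where module X = Space X

neighbourhood-∩ : ∀ (X : Space) {p U V} → Neighbourhood X p U → Neighbourhood X p V →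
  Neighbourhood X p (U ∩ V)
neighbourhood-∩ X (M , oM , m , M⊆) (N , oN , n , N⊆) =
  M ∩ N , Space.open-∩ X oM oN , (m , n) , λ (m , n) → M⊆ m , N⊆ n

neighbourhood-⊆ : ∀ (X : Space) {p U V} → (∀ {q} → U q → V q) → Neighbourhood X p U → Neighbourhood X p V
neighbourhood-⊆ X U⊆V (N , oN , n , N⊆) = N , oN , n , U⊆V ∘ N⊆

-- Stated with arbitrary open neighbourhoods in the source, so that the same closure rules serve
-- realizations, 𝕀 and products.
record Cont (X : Space) (f : Space.Carrier X → ℝ) : Set₁ where
  constructor cont
  field
    nbhd : ∀ p {ε} → 0ℚ ℚ.< ε → Neighbourhood X p λ q → Close ε (f p) (f q)
open Cont

module _ {X : Space} where
  private
    module X = Space X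

  -- Open sets are saturated, so q lies in every neighbourhood of p, and f q is ε-close to f p for
  -- every ε.
  Cont-cong : ∀ {f} → Cont X f → ∀ {p q} → p X.≈ q → f p ≃ f q
  Cont-cong (cont h) {p} p≈q = Close⇒≃ λ ε ε>0 →
    let (N , oN , n , N⊆) = h p ε>0 in N⊆ (X.open-resp oN p≈q n)

  Cont-const : ∀ c → Cont X (λ _ → c)
  Cont-const c = cont λ p ε>0 → (λ _ → ⊤) , X.open-univ , tt , λ _ → ≃⇒Close ε>0 ≃-refl

  Cont-ap : ∀ {φ} (L : Lipschitz φ) {f} → Cont X f → Cont X (λ p → ap L (f p))
  Cont-ap L (cont h) = cont λ p ε>0 → let (δ , δ>0 , k) = ap-close L ε>0 in
    neighbourhood-⊆ X k (h p δ>0)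

  Cont-+ : ∀ {f g} → Cont X f → Cont X g → Cont X (λ p → f p + g p)
  Cont-+ (cont h) (cont k) = cont λ p ε>0 → neighbourhood-⊆ X (λ (a , b) → +-close a b)
    (neighbourhood-∩ X (h p (half>0 ε>0)) (k p (half>0 ε>0)))

  Cont-· : ∀ {f g} → Cont X f → Cont X g → Cont X (λ p → f p · g p)
  Cont-· {f} {g} (cont h) (cont k) = cont λ p ε>0 → let (δ , δ>0 , c) = ·-close (f p) (g p) ε>0 in
    neighbourhood-⊆ X (λ (a , b) → c a b) (neighbourhood-∩ X (h p δ>0) (k p δ>0))

  Cont-mix : ∀ {u f g} → Cont X u → Cont X f → Cont X g → Cont X (λ p → mix (u p) (f p) (g p))
  Cont-mix hu hf hg = Cont-+ hf (Cont-· (Cont-ap unit-Lipschitz hu) (Cont-+ hg (Cont-ap neg-Lipschitz hf)))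

  ball : ∀ {m} {f : X.Carrier → Vector ℝ m} → (∀ i → Cont X (λ p → f p i)) → ∀ p {ε} → 0ℚ ℚ.< ε →
         Neighbourhood X p λ q → ∀ i → Close ε (f p i) (f q i)
  ball {zero}  c p ε>0 = (λ _ → ⊤) , X.open-univ , tt , λ _ ()
  ball {suc m} c p ε>0 = neighbourhood-⊆ X (λ { (a , b) zero → a ; (a , b) (suc i) → b i })
    (neighbourhood-∩ X (nbhd (c zero) p ε>0) (ball (c ∘ suc) p ε>0))

  euclidean : ∀ {m P} (f : X.Carrier → Σ (Vector ℝ m) P) → (∀ i → Cont X (λ p → proj₁ (f p) i)) →
              X ⟶ Euclidean m P
  euclidean f c = record
    { to         = f
    ; cong-to    = λ p≈q i → Cont-cong (c i) p≈q
    ; continuous = λ o → locally⇒open X λ p v →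
        let (ε , ε>0 , b) = lower o (f p) v in
        neighbourhood-⊆ X (λ h → b _ λ i → Close⇒Near ε>0 (h i)) (ball c p (half>0 ε>0))
    }

Cont-∘ : ∀ {X Y f} → Cont Y f → (g : X ⟶ Y) → Cont X (f ∘ to g)
Cont-∘ (cont h) g = cont λ p ε>0 → let (N , oN , n , N⊆) = h (to g p) ε>0 in
  N ∘ to g , continuous g oN , n , N⊆

fst : ∀ X Y → X ⊗ Y ⟶ X
fst X Y = record
  { to         = proj₁
  ; cong-to    = proj₁
  ; continuous = λ {V} oV _ v → V , (λ _ → ⊤) , oV , Space.open-univ Y , v , tt , λ v _ → v
  }

snd : ∀ X Y → X ⊗ Y ⟶ Y
snd X Y = record
  { to         = proj₂
  ; cong-to    = proj₂
  ; continuous = λ {V} oV _ v → (λ _ → ⊤) , V , Space.open-univ X , oV , tt , v , λ _ v → v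
  }

coordinate : ∀ {m P} i → Cont (Euclidean m P) (λ p → proj₁ p i)
coordinate {m} {P} i = cont λ (x , _) {ε} ε>0 → (λ (y , _) → Near ε (x i) (y i)) ,
  lift (λ (y , _) → λ { (near (less g g>0 h) (less k k>0 h′)) →
    -- `Near` is a pair of inequalities with gaps g and k; moving y by less than half of the smaller
    -- gap leaves the other half as a gap in both.
    let γ = g ℚ.⊓ k
        γ>0 = 0<⊓ g>0 k>0
    in ½ ℚ.* γ , half>0 γ>0 , λ (z , _) near-z → near-trans (x i) (y i) (z i) g k h h′ γ>0 (Near⇒Close (near-z i)) }) ,
  ≃⇒Near ε>0 ≃-refl , Near⇒Close
  where
  near-trans : ∀ {ε} x y z g k → Eventually (λ n → seq x n ℚ.+ g ℚ.≤ seq (y + fromℚ ε) n) →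
    Eventually (λ n → seq y n ℚ.+ k ℚ.≤ seq (x + fromℚ ε) n) → 0ℚ ℚ.< g ℚ.⊓ k →
    Close (½ ℚ.* (g ℚ.⊓ k)) y z → Near ε x z
  near-trans {ε} x y z g k h h′ γ>0 (close c) = near
    (less (½ ℚ.* γ) (half>0 γ>0) (ev-zip (λ n p q → ℚₚ.≤-trans
      (ℚₚ.≤-reflexive (solve 2 (λ a e → a :+ con ½ :* e := (a :+ e) :- con ½ :* e) refl (seq x n) γ))
      (ℚₚ.≤-trans (ℚₚ.+-monoˡ-≤ (ℚ.- (½ ℚ.* γ)) (ℚₚ.≤-trans (ℚₚ.+-monoʳ-≤ (seq x n) (ℚₚ.p⊓q≤p g k)) p))
        (ℚₚ.≤-trans (ℚₚ.+-monoˡ-≤ (ℚ.- (½ ℚ.* γ)) (ℚₚ.+-monoˡ-≤ ε (ℚₚ.<⇒≤ (∣-∣<⇒<+ (seq y n) (seq z n) q))))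
          (ℚₚ.≤-reflexive (solve 3 (λ z e d → ((z :+ d) :+ e) :- d := z :+ e) refl (seq z n) ε (½ ℚ.* γ))))))
      h c))
    (less (½ ℚ.* γ) (half>0 γ>0) (ev-zip (λ n p q → ℚₚ.≤-trans
      (ℚₚ.+-monoˡ-≤ (½ ℚ.* γ) (ℚₚ.<⇒≤ (∣-∣<⇒<+ (seq z n) (seq y n) q)))
      (ℚₚ.≤-trans (ℚₚ.≤-reflexive (solve 2 (λ y e → (y :+ con ½ :* e) :+ con ½ :* e := y :+ e) refl (seq y n) γ))
        (ℚₚ.≤-trans (ℚₚ.+-monoʳ-≤ (seq y n) (ℚₚ.p⊓q≤q g k)) p)))
      h′ (Close.within (Close-sym {x = y} {z} (close c)))))
    where
    γ : ℚ
    γ = g ℚ.⊓ k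

height : Space.Carrier 𝕀 → ℝ
height (s , _) = s zero

height-cont : Cont 𝕀 height
height-cont = coordinate zero

0~ : ∀ {X x y s t} → height s ≃ 0ℝ → height t ≃ 0ℝ → Space._≈_ (Susp X) (x , s) (y , t)
0~ p q = ≃-trans p (≃-sym q) , inj₁ p

1~ : ∀ {X x y s t} → height s ≃ 1ℝ → height t ≃ 1ℝ → Space._≈_ (Susp X) (x , s) (y , t)
1~ p q = ≃-trans p (≃-sym q) , inj₂ (inj₁ p)

-- Rescaling the suspension coordinate by φ is homotopic to the identity,
-- via (x , s) ↦ (x , (1 − u) φ(s) + u s).
module Rescaling {φ} (L : Lipschitz φ) (0≤φ : ∀ q → 0ℚ ℚ.≤ φ q) (φ≤1 : ∀ q → φ q ℚ.≤ 1ℚ)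
  (φ-0 : φ 0ℚ ≡ 0ℚ) (φ-1 : φ 1ℚ ≡ 1ℚ) where

  ap∈𝕀 : ℝ → Space.Carrier 𝕀
  ap∈𝕀 x = (λ _ → ap L x) , termwise-≤ (0≤φ ∘ seq x) , termwise-≤ (φ≤1 ∘ seq x)

  opaque
    slide : Space.Carrier 𝕀 → Space.Carrier 𝕀 → ℝ
    slide s u = mix (height u) (ap L (height s)) (height s)

    slide≥0 : ∀ s u → 0ℝ ≤ slide s u
    slide≥0 s u = mix-≥ {height u} 0ℚ (proj₁ (proj₂ (ap∈𝕀 (height s)))) (proj₁ (proj₂ s))

    slide≤1 : ∀ s u → slide s u ≤ 1ℝ
    slide≤1 s u = mix-≤ {height u} 1ℚ (proj₂ (proj₂ (ap∈𝕀 (height s)))) (proj₂ (proj₂ s))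

    slide-cong : ∀ {s t u v} → height s ≃ height t → height u ≃ height v → slide s u ≃ slide t v
    slide-cong s≃t u≃v = mix-cong u≃v (ap-cong L s≃t) s≃t

    slide-0 : ∀ s u → height s ≃ 0ℝ → slide s u ≃ 0ℝ
    slide-0 s u h = mix-idem {height u} (≃-trans (ap-cong L h) (termwise λ _ → φ-0)) h

    slide-1 : ∀ s u → height s ≃ 1ℝ → slide s u ≃ 1ℝ
    slide-1 s u h = mix-idem {height u} (≃-trans (ap-cong L h) (termwise λ _ → φ-1)) h

    slide-start : ∀ s → slide s 0𝕀 ≃ ap L (height s)
    slide-start s = mix-0 {q = height s} ≃-refl

    slide-end : ∀ s → slide s 1𝕀 ≃ height s
    slide-end s = mix-1 {p = ap L (height s)} ≃-refl

    -- The modulus is uniform in s and u, so one radius is good along a whole tube.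
    slide-close : ∀ {ε} → 0ℚ ℚ.< ε → ∃[ δ ] (0ℚ ℚ.< δ ×
      ∀ {s t u} → Close δ (height s) (height t) → Close ε (slide s u) (slide t u))
    slide-close ε>0 = let (δ , δ>0 , h) = ap-close L (half>0 ε>0) in
      δ ℚ.⊓ _ , 0<⊓ δ>0 (half>0 ε>0) , λ {s} {t} {u} c →
      mix-close {u = height u} (h (Close-mono (ℚₚ.p⊓q≤p δ _) c)) (Close-mono (ℚₚ.p⊓q≤q δ _) c)

    slide-close₂ : ∀ s u {ε} → 0ℚ ℚ.< ε → ∃[ δ ] (0ℚ ℚ.< δ ×
      ∀ {v} → Close δ (height u) (height v) → Close ε (slide s u) (slide s v))
    slide-close₂ s u ε>0 = let (δ , δ>0 , h) = mix-close₁ (height u) (ap L (height s)) (height s) ε>0 in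
      δ , δ>0 , λ c → h c

  slide∈𝕀 : Space.Carrier 𝕀 → Space.Carrier 𝕀 → Space.Carrier 𝕀
  slide∈𝕀 s u = (λ _ → slide s u) , slide≥0 s u , slide≤1 s u

  module _ {m : ℕ} (K : SimplicialComplex m) where
    private
      X : Space
      X = ∥ K ∥
      module X = Space X
      module ΣX = Space (Susp X)

    stretch : X.Carrier × Space.Carrier 𝕀 → Space.Carrier 𝕀 → ΣX.Carrier
    stretch (x , s) u = x , slide∈𝕀 s u

    stretch-cong : ∀ {p q u v} → p ΣX.≈ q → height u ≃ height v → stretch p u ΣX.≈ stretch q v
    stretch-cong {_ , s} {_ , t} {u} {v} (s≃t , c) u≃v =
      slide-cong {s} {t} {u} {v} s≃t u≃v , Sum.map (slide-0 s u) (Sum.map₁ (slide-1 s u)) c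

    open-box : ∀ {V x s} → ΣX.Open V → V (x , s) → ∃[ ε ] (0ℚ ℚ.< ε × ∀ y (t : Space.Carrier 𝕀) →
      (∀ i → Close ε (proj₁ x i) (proj₁ y i)) → Close ε (height s) (height t) → V (y , t))
    open-box (_ , o) v =
      let (U , W , oU , oW , u , w , box) = o _ v
          (ε , ε>0 , b)  = lower oU _ u
          (δ , δ>0 , b′) = lower oW _ w
      in ½ ℚ.* (ε ℚ.⊓ δ) , half>0 (0<⊓ ε>0 δ>0) , λ y t hx ht → box
         (b y λ i → Near-mono (ℚₚ.p⊓q≤p ε δ) (Close⇒Near (0<⊓ ε>0 δ>0) (hx i)))
         (b′ t λ { zero → Near-mono (ℚₚ.p⊓q≤q ε δ) (Close⇒Near (0<⊓ ε>0 δ>0) ht) })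

    -- The points p such that a neighbourhood of the curve v ↦ stretch p v,
    -- for v near u, lies in V.  Since stretch fixes the two cone points, this
    -- set is saturated, so that no compactness of 𝕀 is needed for it to be open.
    Tube : Pred ΣX.Carrier 0ℓ → Space.Carrier 𝕀 → ℚ → Pred ΣX.Carrier 0ℓ
    Tube V u η (x , s) = ∃[ ε ] (0ℚ ℚ.< ε × ∀ y (t v : Space.Carrier 𝕀) →
      (∀ i → Close ε (proj₁ x i) (proj₁ y i)) → Close η (height u) (height v) →
      Close ε (slide s v) (height t) → V (y , t))

    module _ {V : Pred ΣX.Carrier 0ℓ} (oV : ΣX.Open V) (u : Space.Carrier 𝕀) {η : ℚ} (η>0 : 0ℚ ℚ.< η) where

      tube-open⊗ : Space.Open (X ⊗ 𝕀) (Tube V u η)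
      tube-open⊗ = locally⇒open (X ⊗ 𝕀) λ (x , s) (ε , ε>0 , tube) →
        let (δ , δ>0 , c) = slide-close (half>0 ε>0) in
        neighbourhood-⊆ (X ⊗ 𝕀)
          (λ {(x′ , s′)} (hx , hs) → ½ ℚ.* ε , half>0 ε>0 , λ y t v hy hv ht →
            tube y t v (λ i → Close-trans (hx i) (hy i)) hv
              (Close-trans (c {s} {s′} {v} hs) ht))
          (neighbourhood-∩ (X ⊗ 𝕀)
            (ball {X ⊗ 𝕀} (λ i → Cont-∘ {X ⊗ 𝕀} {X} (coordinate i) (fst X 𝕀)) (x , s) (half>0 ε>0))
            (Cont.nbhd (Cont-∘ {X ⊗ 𝕀} {𝕀} height-cont (snd X 𝕀)) (x , s) δ>0))

      -- `stretch` is constant at a pole. So V contains the pole over x, by saturation also over y,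
      -- and a ball of V around it serves all v at once.
      tube-pole : ∀ {x y : X.Carrier} {s t : Space.Carrier 𝕀} (pole : Space.Carrier 𝕀) →
        (∀ v → slide s v ≃ height pole) → (∀ v → slide t v ≃ height pole) →
        (x , pole) ΣX.≈ (y , pole) → Tube V u η (x , s) → Tube V u η (y , t)
      tube-pole {x} {y} {s} pole hs ht p (ε , ε>0 , tube) =
        let at-pole = tube x pole u (λ i → ≃⇒Close ε>0 ≃-refl) (≃⇒Close η>0 ≃-refl) (≃⇒Close ε>0 (hs u))
            (δ , δ>0 , b) = open-box {x = y} {pole} oV (proj₁ oV {x , pole} {y , pole} p at-pole)
        in ½ ℚ.* δ , half>0 δ>0 , λ z r v hz hv hr → b z r
             (λ i → Close-mono (half≤ δ>0) (hz i))
             (Close-trans (≃⇒Close (half>0 δ>0) (≃-sym (ht v))) hr)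

      tube-open : ΣX.Open (Tube V u η)
      tube-open = (λ {p} {q} → respects {p} {q}) , tube-open⊗
        where
        respects : ∀ {p q} → p ΣX.≈ q → Tube V u η p → Tube V u η q
        respects {x , s} {y , t} (s≃t , inj₁ s≃0) = tube-pole {x} {y} {s} {t} 0𝕀 (λ v → slide-0 s v s≃0)
          (λ v → slide-0 t v (≃-trans (≃-sym s≃t) s≃0)) (0~ {X} {x} {y} {0𝕀} {0𝕀} ≃-refl ≃-refl)
        respects {x , s} {y , t} (s≃t , inj₂ (inj₁ s≃1)) = tube-pole {x} {y} {s} {t} 1𝕀 (λ v → slide-1 s v s≃1)
          (λ v → slide-1 t v (≃-trans (≃-sym s≃t) s≃1)) (1~ {X} {x} {y} {1𝕀} {1𝕀} ≃-refl ≃-refl)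
        respects {x , s} {y , t} (s≃t , inj₂ (inj₂ x≈y)) =
          Space.open-resp (X ⊗ 𝕀) tube-open⊗ {x , s} {y , t} (x≈y , λ { zero → s≃t })

    stretchₜ : Susp ∥ K ∥ ⊗ 𝕀 ⟶ Susp ∥ K ∥
    stretchₜ = record
      { to         = λ (p , u) → stretch p u
      ; cong-to    = λ {(p , u)} {(q , v)} (p≈q , u≈v) → stretch-cong {p} {q} {u} {v} p≈q (u≈v zero)
      ; continuous = λ {V} oV ((x , s) , u) w →
          let (ε , ε>0 , b)     = open-box {x = x} {slide∈𝕀 s u} oV w
              ε/2>0             = half>0 ε>0
              (η , η>0 , η⊆)    = slide-close₂ s u ε/2>0
              (B , oB , u∈ , B⊆) = Cont.nbhd height-cont u η>0
          -- η is found for the given s only; the other points of the tube satisfy the condition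
          -- with this same η by definition.
          in Tube V u η , B , tube-open oV u η>0 , oB ,
             (½ ℚ.* ε , ε/2>0 , λ y t v hy hv ht → b y t
               (λ i → Close-mono (half≤ ε>0) (hy i))
               (Close-trans (η⊆ {v} hv) ht)) ,
             u∈ ,
             λ {(x′ , s′)} {v} (δ , δ>0 , tube) hv →
               tube x′ (slide∈𝕀 s′ v) v (λ i → ≃⇒Close δ>0 ≃-refl) (B⊆ {v} hv) (≃⇒Close δ>0 ≃-refl)
      }

-- Cut-off functions on the reals

Hi Lo Ht : ℝ → ℝ
Hi = ap hi-Lipschitz
Lo = ap lo-Lipschitz
Ht = ap ht-Lipschitz

1-ᵣ_ : ℝ → ℝ
1-ᵣ x = ap 1-Lipschitz x

Hi≃0 : ∀ {x} → Eventually (λ n → seq x n ℚ.≤ ⅔) → Hi x ≃ 0ℝ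
Hi≃0 h = eventual (ev-map (λ n → hi≡0) h)

Lo≃0 : ∀ {x} → Eventually (λ n → ⅓ ℚ.≤ seq x n) → Lo x ≃ 0ℝ
Lo≃0 h = eventual (ev-map (λ n → lo≡0) h)

Ht≃0 : ∀ {x} → Eventually (λ n → seq x n ℚ.≤ ¼) → Ht x ≃ 0ℝ
Ht≃0 h = eventual (ev-map (λ n → ht≡0) h)

Ht≃1 : ∀ {x} → Eventually (λ n → ½ ℚ.≤ seq x n) → Ht x ≃ 1ℝ
Ht≃1 h = eventual (ev-map (λ n → ht≡1) h)

Hi-0 : ∀ {x} → x ≃ 0ℝ → Hi x ≃ 0ℝ
Hi-0 h = ≃-trans (ap-cong hi-Lipschitz h) (termwise λ _ → refl)

Hi-1 : ∀ {x} → x ≃ 1ℝ → Hi x ≃ 1ℝ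
Hi-1 h = ≃-trans (ap-cong hi-Lipschitz h) (termwise λ _ → refl)

Lo-0 : ∀ {x} → x ≃ 0ℝ → Lo x ≃ 1ℝ
Lo-0 h = ≃-trans (ap-cong lo-Lipschitz h) (termwise λ _ → refl)

Lo-1 : ∀ {x} → x ≃ 1ℝ → Lo x ≃ 0ℝ
Lo-1 h = ≃-trans (ap-cong lo-Lipschitz h) (termwise λ _ → refl)

Ht-0 : ∀ {x} → x ≃ 0ℝ → Ht x ≃ 0ℝ
Ht-0 h = ≃-trans (ap-cong ht-Lipschitz h) (termwise λ _ → refl)

⅓<⅔ : ⅓ ℚ.< ⅔
⅓<⅔ = from-yes (⅓ ℚₚ.<? ⅔)

⅝<¾ : ⅝ ℚ.< ¾
⅝<¾ = from-yes (⅝ ℚₚ.<? ¾)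

½≤⅝ : ½ ℚ.≤ ⅝
½≤⅝ = from-yes (½ ℚₚ.≤? ⅝)

-- This decides in which of the two cones a point of the join lies: without `Lo` there is no
-- η-coordinate, without `Hi` no δ-coordinate.
Lo-or-Hi≃0 : ∀ x → Lo x ≃ 0ℝ ⊎ Hi x ≃ 0ℝ
Lo-or-Hi≃0 x = Sum.swap (Sum.map Hi≃0 Lo≃0 (compare x ⅓<⅔))

-- `mix` truncates its weight again although `hi` and `lo` are already truncated.
unit-idem : ∀ q → unit (unit q) ≡ unit q
unit-idem q = trans (cong (0ℚ ℚ.⊔_) (ℚₚ.p≤q⇒p⊓q≡p (unit≤1 q))) (ℚₚ.p≤q⇒p⊔q≡q (0≤unit q))

-- 1 - ¾ = ¼ is the bound from which on `inv` is a true inverse.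
inv·1-≃1 : ∀ h → Eventually (λ n → seq h n ℚ.≤ ¾) → invᵣ (1-ᵣ h) · (1-ᵣ h) ≃ 1ℝ
inv·1-≃1 h h≤¾ = eventual (ev-map (λ n k → inv-* (ℚₚ.+-monoʳ-≤ 1ℚ (ℚₚ.neg-antimono-≤ k))) h≤¾)

Close-resp : ∀ {ε x x′ y y′} → 0ℚ ℚ.< ε → x ≃ x′ → y ≃ y′ → Close (½ ℚ.* (½ ℚ.* ε)) x y → Close ε x′ y′
Close-resp ε>0 p q c = Close-trans (≃⇒Close (half>0 ε>0) (≃-sym p))
  (Close-trans c (≃⇒Close (half>0 (half>0 ε>0)) q))

-- Realizations as suspensions

basis : ∀ {m} → Fin m → Vector ℝ m
basis zero    zero    = 1ℝ
basis zero    (suc j) = 0ℝ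
basis (suc i) zero    = 0ℝ
basis (suc i) (suc j) = basis i j

basis≥0 : ∀ {m} (i j : Fin m) → 0ℝ ≤ basis i j
basis≥0 zero    zero    = 0≤1
basis≥0 zero    (suc j) = ≤-refl
basis≥0 (suc i) zero    = ≤-refl
basis≥0 (suc i) (suc j) = basis≥0 i j

∑-basis : ∀ {m} (i : Fin m) → ∑ (basis i) ≃ 1ℝ
∑-basis {suc m} zero = ≃-trans (+-cong {1ℝ} ≃-refl (∑-0 {m} λ j → ≃-refl)) (termwise λ n → refl)
∑-basis (suc i)      = ≃-trans (+-cong {0ℝ} ≃-refl (∑-basis i)) (termwise λ n → refl)

record SupportedOn {m} (τ : Subset m) (x : Vector ℝ m) : Set where
  constructor supported
  field
    vanishes : ∀ i → i ∉ˢ τ → x i ≃ 0ℝ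
open SupportedOn

supported-⊆ : ∀ {m} {σ τ : Subset m} {x} → σ ⊆ˢ τ → SupportedOn σ x → SupportedOn τ x
supported-⊆ σ⊆τ (supported h) = supported λ i i∉τ → h i (i∉τ ∘ σ⊆τ)

supported-≃ : ∀ {m} {τ : Subset m} {x y} → (∀ i → x i ≃ y i) → SupportedOn τ y → SupportedOn τ x
supported-≃ x≃y (supported h) = supported λ i i∉τ → ≃-trans (x≃y i) (h i i∉τ)

supported-mix : ∀ {m} {τ : Subset m} u (x y : Vector ℝ m) → SupportedOn τ x → SupportedOn τ y →
  SupportedOn τ (λ i → mix u (x i) (y i))
supported-mix u x y (supported hx) (supported hy) = supported λ i i∉ → mix-idem {u} (hx i i∉) (hy i i∉)

supported-basis : ∀ {m} {τ : Subset m} {i} → i ∈ˢ τ → SupportedOn τ (basis i)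
supported-basis {τ = τ} {i} i∈ = supported λ j j∉ → vanish i j λ { refl → j∉ i∈ }
  where
  vanish : ∀ {m} (i j : Fin m) → i ≢ j → basis i j ≃ 0ℝ
  vanish zero    zero    i≢j = ⊥-elim (i≢j refl)
  vanish zero    (suc j) i≢j = ≃-refl
  vanish (suc i) zero    i≢j = ≃-refl
  vanish (suc i) (suc j) i≢j = vanish i j (i≢j ∘ cong suc)

vertex : ∀ {m} (K : SimplicialComplex m) {i σ} → Simplex K σ → i ∈ˢ σ → Space.Carrier ∥ K ∥
vertex K {i} {σ} σ∈K i∈ = basis i , basis≥0 i , ∑-basis i , σ , σ∈K , SupportedOn.vanishes (supported-basis i∈)

-- The edges (t , t₁) and (t₂ , t₁) of gluing (A), and the edges of G; the
-- first two of its new edges, (t , v) and (t₁ , t), are called β and γ.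
pattern δ = suc (suc zero)
pattern η = suc (suc (suc zero))
pattern kept i = suc (suc (suc (suc i)))

pattern bottom h = inj₁ h
pattern top h = inj₂ (inj₁ h)
pattern middle h h₀ h₁ h₃ hx = inj₂ (inj₂ (h , h₀ , h₁ , h₃ , hx))

δ∪ η∪ : ∀ {m} → Subset m → Subset (4 ℕ.+ m)
δ∪ M = outside ∷ outside ∷ inside ∷ outside ∷ M
η∪ M = outside ∷ outside ∷ outside ∷ inside ∷ M

-- K is the union of the cone over X with apex δ and of a cone with apex η
-- whose base contains X.
record UnionOfCones {m} (X : SimplicialComplex m) (K : SimplicialComplex (4 ℕ.+ m)) : Set where
  field
    add-η  : ∀ {a b d M} → Simplex K (a ∷ b ∷ outside ∷ d ∷ M) → Simplex K (a ∷ b ∷ outside ∷ inside ∷ M)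
    link-δ : ∀ {a b d M} → Simplex K (a ∷ b ∷ inside ∷ d ∷ M) →
             a ≡ outside × b ≡ outside × d ≡ outside × Face X M
    cone-δ : ∀ {M} → Face X M → Simplex K (δ∪ M)
    cone-η : ∀ {M} → Face X M → Simplex K (η∪ M)

module _ {m : ℕ} where

  eδ eη : Vector ℝ (4 ℕ.+ m)
  eδ = basis δ
  eη = basis η

  pad : Vector ℝ m → Vector ℝ (4 ℕ.+ m)
  pad x (kept i) = x i
  pad x _       = 0ℝ

  without-δ : Vector ℝ (4 ℕ.+ m) → Vector ℝ (4 ℕ.+ m)
  without-δ p δ = 0ℝ
  without-δ p i = p i

  pad≥0 : ∀ {x} → (∀ i → 0ℝ ≤ x i) → ∀ i → 0ℝ ≤ pad x i
  pad≥0 h zero = ≤-refl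
  pad≥0 h (suc zero) = ≤-refl
  pad≥0 h δ = ≤-refl
  pad≥0 h η = ≤-refl
  pad≥0 h (kept i) = h i

  without-δ≥0 : ∀ {p} → (∀ i → 0ℝ ≤ p i) → ∀ i → 0ℝ ≤ without-δ p i
  without-δ≥0 h zero = h zero
  without-δ≥0 h (suc zero) = h (suc zero)
  without-δ≥0 h δ = ≤-refl
  without-δ≥0 h η = h η
  without-δ≥0 h (kept i) = h (kept i)

  ∑-blocks : ∀ {a b c d r} {p : Vector ℝ (4 ℕ.+ m)} → p zero ≃ a → p (suc zero) ≃ b → p δ ≃ c → p η ≃ d →
             ∑ (λ i → p (kept i)) ≃ r → ∑ p ≃ a + (b + (c + (d + r)))
  ∑-blocks ha hb hc hd hr = +-cong ha (+-cong hb (+-cong hc (+-cong hd hr)))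

  ∑-eδ : ∑ eδ ≃ 1ℝ
  ∑-eδ = ∑-basis {4 ℕ.+ m} δ

  ∑-eη : ∑ eη ≃ 1ℝ
  ∑-eη = ∑-basis {4 ℕ.+ m} η

  ∑-pad : ∀ x → ∑ (pad x) ≃ ∑ x
  ∑-pad x = termwise λ n →
    solve 1 (λ r → con 0ℚ :+ (con 0ℚ :+ (con 0ℚ :+ (con 0ℚ :+ r))) := r) refl (seq (∑ x) n)

  ∑-without-δ : ∀ p → ∑ p ≃ 1ℝ → ∑ (without-δ p) ≃ 1-ᵣ p δ
  ∑-without-δ p h = ≃-trans {y = ∑ p + - p δ}
    (termwise λ n → solve 5 (λ a b c d r → a :+ (b :+ (con 0ℚ :+ (d :+ r))) := (a :+ (b :+ (c :+ (d :+ r)))) :- c)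
      refl (seq (p zero) n) (seq (p (suc zero)) n) (seq (p δ) n) (seq (p η) n) (seq (∑ (λ i → p (kept i))) n))
    (≃-trans (+-cong {y = - p δ} h ≃-refl) (termwise λ n → refl))

  supported-eδ : ∀ {a b d M} → SupportedOn (a ∷ b ∷ inside ∷ d ∷ M) eδ
  supported-eδ = supported-basis (there (there here))

  supported-eη : ∀ {a b c M} → SupportedOn (a ∷ b ∷ c ∷ inside ∷ M) eη
  supported-eη = supported-basis (there (there (there here)))

  supported-pad : ∀ {a b c d M x} → SupportedOn M x → SupportedOn (a ∷ b ∷ c ∷ d ∷ M) (pad x)
  supported-pad (supported h) = supported λ
    { zero _ → ≃-refl
    ; (suc zero) _ → ≃-refl
    ; δ _ → ≃-refl
    ; η _ → ≃-refl
    ; (kept i) i∉ → h i λ i∈ → i∉ (there (there (there (there i∈))))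
    }

  supported-without-δ : ∀ {a b c c′ d M p} → SupportedOn (a ∷ b ∷ c ∷ d ∷ M) p →
                        SupportedOn (a ∷ b ∷ c′ ∷ d ∷ M) (without-δ p)
  supported-without-δ (supported h) = supported λ
    { zero i∉ → h zero λ { here → i∉ here }
    ; (suc zero) i∉ → h _ λ { (there here) → i∉ (there here) }
    ; δ _ → ≃-refl
    ; η i∉ → h _ λ { (there (there (there here))) → i∉ (there (there (there here))) }
    ; (kept i) i∉ → h _ λ { (there (there (there i∈))) → i∉ (there (there (there i∈))) }
    }

  opaque
    -- The point of {δ, η} ∗ X given by (x , s) in the suspension of X.
    join : Vector ℝ m → ℝ → Vector ℝ (4 ℕ.+ m)
    join x s i = mix (Lo s) (mix (Hi s) (pad x i) (eδ i)) (eη i)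

    ht-of : Vector ℝ (4 ℕ.+ m) → ℝ
    ht-of p = Ht (p δ)

    rescaled : Vector ℝ (4 ℕ.+ m) → Vector ℝ (4 ℕ.+ m)
    rescaled p i = invᵣ (1-ᵣ p δ) · without-δ p i

    -- As u decreases from 1 to 0, deform p u first moves from p to retract p,
    -- whose δ-coordinate vanishes unless Lo (ht-of p) does, and only then
    -- towards η.
    retract : Vector ℝ (4 ℕ.+ m) → Vector ℝ (4 ℕ.+ m)
    retract p i = mix (Hi (ht-of p)) (rescaled p i) (eδ i)

    halfway : Vector ℝ (4 ℕ.+ m) → ℝ → Vector ℝ (4 ℕ.+ m)
    halfway p u i = mix (Hi u) (retract p i) (p i)

    deform : Vector ℝ (4 ℕ.+ m) → ℝ → Vector ℝ (4 ℕ.+ m)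
    deform p u i = mix (Lo (ht-of p)) (halfway p u i) (mix (Lo u) (halfway p u i) (eη i))

  -- How x ∈ ∥ X ∥ is chosen so that (x , ht-of p) is the image of p in the
  -- suspension; in the first two cases x is arbitrary, as ht-of p is 0 or 1.
  Choice : Vector ℝ (4 ℕ.+ m) → Vector ℝ m → Set
  Choice p x =
    p δ ≃ 0ℝ ⊎
    Eventually (λ n → ⅝ ℚ.≤ seq (p δ) n) ⊎
    Eventually (λ n → seq (p δ) n ℚ.≤ ¾) × p zero ≃ 0ℝ × p (suc zero) ≃ 0ℝ × p η ≃ 0ℝ ×
      (∀ i → x i ≃ rescaled p (kept i))

  opaque
    unfolding join ht-of rescaled retract halfway deform

    bottom-ht : ∀ p → p δ ≃ 0ℝ → ht-of p ≃ 0ℝ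
    bottom-ht p = Ht-0 {p δ}

    top-ht : ∀ p → Eventually (λ n → ⅝ ℚ.≤ seq (p δ) n) → ht-of p ≃ 1ℝ
    top-ht p h = Ht≃1 {p δ} (ev-map (λ n → ℚₚ.≤-trans ½≤⅝) h)

    low-ht : ∀ p → Eventually (λ n → seq (p δ) n ℚ.≤ ¼) → ht-of p ≃ 0ℝ
    low-ht p = Ht≃0 {p δ}

    high-ht : ∀ p → Eventually (λ n → ½ ℚ.≤ seq (p δ) n) → ht-of p ≃ 1ℝ
    high-ht p = Ht≃1 {p δ}

    0≤ht-of : ∀ p → 0ℝ ≤ ht-of p
    0≤ht-of p = termwise-≤ λ n → 0≤unit (ramp 4ℚ ¼ (seq (p δ) n))

    ht-of≤1 : ∀ p → ht-of p ≤ 1ℝ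
    ht-of≤1 p = termwise-≤ λ n → unit≤1 (ramp 4ℚ ¼ (seq (p δ) n))

    ht-of-cong : ∀ {p q} → p δ ≃ q δ → ht-of p ≃ ht-of q
    ht-of-cong = ap-cong ht-Lipschitz

    rescaled-kept-cong : ∀ {p q : Vector ℝ (4 ℕ.+ m)} → (∀ i → p i ≃ q i) → ∀ i → rescaled p (kept i) ≃ rescaled q (kept i)
    rescaled-kept-cong p≃q i = ·-cong (ap-cong inv-Lipschitz (ap-cong 1-Lipschitz (p≃q δ))) (p≃q (kept i))

    deform-1 : ∀ p i → deform p 1ℝ i ≃ p i
    deform-1 p i = mix-idem {Lo (ht-of p)} half (≃-trans (mix-0 {q = eη i} (Lo-1 ≃-refl)) half)
      where
      half : halfway p 1ℝ i ≃ p i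
      half = mix-1 {p = retract p i} (Hi-1 ≃-refl)

    -- Every admissible choice gives the same point: at the bottom both sides are η, at the top the
    -- weight `Hi` discards x, and otherwise padding x gives `rescaled p`. No complex occurs, so x
    -- may be chosen in a larger complex than the one containing the result.
    deform-0 : ∀ p {x} → Choice p x → ∀ i → join x (ht-of p) i ≃ deform p 0ℝ i
    deform-0 p {x} c i = ≃-trans (collapse c)
      (mix-cong {Lo (ht-of p)} ≃-refl (≃-sym half) (≃-sym (mix-1 {p = halfway p 0ℝ i} (Lo-0 ≃-refl))))
      where
      half : halfway p 0ℝ i ≃ retract p i
      half = mix-0 {q = p i} (Hi-0 ≃-refl)
  
      vanish : ∀ {y} → y ≃ 0ℝ → 0ℝ ≃ invᵣ (1-ᵣ p δ) · y
      vanish h = ≃-sym (·-0 (invᵣ (1-ᵣ p δ)) h)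
      pads : p zero ≃ 0ℝ → p (suc zero) ≃ 0ℝ → p η ≃ 0ℝ → (∀ i → x i ≃ rescaled p (kept i)) →
             ∀ i → pad x i ≃ rescaled p i
      pads h₀ h₁ h₃ hx zero = vanish h₀
      pads h₀ h₁ h₃ hx (suc zero) = vanish h₁
      pads h₀ h₁ h₃ hx δ = vanish ≃-refl
      pads h₀ h₁ h₃ hx η = vanish h₃
      pads h₀ h₁ h₃ hx (kept i) = hx i
      collapse : Choice p x → join x (ht-of p) i ≃ mix (Lo (ht-of p)) (retract p i) (eη i)
      collapse (bottom h) = ≃-trans
        (mix-1 {p = mix (Hi (ht-of p)) (pad x i) (eδ i)} (Lo-0 (bottom-ht p h)))
        (≃-sym (mix-1 {p = retract p i} (Lo-0 (bottom-ht p h))))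
      collapse (top h) = mix-cong {Lo (ht-of p)} {q = eη i} ≃-refl (≃-trans (mix-1 {p = pad x i} hi1)
        (≃-sym (mix-1 {p = rescaled p i} hi1))) ≃-refl
        where
        hi1 : Hi (ht-of p) ≃ 1ℝ
        hi1 = Hi-1 (top-ht p h)
      collapse (middle _ h₀ h₁ h₃ hx) = mix-cong {Lo (ht-of p)} {q = eη i} ≃-refl
        (mix-cong {Hi (ht-of p)} {q = eδ i} ≃-refl (pads h₀ h₁ h₃ hx i) ≃-refl) ≃-refl

    ∑-rescaled : ∀ p → ∑ p ≃ 1ℝ → Eventually (λ n → seq (p δ) n ℚ.≤ ¾) → ∑ (rescaled p) ≃ 1ℝ
    ∑-rescaled p h h≤¾ = ≃-trans (∑-· (invᵣ (1-ᵣ p δ)) (without-δ p))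
      (≃-trans (·-cong {invᵣ (1-ᵣ p δ)} ≃-refl (∑-without-δ p h)) (inv·1-≃1 (p δ) h≤¾))

    -- `rescaled p` is known to have sum 1 only up to ¾; from ⅝ on it has weight 0 in `retract p`.
    ∑-retract : ∀ p → ∑ p ≃ 1ℝ → ∑ (retract p) ≃ 1ℝ
    ∑-retract p h = ≃-trans (∑-mix (Hi (ht-of p)) (rescaled p) eδ) (go (compare (p δ) ⅝<¾))
      where
      go : Eventually (λ n → seq (p δ) n ℚ.≤ ¾) ⊎ Eventually (λ n → ⅝ ℚ.≤ seq (p δ) n) →
           mix (Hi (ht-of p)) (∑ (rescaled p)) (∑ eδ) ≃ 1ℝ
      go (inj₁ h≤¾) = mix-idem {Hi (ht-of p)} (∑-rescaled p h h≤¾) ∑-eδ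
      go (inj₂ ⅝≤h) = ≃-trans (mix-1 {p = ∑ (rescaled p)} (Hi-1 (top-ht p ⅝≤h))) ∑-eδ

    ∑-halfway : ∀ p u → ∑ p ≃ 1ℝ → ∑ (halfway p u) ≃ 1ℝ
    ∑-halfway p u h = ≃-trans (∑-mix (Hi u) (retract p) p) (mix-idem {Hi u} (∑-retract p h) h)

    ∑-deform : ∀ p u → ∑ p ≃ 1ℝ → ∑ (deform p u) ≃ 1ℝ
    ∑-deform p u h = ≃-trans (∑-mix (Lo (ht-of p)) (halfway p u) (λ i → mix (Lo u) (halfway p u i) (eη i)))
      (mix-idem {Lo (ht-of p)} (∑-halfway p u h)
        (≃-trans (∑-mix (Lo u) (halfway p u) eη) (mix-idem {Lo u} (∑-halfway p u h) ∑-eη)))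

    ∑-join : ∀ x s → ∑ x ≃ 1ℝ → ∑ (join x s) ≃ 1ℝ
    ∑-join x s h = ≃-trans (∑-mix (Lo s) (λ i → mix (Hi s) (pad x i) (eδ i)) eη)
      (mix-idem {Lo s} (≃-trans (∑-mix (Hi s) (pad x) eδ) (mix-idem {Hi s} (≃-trans (∑-pad x) h) ∑-eδ)) ∑-eη)

    join≥0 : ∀ {x} s → (∀ i → 0ℝ ≤ x i) → ∀ i → 0ℝ ≤ join x s i
    join≥0 s h i = mix-≥ {Lo s} 0ℚ (mix-≥ {Hi s} 0ℚ (pad≥0 h i) (basis≥0 {4 ℕ.+ m} δ i)) (basis≥0 {4 ℕ.+ m} η i)

    rescaled≥0 : ∀ {p} → (∀ i → 0ℝ ≤ p i) → ∀ i → 0ℝ ≤ rescaled p i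
    rescaled≥0 {p} h i = inv·-nonneg {1-ᵣ p δ} (without-δ≥0 h i)

    deform≥0 : ∀ {p} u → (∀ i → 0ℝ ≤ p i) → ∀ i → 0ℝ ≤ deform p u i
    deform≥0 {p} u h i = mix-≥ {Lo (ht-of p)} 0ℚ half (mix-≥ {Lo u} 0ℚ half (basis≥0 {4 ℕ.+ m} η i))
      where
      half : 0ℝ ≤ halfway p u i
      half = mix-≥ {Hi u} 0ℚ (mix-≥ {Hi (ht-of p)} 0ℚ (rescaled≥0 h i) (basis≥0 {4 ℕ.+ m} δ i)) (h i)

    -- The entry at δ may be changed at will, because `rescaled p` vanishes there.
    supported-rescaled : ∀ {a b c c′ d M p} → SupportedOn (a ∷ b ∷ c ∷ d ∷ M) p →
                         SupportedOn (a ∷ b ∷ c′ ∷ d ∷ M) (rescaled p)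
    supported-rescaled {p = p} h = supported λ i i∉ →
      ·-0 (invᵣ (1-ᵣ p δ)) (vanishes (supported-without-δ h) i i∉)

    supported-retract : ∀ {a b c c′ d M p} → Hi (ht-of p) ≃ 0ℝ → SupportedOn (a ∷ b ∷ c ∷ d ∷ M) p →
                        SupportedOn (a ∷ b ∷ c′ ∷ d ∷ M) (retract p)
    supported-retract {p = p} hi0 h = supported-≃ {x = retract p} {rescaled p} (λ i → mix-0 {p = rescaled p i} {eδ i} hi0) (supported-rescaled h)

    supported-deform : ∀ {τ : Subset (4 ℕ.+ m)} p u → SupportedOn τ (halfway p u) → SupportedOn τ eη →
                       SupportedOn τ (deform p u)
    supported-deform p u h hη = supported-mix (Lo (ht-of p)) (halfway p u) _ h (supported-mix (Lo u) (halfway p u) eη h hη)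

    ∑-kept : ∀ (p : Vector ℝ (4 ℕ.+ m)) → ∑ p ≃ 1ℝ → p zero ≃ 0ℝ → p (suc zero) ≃ 0ℝ → p η ≃ 0ℝ → ∑ (λ i → p (kept i)) ≃ 1-ᵣ p δ
    ∑-kept p h h₀ h₁ h₃ = ≃-trans {y = 0ℝ + (0ℝ + (0ℝ + (0ℝ + rest)))} (termwise λ n →
        solve 1 (λ r → r := con 0ℚ :+ (con 0ℚ :+ (con 0ℚ :+ (con 0ℚ :+ r)))) refl (seq rest n))
      (≃-trans (≃-sym (∑-blocks {0ℝ} {0ℝ} {0ℝ} {0ℝ} {rest} {without-δ p} h₀ h₁ ≃-refl h₃ ≃-refl)) (∑-without-δ p h))
      where
      rest : ℝ
      rest = ∑ (λ i → p (kept i))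

    ∑-rescaled-kept : ∀ (p : Vector ℝ (4 ℕ.+ m)) → ∑ p ≃ 1ℝ → Eventually (λ n → seq (p δ) n ℚ.≤ ¾) →
      p zero ≃ 0ℝ → p (suc zero) ≃ 0ℝ → p η ≃ 0ℝ → ∑ (λ i → rescaled p (kept i)) ≃ 1ℝ
    ∑-rescaled-kept p ∑p h≤¾ h₀ h₁ h₃ = ≃-trans (∑-· (invᵣ (1-ᵣ p δ)) (λ i → p (kept i)))
      (≃-trans (·-cong {invᵣ (1-ᵣ p δ)} ≃-refl (∑-kept p ∑p h₀ h₁ h₃)) (inv·1-≃1 (p δ) h≤¾))

    join-cong : ∀ {x y s t} → s ≃ t → s ≃ 0ℝ ⊎ s ≃ 1ℝ ⊎ (∀ i → x i ≃ y i) → ∀ i → join x s i ≃ join y t i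
    join-cong {x} {y} {s} {t} s≃t (inj₁ s≃0) i = ≃-trans
      (mix-1 {p = mix (Hi s) (pad x i) (eδ i)} (Lo-0 s≃0))
      (≃-sym (mix-1 {p = mix (Hi t) (pad y i) (eδ i)} (Lo-0 (≃-trans (≃-sym s≃t) s≃0))))
    join-cong {x} {y} {s} {t} s≃t (inj₂ (inj₁ s≃1)) i = mix-cong {q = eη i} (ap-cong lo-Lipschitz s≃t)
      (≃-trans (mix-1 {p = pad x i} (Hi-1 s≃1)) (≃-sym (mix-1 {p = pad y i} (Hi-1 (≃-trans (≃-sym s≃t) s≃1))))) ≃-refl
    join-cong {x} {y} s≃t (inj₂ (inj₂ x≃y)) i = mix-cong {q = eη i} (ap-cong lo-Lipschitz s≃t)
      (mix-cong {q = eδ i} (ap-cong hi-Lipschitz s≃t) (pads i) ≃-refl) ≃-refl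
      where
      pads : ∀ i → pad x i ≃ pad y i
      pads zero = ≃-refl
      pads (suc zero) = ≃-refl
      pads δ = ≃-refl
      pads η = ≃-refl
      pads (kept i) = x≃y i

    -- The outer `mix` would multiply by 1 - Lo s, but Lo s and Hi s are never both nonzero.
    join-δ : ∀ x s → join x s δ ≃ Hi s
    join-δ x s = go (Lo-or-Hi≃0 s)
      where
      go : Lo s ≃ 0ℝ ⊎ Hi s ≃ 0ℝ → join x s δ ≃ Hi s
      go (inj₁ lo0) = ≃-trans (mix-0 {q = 0ℝ} lo0) (termwise λ n →
        trans (solve 1 (λ u → con 0ℚ :+ u :* (con 1ℚ :- con 0ℚ) := u) refl (unit (hi (seq s n)))) (unit-idem (ramp 3ℚ ⅔ (seq s n))))
      go (inj₂ hi0) = ≃-trans (mix-idem {Lo s} (mix-0 {q = 1ℝ} hi0) ≃-refl) (≃-sym hi0)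

    ht-of-join : ∀ x s → ht-of (join x s) ≃ ap (Lipschitz-∘ ht-Lipschitz hi-Lipschitz) s
    ht-of-join x s = ≃-trans (ap-cong ht-Lipschitz (join-δ x s)) (termwise λ n → refl)

    join-η : ∀ x s → join x s η ≃ Lo s
    join-η x s = ≃-trans (mix-cong {Lo s} {q = 1ℝ} ≃-refl (mix-idem {Hi s} {0ℝ} {0ℝ} ≃-refl ≃-refl) ≃-refl)
      (termwise λ n → trans
        (solve 1 (λ u → con 0ℚ :+ u :* (con 1ℚ :- con 0ℚ) := u) refl (unit (lo (seq s n)))) (unit-idem (ramp 3ℚ ⅔ (1- seq s n))))

    -- Without η-coordinate Lo s vanishes, so the kept coordinates are (1 - Hi s) x, and 1 - Hi s is
    -- exactly the factor that rescaling divides out.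
    rescaled-join : ∀ x s → Eventually (λ n → seq (join x s δ) n ℚ.≤ ¾) → join x s η ≃ 0ℝ →
                    ∀ i → rescaled (join x s) (kept i) ≃ x i
    rescaled-join x s h≤¾ η0 i = ≃-trans
      (·-cong {invᵣ (1-ᵣ h)} ≃-refl (≃-trans (mix-0 {q = 0ℝ} (≃-trans (≃-sym (join-η x s)) η0)) shrink))
      (≃-trans {y = invᵣ (1-ᵣ h) · (1-ᵣ h) · x i} (termwise λ n → sym (ℚₚ.*-assoc (inv (1- seq h n)) (1- seq h n) (seq (x i) n)))
        (≃-trans (·-cong {y = x i} (inv·1-≃1 h h≤¾) ≃-refl) (termwise λ n → ℚₚ.*-identityˡ (seq (x i) n))))
      where
      h : ℝ
      h = join x s δ
      shrink : mix (Hi s) (x i) 0ℝ ≃ (1-ᵣ h) · x i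
      shrink = ≃-trans {y = (1-ᵣ Hi s) · x i}
        (termwise λ n → trans (solve 2 (λ u x → x :+ u :* (con 0ℚ :- x) := (con 1ℚ :- u) :* x) refl
                                 (unit (hi (seq s n))) (seq (x i) n))
                              (cong (λ u → (1- u) ℚ.* seq (x i) n) (unit-idem (ramp 3ℚ ⅔ (seq s n)))))
        (·-cong {y = x i} (ap-cong 1-Lipschitz (≃-sym (join-δ x s))) ≃-refl)

  module _ {A : Space} {p : Space.Carrier A → Vector ℝ (4 ℕ.+ m)} (cp : ∀ i → Cont A (λ a → p a i)) where

    opaque
      unfolding join ht-of rescaled retract halfway deform

      ht-cont : Cont A (λ a → ht-of (p a))
      ht-cont = Cont-ap ht-Lipschitz (cp δ)

      without-δ-cont : ∀ i → Cont A (λ a → without-δ (p a) i)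
      without-δ-cont zero = cp zero
      without-δ-cont (suc zero) = cp (suc zero)
      without-δ-cont δ = Cont-const 0ℝ
      without-δ-cont η = cp η
      without-δ-cont (kept i) = cp (kept i)

      rescaled-cont : ∀ i → Cont A (λ a → rescaled (p a) i)
      rescaled-cont i = Cont-· (Cont-ap inv-Lipschitz (Cont-ap 1-Lipschitz (cp δ))) (without-δ-cont i)

      deform-cont : ∀ {u} → Cont A u → ∀ i → Cont A (λ a → deform (p a) (u a) i)
      deform-cont {u} cu i = Cont-mix (Cont-ap lo-Lipschitz ht-cont) half
        (Cont-mix (Cont-ap lo-Lipschitz cu) half (Cont-const (eη i)))
        where
        half : Cont A (λ a → halfway (p a) (u a) i)
        half = Cont-mix (Cont-ap hi-Lipschitz cu)
          (Cont-mix (Cont-ap hi-Lipschitz ht-cont) (rescaled-cont i) (Cont-const (eδ i))) (cp i)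

  opaque
    unfolding join ht-of rescaled retract halfway deform

    join-cont : ∀ {A : Space} {x : Space.Carrier A → Vector ℝ m} {s} → (∀ i → Cont A (λ a → x a i)) → Cont A s →
                ∀ i → Cont A (λ a → join (x a) (s a) i)
    join-cont {A} {x} cx cs i = Cont-mix (Cont-ap lo-Lipschitz cs)
      (Cont-mix (Cont-ap hi-Lipschitz cs) (pads i) (Cont-const (eδ i))) (Cont-const (eη i))
      where
      pads : ∀ i → Cont A (λ a → pad (x a) i)
      pads zero = Cont-const 0ℝ
      pads (suc zero) = Cont-const 0ℝ
      pads δ = Cont-const 0ℝ
      pads η = Cont-const 0ℝ
      pads (kept i) = cx i

-- By `ht-of-join`, going from the suspension to the complex and back acts on the suspension
-- coordinate by this function.
module Ht∘Hi = Rescaling (Lipschitz-∘ ht-Lipschitz hi-Lipschitz)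
  (λ q → 0≤unit (ramp 4ℚ ¼ (hi q))) (λ q → unit≤1 (ramp 4ℚ ¼ (hi q))) refl refl

ht∈𝕀 : ∀ {m} → Vector ℝ (4 ℕ.+ m) → Space.Carrier 𝕀
ht∈𝕀 p = (λ _ → ht-of p) , 0≤ht-of p , ht-of≤1 p

-- The homotopy equivalence between a union of cones and the suspension

module _ {m} (X : SimplicialComplex m) (K : SimplicialComplex (4 ℕ.+ m)) (U : UnionOfCones X K) where
  open UnionOfCones U
  private
    module X = Space ∥ X ∥
    module K = Space ∥ K ∥

  Support : Vector ℝ (4 ℕ.+ m) → Set
  Support x = ∃[ τ ] (Simplex K τ × SupportedOn τ x)

  support : ∀ {x} → Support x → ∃[ τ ] (Simplex K τ × ∀ i → i ∉ˢ τ → x i ≃ 0ℝ)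
  support (τ , τ∈K , supported h) = τ , τ∈K , h

  opaque
    unfolding join ht-of rescaled retract halfway deform

    join-simplex : ∀ (x : X.Carrier) s → Support (join (proj₁ x) s)
    join-simplex (x , _ , _ , M , M∈X , x≃0) s = go (Lo-or-Hi≃0 s)
      where
      supp : SupportedOn M x
      supp = supported x≃0
      go : Lo s ≃ 0ℝ ⊎ Hi s ≃ 0ℝ → Support (join x s)
      go (inj₁ lo0) = δ∪ M , cone-δ (inj₂ M∈X) ,
        supported-≃ (λ i → mix-0 {p = mix (Hi s) (pad x i) (eδ i)} {eη i} lo0)
          (supported-mix (Hi s) (pad x) eδ (supported-pad supp) supported-eδ)
      go (inj₂ hi0) = η∪ M , cone-η (inj₂ M∈X) , supported-mix (Lo s) (λ i → mix (Hi s) (pad x i) (eδ i)) eη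
        (supported-≃ (λ i → mix-0 {p = pad x i} {eδ i} hi0) (supported-pad supp)) supported-eη

  fromSusp : Susp ∥ X ∥ ⟶ ∥ K ∥
  fromSusp = record
    { to         = f
    ; cong-to    = λ {p} {q} → f-cong p q
    ; continuous = λ {V} o → (λ {p} {q} p≈q → K.open-resp {V} o {f p} {f q} (f-cong p q p≈q)) , continuous f⊗ o
    }
    where
    f : Space.Carrier (Susp ∥ X ∥) → K.Carrier
    f (x , s) = join (proj₁ x) (height s) , join≥0 (height s) (proj₁ (proj₂ x)) ,
      ∑-join (proj₁ x) (height s) (proj₁ (proj₂ (proj₂ x))) , support (join-simplex x (height s))
    f-cong : ∀ p q → Space._≈_ (Susp ∥ X ∥) p q → f p K.≈ f q
    f-cong (x , s) (y , t) (s≃t , c) = join-cong {x = proj₁ x} {proj₁ y} {height s} {height t} s≃t c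
    f⊗ : ∥ X ∥ ⊗ 𝕀 ⟶ ∥ K ∥
    f⊗ = euclidean f (join-cont {A = ∥ X ∥ ⊗ 𝕀} {s = λ (x , s) → height s}
      (λ i → Cont-∘ {∥ X ∥ ⊗ 𝕀} {∥ X ∥} (coordinate i) (fst ∥ X ∥ 𝕀))
      (Cont-∘ {∥ X ∥ ⊗ 𝕀} {𝕀} height-cont (snd ∥ X ∥ 𝕀)))

  opaque
    unfolding join ht-of rescaled retract halfway deform

    -- The point stays in the simplex of p if nothing moves towards η, that is if `Lo u` or
    -- `Lo (ht-of p)` vanishes. Otherwise `Hi u` and `Hi (ht-of p)` vanish; then the halfway point
    -- has lost its δ-coordinate, and adding η to M gives a simplex.
    deform-link : ∀ {a b d M} p u → Simplex K (a ∷ b ∷ inside ∷ d ∷ M) → SupportedOn (a ∷ b ∷ inside ∷ d ∷ M) p →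
                  a ≡ outside × b ≡ outside × d ≡ outside × Face X M → Support (deform p u)
    deform-link {M = M} p u σ∈K supp (refl , refl , refl , M∈X) = go (Lo-or-Hi≃0 u) (Lo-or-Hi≃0 (ht-of p))
      where
      σ : Subset (4 ℕ.+ m)
      σ = δ∪ M
      end : Vector ℝ (4 ℕ.+ m)
      end i = mix (Lo u) (halfway p u i) (eη i)
      half : SupportedOn σ (halfway p u)
      half = supported-mix (Hi u) (retract p) p (supported-mix (Hi (ht-of p)) (rescaled p) eδ (supported-rescaled supp) supported-eδ) supp
      go : Lo u ≃ 0ℝ ⊎ Hi u ≃ 0ℝ → Lo (ht-of p) ≃ 0ℝ ⊎ Hi (ht-of p) ≃ 0ℝ → Support (deform p u)
      go (inj₁ lo0) _ = σ , σ∈K , supported-mix (Lo (ht-of p)) (halfway p u) end half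
        (supported-≃ {x = end} {halfway p u} (λ i → mix-0 {p = halfway p u i} {eη i} lo0) half)
      go (inj₂ _) (inj₁ lo0) = σ , σ∈K ,
        supported-≃ {x = deform p u} {halfway p u} (λ i → mix-0 {p = halfway p u i} {end i} lo0) half
      go (inj₂ hi0) (inj₂ hi0′) = η∪ M , cone-η M∈X , supported-deform p u
        (supported-≃ {x = halfway p u} {retract p} (λ i → mix-0 {p = retract p i} {p i} hi0)
          (supported-⊆ {σ = ∅ˢ {4} Data.Vec.++ M} (λ { (there (there (there (there i∈)))) → there (there (there (there i∈))) })
            (supported-retract {p = p} hi0′ supp)))
        supported-eη

    deform-simplex : ∀ (p : K.Carrier) u → Support (deform (proj₁ p) u)
    deform-simplex (p , _ , _ , (a ∷ b ∷ outside ∷ d ∷ M) , σ∈K , p≃0) u =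
      a ∷ b ∷ outside ∷ inside ∷ M , add-η σ∈K ,
      supported-deform p u (supported-mix (Hi u) (retract p) p (widen (supported-retract {p = p} hi0 supp)) (widen supp)) supported-eη
      where
      supp : SupportedOn (a ∷ b ∷ outside ∷ d ∷ M) p
      supp = supported p≃0
      hi0 : Hi (ht-of p) ≃ 0ℝ
      hi0 = Hi-0 (bottom-ht p (p≃0 δ λ { (there (there ())) }))
      widen : ∀ {x} → SupportedOn (a ∷ b ∷ outside ∷ d ∷ M) x → SupportedOn (a ∷ b ∷ outside ∷ inside ∷ M) x
      widen = supported-⊆ λ { here → here ; (there here) → there here ; (there (there (there here))) → there (there (there here))
                            ; (there (there (there (there i∈)))) → there (there (there (there i∈))) }
    deform-simplex (p , _ , _ , (a ∷ b ∷ inside ∷ d ∷ M) , σ∈K , p≃0) u =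
      deform-link p u σ∈K (supported p≃0) (link-δ σ∈K)

  deformₜ : ∥ K ∥ ⊗ 𝕀 ⟶ ∥ K ∥
  deformₜ = euclidean
    (λ (p , u) → deform (proj₁ p) (height u) , deform≥0 (height u) (proj₁ (proj₂ p)) ,
      ∑-deform (proj₁ p) (height u) (proj₁ (proj₂ (proj₂ p))) , support (deform-simplex p (height u)))
    (deform-cont {A = ∥ K ∥ ⊗ 𝕀} {p = λ (p , _) → proj₁ p}
      (λ i → Cont-∘ {∥ K ∥ ⊗ 𝕀} {∥ K ∥} (coordinate i) (fst ∥ K ∥ 𝕀))
      {λ (_ , u) → height u}
      (Cont-∘ {∥ K ∥ ⊗ 𝕀} {𝕀} height-cont (snd ∥ K ∥ 𝕀)))

  deformation : ∀ (f : ∥ K ∥ ⟶ ∥ K ∥) → (∀ p i → proj₁ (to f p) i ≃ deform (proj₁ p) 0ℝ i) → Homotopy f idₜ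
  deformation f h = record
    { H  = deformₜ
    ; H₀ = λ p i → ≃-sym (h p i)
    ; H₁ = λ p i → deform-1 (proj₁ p) i
    }

  module _ (base : X.Carrier) where

    choose-link : ∀ {a b d M} (p : Vector ℝ (4 ℕ.+ m)) → (∀ i → 0ℝ ≤ p i) → ∑ p ≃ 1ℝ →
                  SupportedOn (a ∷ b ∷ inside ∷ d ∷ M) p → a ≡ outside × b ≡ outside × d ≡ outside × Face X M →
                  Σ X.Carrier λ x → Choice p (proj₁ x)
    choose-link {M = M} p p≥0 ∑p (supported supp) (refl , refl , refl , M∈X) = go (compare (p δ) ⅝<¾) M∈X
      where
      p0 : p zero ≃ 0ℝ
      p0 = supp zero λ ()
      p1 : p (suc zero) ≃ 0ℝ
      p1 = supp (suc zero) λ { (there ()) }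
      p3 : p η ≃ 0ℝ
      p3 = supp η λ { (there (there (there ()))) }
      kept-supp : ∀ i → i ∉ˢ M → rescaled p (kept i) ≃ 0ℝ
      kept-supp i i∉ = vanishes (supported-rescaled {c′ = inside} (supported supp)) (kept i)
        λ { (there (there (there (there i∈)))) → i∉ i∈ }
      go : Eventually (λ n → seq (p δ) n ℚ.≤ ¾) ⊎ Eventually (λ n → ⅝ ℚ.≤ seq (p δ) n) → Face X M →
           Σ X.Carrier λ x → Choice p (proj₁ x)
      go (inj₂ ⅝≤h) _ = base , top ⅝≤h
      go (inj₁ h≤¾) (inj₂ M∈X) =
        ((λ i → rescaled p (kept i)) , (λ i → rescaled≥0 {p = p} p≥0 (kept i)) ,
          ∑-rescaled-kept p ∑p h≤¾ p0 p1 p3 , M , M∈X , kept-supp) ,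
        middle h≤¾ p0 p1 p3 λ i → ≃-refl
      -- M is empty, so p is the apex δ; its δ-coordinate is 1, hence eventually above 1 - ⅜ = ⅝.
      go (inj₁ h≤¾) (inj₁ refl) = base , top (ev-map (λ n k → ℚₚ.<⇒≤ (+-cancelʳ-< ⅜
          (∣-∣<⇒<+ 1ℚ (seq (p δ) n) k))) (_≃_.apply 1≃h ⅜ (ℚₚ.positive⁻¹ ⅜)))
        where
        none : ∑ (λ i → p (kept i)) ≃ 0ℝ
        none = ∑-0 λ i → supp (kept i) λ { (there (there (there (there i∈)))) → Subₚ.∉⊥ i∈ }
        1≃h : 1ℝ ≃ p δ
        1≃h = ≃-trans (≃-sym ∑p) (≃-trans (∑-blocks {p = p} p0 p1 ≃-refl p3 none)
          (termwise λ n → solve 1 (λ h → con 0ℚ :+ (con 0ℚ :+ (h :+ (con 0ℚ :+ con 0ℚ))) := h) refl (seq (p δ) n)))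

    choose : (p : K.Carrier) → Σ X.Carrier λ x → Choice (proj₁ p) (proj₁ x)
    choose (p , _ , _ , (a ∷ b ∷ outside ∷ d ∷ M) , σ∈K , supp) =
      base , bottom (supp δ λ { (there (there ())) })
    choose (p , p≥0 , ∑p , (a ∷ b ∷ inside ∷ d ∷ M) , σ∈K , supp) =
      choose-link p p≥0 ∑p (supported supp) (link-δ σ∈K)

    to-ΣX : K.Carrier → Space.Carrier (Susp ∥ X ∥)
    to-ΣX p = proj₁ (choose p) , ht∈𝕀 (proj₁ p)

    ht-map : ∥ K ∥ ⟶ 𝕀
    ht-map = euclidean {X = ∥ K ∥} (λ p → ht∈𝕀 (proj₁ p)) λ { zero → ht-cont {A = ∥ K ∥} coordinate }

    -- Equal points may carry different simplices and so lead to different choices. If one of these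
    -- is `bottom` or `top`, the common height is that of a pole; otherwise both are given by the
    -- same formula.
    choice-cong : ∀ {p q} {x y : X.Carrier} → (∀ i → p i ≃ q i) → Choice p (proj₁ x) → Choice q (proj₁ y) →
                  ht-of p ≃ 0ℝ ⊎ ht-of p ≃ 1ℝ ⊎ x X.≈ y
    choice-cong {p} p≃q (bottom h) _ = inj₁ (bottom-ht p h)
    choice-cong {p} p≃q (top h) _ = inj₂ (inj₁ (top-ht p h))
    choice-cong {p} {q} p≃q (middle _ _ _ _ _) (bottom h) =
      inj₁ (≃-trans (ht-of-cong {p = p} {q} (p≃q δ)) (bottom-ht q h))
    choice-cong {p} {q} p≃q (middle _ _ _ _ _) (top h) =
      inj₂ (inj₁ (≃-trans (ht-of-cong {p = p} {q} (p≃q δ)) (top-ht q h)))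
    choice-cong {p} {q} p≃q (middle _ _ _ _ hx) (middle _ _ _ _ hy) = inj₂ (inj₂ λ i →
      ≃-trans (hx i) (≃-trans (rescaled-kept-cong {p = p} {q} p≃q i) (≃-sym (hy i))))

    module _ {V : Pred (Space.Carrier (Susp ∥ X ∥)) 0ℓ} (oV : Space.Open (Susp ∥ X ∥) V) where

      δ-near : (p : K.Carrier) → Neighbourhood ∥ K ∥ p λ q → Close ⅛ (proj₁ p δ) (proj₁ q δ)
      δ-near p = Cont.nbhd {∥ K ∥} (coordinate δ) p (ℚₚ.positive⁻¹ ⅛)

      -- Within ⅛ of p the δ-coordinate is at most ⅛ + ⅛ = ¼, where `ht` is still 0, so all points
      -- nearby go to the same pole.
      near-bottom : ∀ p → V (to-ΣX p) → proj₁ p δ ≃ 0ℝ → Neighbourhood ∥ K ∥ p (V ∘ to-ΣX)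
      near-bottom p v h = neighbourhood-⊆ ∥ K ∥
        (λ {q} c → proj₁ oV {to-ΣX p} {to-ΣX q} (0~ {∥ X ∥} {proj₁ (choose p)} {proj₁ (choose q)} {ht∈𝕀 (proj₁ p)} {ht∈𝕀 (proj₁ q)} (bottom-ht (proj₁ p) h)
          (low-ht (proj₁ q) (ev-zip (λ n → below (seq (proj₁ p δ) n) (seq (proj₁ q δ) n)) (Close.within c)
            (_≃_.apply h ⅛ (ℚₚ.positive⁻¹ ⅛))))) v)
        (δ-near p)
        where
        below : ∀ a b → ℚ.∣ a ℚ.- b ∣ ℚ.< ⅛ → ℚ.∣ a ℚ.- 0ℚ ∣ ℚ.< ⅛ → b ℚ.≤ ¼
        below a b h k = ℚₚ.≤-trans (ℚₚ.<⇒≤ (∣-∣<⇒<+ b a (subst (ℚ._< ⅛) (∣-∣-sym a b) h)))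
          (ℚₚ.+-monoˡ-≤ ⅛ (ℚₚ.<⇒≤ (∣-∣<⇒<+ a 0ℚ k)))

      -- As at the bottom, now with ⅝ - ⅛ = ½, from where on `ht` is 1.
      near-top : ∀ p → V (to-ΣX p) → Eventually (λ n → ⅝ ℚ.≤ seq (proj₁ p δ) n) → Neighbourhood ∥ K ∥ p (V ∘ to-ΣX)
      near-top p v h = neighbourhood-⊆ ∥ K ∥
        (λ {q} c → proj₁ oV {to-ΣX p} {to-ΣX q} (1~ {∥ X ∥} {proj₁ (choose p)} {proj₁ (choose q)} {ht∈𝕀 (proj₁ p)} {ht∈𝕀 (proj₁ q)} (top-ht (proj₁ p) h)
          (high-ht (proj₁ q) (ev-zip (λ n → above (seq (proj₁ p δ) n) (seq (proj₁ q δ) n)) (Close.within c) h))) v)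
        (δ-near p)
        where
        above : ∀ a b → ℚ.∣ a ℚ.- b ∣ ℚ.< ⅛ → ⅝ ℚ.≤ a → ½ ℚ.≤ b
        above a b h k = ℚₚ.<⇒≤ (+-cancelʳ-< ⅛ (ℚₚ.≤-<-trans k (∣-∣<⇒<+ a b h)))

      -- A nearby q need not be in the middle case itself. The box first gives V at the x of p and
      -- the height of q; if q goes to a pole, this is already its image, and otherwise its x is
      -- `rescaled q`, which is close to that of p.
      near-middle : ∀ p → V (to-ΣX p) → (∀ i → proj₁ (proj₁ (choose p)) i ≃ rescaled (proj₁ p) (kept i)) →
                    Neighbourhood ∥ K ∥ p (V ∘ to-ΣX)
      near-middle p v hx =
        let (A , B , oA , oB , a , b , box) = proj₂ oV (to-ΣX p) v
            (ε , ε>0 , ball-A) = lower oA (proj₁ (choose p)) a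
            -- ε is halved twice for `Close-resp` and once for `Close⇒Near`.
            near-x : Neighbourhood ∥ K ∥ p λ q →
              ∀ i → Close (½ ℚ.* (½ ℚ.* (½ ℚ.* ε))) (rescaled (proj₁ p) (kept i)) (rescaled (proj₁ q) (kept i))
            near-x = ball {∥ K ∥} (λ i → rescaled-cont {A = ∥ K ∥} coordinate (kept i)) p (half>0 (half>0 (half>0 ε>0)))
            near-s : Neighbourhood ∥ K ∥ p λ q → B (ht∈𝕀 (proj₁ q))
            near-s = B ∘ ht∈𝕀 ∘ proj₁ , continuous ht-map oB , b , id
        in neighbourhood-⊆ ∥ K ∥
          (λ {q} (c , bq) → transfer q (proj₂ (choose q)) (box a bq) λ hy → box
            (ball-A (proj₁ (choose q)) λ i → Close⇒Near ε>0 (Close-resp (half>0 ε>0) (≃-sym (hx i)) (≃-sym (hy i)) (c i))) bq)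
          (neighbourhood-∩ ∥ K ∥ near-x near-s)
        where
        transfer : ∀ q → Choice (proj₁ q) (proj₁ (proj₁ (choose q))) → V (proj₁ (choose p) , ht∈𝕀 (proj₁ q)) →
          ((∀ i → proj₁ (proj₁ (choose q)) i ≃ rescaled (proj₁ q) (kept i)) → V (to-ΣX q)) → V (to-ΣX q)
        transfer q (bottom h) v _ = proj₁ oV {proj₁ (choose p) , ht∈𝕀 (proj₁ q)} {to-ΣX q}
          (0~ {∥ X ∥} {proj₁ (choose p)} {proj₁ (choose q)} {ht∈𝕀 (proj₁ q)} {ht∈𝕀 (proj₁ q)} (bottom-ht (proj₁ q) h) (bottom-ht (proj₁ q) h)) v
        transfer q (top h) v _ = proj₁ oV {proj₁ (choose p) , ht∈𝕀 (proj₁ q)} {to-ΣX q}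
          (1~ {∥ X ∥} {proj₁ (choose p)} {proj₁ (choose q)} {ht∈𝕀 (proj₁ q)} {ht∈𝕀 (proj₁ q)} (top-ht (proj₁ q) h) (top-ht (proj₁ q) h)) v
        transfer q (middle _ _ _ _ hy) _ k = k hy

      to-ΣX-open : Space.Open ∥ K ∥ (V ∘ to-ΣX)
      to-ΣX-open = locally⇒open ∥ K ∥ λ p v → go p v (proj₂ (choose p))
        where
        go : ∀ p → V (to-ΣX p) → Choice (proj₁ p) (proj₁ (proj₁ (choose p))) → Neighbourhood ∥ K ∥ p (V ∘ to-ΣX)
        go p v (bottom h) = near-bottom p v h
        go p v (top h) = near-top p v h
        go p v (middle _ _ _ _ hx) = near-middle p v hx

    toSusp : ∥ K ∥ ⟶ Susp ∥ X ∥
    toSusp = record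
      { to         = to-ΣX
      ; cong-to    = λ {p} {q} p≈q → ht-of-cong {p = proj₁ p} {proj₁ q} (p≈q δ) ,
          choice-cong {x = proj₁ (choose p)} {proj₁ (choose q)} p≈q (proj₂ (choose p)) (proj₂ (choose q))
      ; continuous = to-ΣX-open
      }

    start≈to∘from : ∀ x s → Space._≈_ (Susp ∥ X ∥) (Ht∘Hi.stretch X (x , s) 0𝕀) (to-ΣX (to fromSusp (x , s)))
    start≈to∘from x s = heights , go (proj₂ (choose (to fromSusp (x , s))))
      where
      p : Vector ℝ (4 ℕ.+ m)
      p = join (proj₁ x) (height s)
      y : X.Carrier
      y = proj₁ (choose (to fromSusp (x , s)))
      start : ℝ
      start = Ht∘Hi.slide s 0𝕀
      heights : start ≃ ht-of p
      heights = ≃-trans (Ht∘Hi.slide-start s) (≃-sym (ht-of-join (proj₁ x) (height s)))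
      go : Choice p (proj₁ y) → start ≃ 0ℝ ⊎ start ≃ 1ℝ ⊎ x X.≈ y
      go (bottom h) = inj₁ (≃-trans heights (bottom-ht p h))
      go (top h) = inj₂ (inj₁ (≃-trans heights (top-ht p h)))
      go (middle h≤¾ _ _ η0 hy) = inj₂ (inj₂ λ i →
        ≃-sym (≃-trans (hy i) (rescaled-join (proj₁ x) (height s) h≤¾ η0 i)))

    from∘to : ∥ K ∥ ⟶ ∥ K ∥
    from∘to = _∘ₜ_ {∥ K ∥} {Susp ∥ X ∥} {∥ K ∥} fromSusp toSusp

    to∘from : Susp ∥ X ∥ ⟶ Susp ∥ X ∥
    to∘from = _∘ₜ_ {Susp ∥ X ∥} {∥ K ∥} {Susp ∥ X ∥} toSusp fromSusp

    stretching : Susp ∥ X ∥ ⊗ 𝕀 ⟶ Susp ∥ X ∥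
    stretching = Ht∘Hi.stretchₜ X

    stretching-start : ∀ p → Space._≈_ (Susp ∥ X ∥) (to stretching (p , 0𝕀)) (to to∘from p)
    stretching-start (x , s) = start≈to∘from x s

    stretching-end : ∀ p → Space._≈_ (Susp ∥ X ∥) (to stretching (p , 1𝕀)) p
    stretching-end (x , s) = Ht∘Hi.slide-end s , inj₂ (inj₂ λ i → ≃-refl)

    susp-equivalence : IsHomotopyEquivalence toSusp
    susp-equivalence = record
      { inverse = fromSusp
      ; left    = deformation from∘to λ p → deform-0 (proj₁ p) {proj₁ (proj₁ (choose p))} (proj₂ (choose p))
      ; right   = record { H = stretching ; H₀ = stretching-start ; H₁ = stretching-end }
      }

-- Inclusions between unions of cones over the same complex

module _ {m} (X : SimplicialComplex m) (L K : SimplicialComplex (4 ℕ.+ m)) (base : Space.Carrier ∥ X ∥)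
  (UL : UnionOfCones X L) (UK : UnionOfCones X K) (L⊑K : L ⊑ K) where

  include : ∥ L ∥ ⟶ ∥ K ∥
  include = inclusion {L = L} {K} L⊑K

  retraction : ∥ K ∥ ⟶ ∥ L ∥
  retraction = _∘ₜ_ {∥ K ∥} {Susp ∥ X ∥} {∥ L ∥} (fromSusp X L UL) (toSusp X K UK base)

  r∘i : ∥ L ∥ ⟶ ∥ L ∥
  r∘i = _∘ₜ_ {∥ L ∥} {∥ K ∥} {∥ L ∥} retraction include

  i∘r : ∥ K ∥ ⟶ ∥ K ∥
  i∘r = _∘ₜ_ {∥ K ∥} {∥ L ∥} {∥ K ∥} include retraction

  -- The point of X is chosen in K although the result lies in L; `deform-0` allows this.
  r∘i-0 : ∀ (p : Space.Carrier ∥ L ∥) i → proj₁ (to r∘i p) i ≃ deform (proj₁ p) 0ℝ i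
  r∘i-0 p = deform-0 (proj₁ p) {proj₁ (proj₁ (choose X K UK base (to include p)))} (proj₂ (choose X K UK base (to include p)))

  i∘r-0 : ∀ (p : Space.Carrier ∥ K ∥) i → proj₁ (to i∘r p) i ≃ deform (proj₁ p) 0ℝ i
  i∘r-0 p = deform-0 (proj₁ p) {proj₁ (proj₁ (choose X K UK base p))} (proj₂ (choose X K UK base p))

  inclusion-equivalence : IsHomotopyEquivalence include
  inclusion-equivalence = record
    { inverse = retraction
    ; left    = deformation X L UL r∘i r∘i-0
    ; right   = deformation X K UK i∘r i∘r-0
    }

-- Multipaths as acyclic edge sets without branching

module _ {n m : ℕ} (src tgt : Fin m → Fin n) (S : Subset m) where

  -- Accessibility along the edges of S: an inductive form of acyclicity that also supplies the
  -- recursion for following edges to their end.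
  data Terminates (u : Fin n) : Set where
    term : (∀ e → e ∈ˢ S → src e ≡ u → Terminates (tgt e)) → Terminates u

module _ {n m : ℕ} (src tgt : Fin m → Fin n) (S : Subset m) where

  -- Each condition is paired with its mirror image, so reversal of all edges just permutes the
  -- fields.
  record LinearForest : Set where
    field
      out-unique : ∀ {e f} → e ∈ˢ S → f ∈ˢ S → src e ≡ src f → e ≡ f
      in-unique  : ∀ {e f} → e ∈ˢ S → f ∈ˢ S → tgt e ≡ tgt f → e ≡ f
      forward    : ∀ u → Terminates src tgt S u
      backward   : ∀ u → Terminates tgt src S u

open LinearForest

terminates-⊆ : ∀ {n m} {src tgt : Fin m → Fin n} {S T u} → T ⊆ˢ S → Terminates src tgt S u → Terminates src tgt T u
terminates-⊆ T⊆S (term h) = term λ e e∈ eq → terminates-⊆ T⊆S (h e (T⊆S e∈) eq)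

linearForest-⊆ : ∀ {n m} {src tgt : Fin m → Fin n} {S T} → T ⊆ˢ S → LinearForest src tgt S → LinearForest src tgt T
linearForest-⊆ T⊆S F = record
  { out-unique = λ e∈ f∈ → out-unique F (T⊆S e∈) (T⊆S f∈)
  ; in-unique  = λ e∈ f∈ → in-unique F (T⊆S e∈) (T⊆S f∈)
  ; forward    = λ u → terminates-⊆ T⊆S (forward F u)
  ; backward   = λ u → terminates-⊆ T⊆S (backward F u)
  }

linearForest-reverse : ∀ {n m} {src tgt : Fin m → Fin n} {S} → LinearForest src tgt S → LinearForest tgt src S
linearForest-reverse F = record
  { out-unique = in-unique F ; in-unique = out-unique F ; forward = backward F ; backward = forward F }

module _ {n m} {src tgt src′ tgt′ : Fin m → Fin n} (s : ∀ e → src e ≡ src′ e) (t : ∀ e → tgt e ≡ tgt′ e) where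

  terminates-cong : ∀ {S u} → Terminates src tgt S u → Terminates src′ tgt′ S u
  terminates-cong {S} (term h) = term λ e e∈ eq →
    subst (Terminates src′ tgt′ S) (t e) (terminates-cong (h e e∈ (trans (s e) eq)))

linearForest-cong : ∀ {n m} {src tgt src′ tgt′ : Fin m → Fin n} → (∀ e → src e ≡ src′ e) → (∀ e → tgt e ≡ tgt′ e) →
  ∀ {S} → LinearForest src tgt S → LinearForest src′ tgt′ S
linearForest-cong s t F = record
  { out-unique = λ {e} {f} e∈ f∈ eq → out-unique F e∈ f∈ (trans (s e) (trans eq (sym (s f))))
  ; in-unique  = λ {e} {f} e∈ f∈ eq → in-unique F e∈ f∈ (trans (t e) (trans eq (sym (t f))))
  ; forward    = terminates-cong s t ∘ forward F
  ; backward   = terminates-cong t s ∘ backward F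
  }

linearForest-∅ : ∀ {n m} (src tgt : Fin m → Fin n) → LinearForest src tgt ∅ˢ
linearForest-∅ src tgt = record
  { out-unique = λ e∈ → ⊥-elim (Subₚ.∉⊥ e∈)
  ; in-unique  = λ e∈ → ⊥-elim (Subₚ.∉⊥ e∈)
  ; forward    = λ u → term λ e e∈ → ⊥-elim (Subₚ.∉⊥ e∈)
  ; backward   = λ u → term λ e e∈ → ⊥-elim (Subₚ.∉⊥ e∈)
  }

linearForest-singleton : ∀ {n m} (src tgt : Fin m → Fin n) f → src f ≢ tgt f → LinearForest src tgt ⁅ f ⁆
linearForest-singleton src tgt f no-loop = record
  { out-unique = λ e∈ f∈ _ → trans (is-f e∈) (sym (is-f f∈))
  ; in-unique  = λ e∈ f∈ _ → trans (is-f e∈) (sym (is-f f∈))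
  ; forward    = λ u → term λ e e∈ _ → term λ e′ e′∈ eq →
      ⊥-elim (no-loop (trans (cong src (sym (is-f e′∈))) (trans eq (cong tgt (is-f e∈)))))
  ; backward   = λ u → term λ e e∈ _ → term λ e′ e′∈ eq →
      ⊥-elim (no-loop (trans (cong src (sym (is-f e∈))) (trans (sym eq) (cong tgt (is-f e′∈)))))
  }
  where
  is-f : ∀ {e} → e ∈ˢ ⁅ f ⁆ → e ≡ f
  is-f = Subₚ.x∈⁅y⁆⇒x≡y f

-- From multipaths to linear forests

module _ (G : Digraph) {S : Subset (Digraph.size G)} where
  open Digraph G

  private
    module PathComp {w} (C : PathComponent G S w) where
      open PathComponent C renaming (length-1 to k)
      open SimplePath simplePath

      on-path : ∀ {e} → e ∈ˢ S → Connected G S w (src e) → ∃[ i ] path i ≡ e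
      on-path e∈ c = Equivalence.to (edges _) (e∈ , c)

      src-connected : ∀ i → Connected G S w (src (path i))
      src-connected i = Equivalence.from (vertices _) (i , inj₁ refl)

      tgt-connected : ∀ i → Connected G S w (tgt (path i))
      tgt-connected i = Equivalence.from (vertices _) (i , inj₂ refl)

      into : ∀ {e i} → e ∈ˢ S → tgt e ≡ tgt (path i) → path i ≡ e
      into {e} {i} e∈ eq
        with on-path e∈ (tgt-connected i ◅◅ (bwd (e , e∈ , refl , eq) ◅ done))
      ... | j , refl = cong path (injective _ _ (inj₂ (sym eq)))

      out-of : ∀ {e i} → e ∈ˢ S → src e ≡ src (path i) → path i ≡ e
      out-of {e} {i} e∈ eq with on-path e∈ (subst (Connected G S w) (sym eq) (src-connected i))
      ... | j , refl = cong path (injective _ _ (inj₁ (sym eq)))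

      -- Such an edge would lie on the path. As its first edge it would close a cycle; as a later
      -- one, its predecessor would share its target with the last edge, against injectivity.
      last-terminal : ∀ e → e ∈ˢ S → src e ≢ tgt (path (fromℕ k))
      last-terminal e e∈ eq with on-path e∈ (subst (Connected G S w) (sym eq) (tgt-connected (fromℕ k)))
      ... | zero  , refl = non-cycle eq
      ... | suc j , refl = Finₚ.fromℕ≢inject₁ (sym (injective _ _ (inj₂ (trans (sym (chain j)) eq))))

      first-initial : ∀ e → e ∈ˢ S → tgt e ≢ src (path zero)
      first-initial e e∈ eq
        with on-path e∈ (src-connected zero ◅◅ (bwd (e , e∈ , refl , eq) ◅ done))
      ... | j , refl with view j
      ...   | ‵fromℕ = non-cycle (sym eq)
      ...   | ‵inject₁ j′ with injective (suc j′) zero (inj₁ (trans (chain j′) eq))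
      ...     | ()

      forward-tgt : ∀ i → Terminates src tgt S (tgt (path i))
      forward-tgt = >-weakInduction (λ i → Terminates src tgt S (tgt (path i)))
        (term λ e e∈ eq → ⊥-elim (last-terminal e e∈ eq))
        λ i h → term λ e e∈ eq → subst (Terminates src tgt S ∘ tgt) (out-of e∈ (trans eq (sym (chain i)))) h

      backward-src : ∀ i → Terminates tgt src S (src (path i))
      backward-src = <-weakInduction (λ i → Terminates tgt src S (src (path i)))
        (term λ e e∈ eq → ⊥-elim (first-initial e e∈ eq))
        λ i h → term λ e e∈ eq → subst (Terminates tgt src S ∘ src) (into e∈ (trans eq (chain i))) h

      forward-w : Terminates src tgt S w
      forward-w with Equivalence.to (vertices w) done
      ... | i , inj₁ eq = subst (Terminates src tgt S) eq
            (term λ e e∈ eq → subst (Terminates src tgt S ∘ tgt) (out-of e∈ eq) (forward-tgt i))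
      ... | i , inj₂ eq = subst (Terminates src tgt S) eq (forward-tgt i)

      backward-w : Terminates tgt src S w
      backward-w with Equivalence.to (vertices w) done
      ... | i , inj₁ eq = subst (Terminates tgt src S) eq (backward-src i)
      ... | i , inj₂ eq = subst (Terminates tgt src S) eq
            (term λ e e∈ eq → subst (Terminates tgt src S ∘ src) (into e∈ eq) (backward-src i))

  multipath⇒linearForest : Multipath G S → LinearForest src tgt S
  multipath⇒linearForest mp = record
    { out-unique = λ {e} → out e (mp (src e))
    ; in-unique  = λ {e} → inn e (mp (src e))
    ; forward    = λ u → fw u (mp u)
    ; backward   = λ u → bw u (mp u)
    }
    where
    out : ∀ e {f} → VertexComponent G S (src e) ⊎ PathComponent G S (src e) → e ∈ˢ S → f ∈ˢ S → src e ≡ src f → e ≡ f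
    out e (inj₁ C) e∈ _ _ = ⊥-elim (VertexComponent.edges C e e∈ done)
    out e (inj₂ C) e∈ f∈ eq with PathComp.on-path C e∈ done
    ... | i , p = trans (sym p) (PathComp.out-of C f∈ (trans (sym eq) (cong src (sym p))))
    inn : ∀ e {f} → VertexComponent G S (src e) ⊎ PathComponent G S (src e) → e ∈ˢ S → f ∈ˢ S → tgt e ≡ tgt f → e ≡ f
    inn e (inj₁ C) e∈ _ _ = ⊥-elim (VertexComponent.edges C e e∈ done)
    inn e (inj₂ C) e∈ f∈ eq with PathComp.on-path C e∈ done
    ... | i , p = trans (sym p) (PathComp.into C f∈ (trans (sym eq) (cong tgt (sym p))))
    fw : ∀ u → VertexComponent G S u ⊎ PathComponent G S u → Terminates src tgt S u
    fw u (inj₁ C) = term λ { e e∈ refl → ⊥-elim (VertexComponent.edges C e e∈ done) }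
    fw u (inj₂ C) = PathComp.forward-w C
    bw : ∀ u → VertexComponent G S u ⊎ PathComponent G S u → Terminates tgt src S u
    bw u (inj₁ C) = term λ { e e∈ refl → ⊥-elim (VertexComponent.edges C e e∈ (bwd (e , e∈ , refl , refl) ◅ done)) }
    bw u (inj₂ C) = PathComp.backward-w C

-- From linear forests to multipaths

module _ {n m : ℕ} (src tgt : Fin m → Fin n) (S : Subset m) where

  -- `stop` demands that no edge leaves u, so walks are maximal; without branching, the length
  -- depends on the starting vertex alone.
  data Walk : Fin n → ℕ → Set where
    stop : ∀ {u} → (∀ e → e ∈ˢ S → src e ≢ u) → Walk u zero
    step : ∀ {u k} e → e ∈ˢ S → src e ≡ u → Walk (tgt e) k → Walk u (suc k)

  walk : ∀ {u} → Terminates src tgt S u → ∃[ k ] Walk u k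
  walk {u} (term h) with Finₚ.any? (λ e → (e Subₚ.∈? S) ×-dec (src e Fin.≟ u))
  ... | yes (e , e∈ , eq) = let (k , W) = walk (h e e∈ eq) in suc k , step e e∈ eq W
  ... | no  none          = zero , stop λ e e∈ eq → none (e , e∈ , eq)

  edgeAt : ∀ {u k} → Walk u k → Fin k → Fin m
  edgeAt (step e _ _ W) zero    = e
  edgeAt (step e _ _ W) (suc i) = edgeAt W i

  edgeAt-∈ : ∀ {u k} (W : Walk u k) i → edgeAt W i ∈ˢ S
  edgeAt-∈ (step e e∈ _ W) zero    = e∈
  edgeAt-∈ (step e e∈ _ W) (suc i) = edgeAt-∈ W i

  edgeAt-chain : ∀ {u k} (W : Walk u (suc k)) (i : Fin k) → src (edgeAt W (suc i)) ≡ tgt (edgeAt W (inject₁ i))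
  edgeAt-chain (step e _ _ (step e′ _ eq W)) zero    = eq
  edgeAt-chain (step e _ _ W@(step _ _ _ _)) (suc i) = edgeAt-chain W i

  edgeAt-src : ∀ {u k} (W : Walk u k) i → src (edgeAt W i) ≡ u ⊎ ∃[ j ] tgt (edgeAt W j) ≡ src (edgeAt W i)
  edgeAt-src (step e _ eq W) zero    = inj₁ eq
  edgeAt-src (step e _ _ W)  (suc i) = inj₂ (Sum.[ (λ eq → zero , sym eq) , (λ (j , eq) → suc j , eq) ]′ (edgeAt-src W i))

  walk-from : ∀ {u k} (W : Walk u k) i → Walk (src (edgeAt W i)) (k ∸ toℕ i)
  walk-from (step e e∈ _ W) zero    = step e e∈ refl W
  walk-from (step e e∈ _ W) (suc i) = walk-from W i

  module _ (out-unique : ∀ {e f} → e ∈ˢ S → f ∈ˢ S → src e ≡ src f → e ≡ f) where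

    walk-length : ∀ {u k l} → Walk u k → Walk u l → k ≡ l
    walk-length (stop h) (stop _) = refl
    walk-length (stop h) (step e e∈ eq _) = ⊥-elim (h e e∈ eq)
    walk-length (step e e∈ eq _) (stop h) = ⊥-elim (h e e∈ eq)
    walk-length (step e e∈ eq W) (step e′ e′∈ eq′ W′) with refl ← out-unique e∈ e′∈ (trans eq (sym eq′)) =
      cong suc (walk-length W W′)

    -- From its i-th edge on the walk has length k - i, and this number is determined by the source
    -- of that edge.
    edgeAt-injective : ∀ {u k} (W : Walk u k) {i j} → edgeAt W i ≡ edgeAt W j → i ≡ j
    edgeAt-injective {k = k} W {i} {j} eq = Finₚ.toℕ-injective
      (ℕₚ.∸-cancelˡ-≡ (ℕₚ.<⇒≤ (Finₚ.toℕ<n i)) (ℕₚ.<⇒≤ (Finₚ.toℕ<n j))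
        (walk-length (walk-from W i) (subst (λ e → Walk (src e) (k ∸ toℕ j)) (sym eq) (walk-from W j))))

    out-edge : ∀ {u k e} (W : Walk u k) → e ∈ˢ S → u ≡ src e ⊎ ∃[ i ] tgt (edgeAt W i) ≡ src e → ∃[ j ] edgeAt W j ≡ e
    out-edge (stop h) e∈ (inj₁ eq) = ⊥-elim (h _ e∈ (sym eq))
    out-edge (step e′ e′∈ eq′ W) e∈ (inj₁ eq) = zero , out-unique e′∈ e∈ (trans eq′ eq)
    out-edge (step e′ e′∈ eq′ W) e∈ (inj₂ (zero , eq)) = let (j , h) = out-edge W e∈ (inj₁ eq) in suc j , h
    out-edge (step e′ e′∈ eq′ W) e∈ (inj₂ (suc i , eq)) = let (j , h) = out-edge W e∈ (inj₂ (i , eq)) in suc j , h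

module _ (G : Digraph) {S : Subset (Digraph.size G)} (F : LinearForest (Digraph.src G) (Digraph.tgt G) S) where
  open Digraph G

  private
    -- Going against the edges ends at a vertex without incoming edge; the component of w is the
    -- maximal walk from there.
    origin : ∀ {w} → Terminates tgt src S w → ∃[ a ] ((∀ e → e ∈ˢ S → tgt e ≢ a) × Connected G S w a)
    origin {w} (term h) with Finₚ.any? (λ e → (e Subₚ.∈? S) ×-dec (tgt e Fin.≟ w))
    ... | yes (e , e∈ , eq) = let (a , initial , c) = origin (h e e∈ eq) in a , initial , bwd (e , e∈ , refl , eq) ◅ c
    ... | no  none          = w , (λ e e∈ eq → none (e , e∈ , eq)) , done

    module Component {w a} (initial : ∀ e → e ∈ˢ S → tgt e ≢ a) (w~a : Connected G S w a) where

      a~w : Connected G S a w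
      a~w = reverse (SymC.symmetric (Adjacent G S)) w~a

      module _ {k} (W : Walk src tgt S a k) where

        On : Vertex → Set
        On u = a ≡ u ⊎ ∃[ i ] tgt (edgeAt src tgt S W i) ≡ u

        On-src : ∀ i → On (src (edgeAt src tgt S W i))
        On-src i = Sum.map₁ sym (edgeAt-src src tgt S W i)

        into-walk : ∀ {e} → e ∈ˢ S → On (tgt e) → ∃[ i ] edgeAt src tgt S W i ≡ e
        into-walk e∈ (inj₁ eq)       = ⊥-elim (initial _ e∈ (sym eq))
        into-walk e∈ (inj₂ (i , eq)) = i , in-unique F (edgeAt-∈ src tgt S W i) e∈ eq

        connected⇒On : ∀ {u v} → On u → Connected G S u v → On v
        connected⇒On o done = o
        connected⇒On o (fwd (e , e∈ , refl , refl) ◅ r) =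
          let (j , eq) = out-edge src tgt S (out-unique F) W e∈ o in connected⇒On (inj₂ (j , cong tgt eq)) r
        connected⇒On o (bwd (e , e∈ , refl , refl) ◅ r) =
          let (j , eq) = into-walk e∈ o in connected⇒On (subst (On ∘ src) eq (On-src j)) r

        w⇒On : ∀ {u} → Connected G S w u → On u
        w⇒On c = connected⇒On (inj₁ refl) (a~w ◅◅ c)

      reachable : ∀ {u k} (W : Walk src tgt S u k) i → Connected G S u (tgt (edgeAt src tgt S W i))
      reachable (step e e∈ eq W) zero    = fwd (e , e∈ , eq , refl) ◅ done
      reachable (step e e∈ eq W) (suc i) = fwd (e , e∈ , eq , refl) ◅ reachable W i

      On⇒w : ∀ {k} (W : Walk src tgt S a k) {u} → On W u → Connected G S w u
      On⇒w W (inj₁ refl)       = w~a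
      On⇒w W (inj₂ (i , refl)) = w~a ◅◅ reachable W i

      component : ∀ {k} → Walk src tgt S a k → VertexComponent G S w ⊎ PathComponent G S w
      component {zero} W@(stop terminal) = inj₁ record
        { vertices = λ u c → trans (sym (only (w⇒On W c))) (only (w⇒On W done))
        ; edges    = λ e e∈ c → terminal e e∈ (sym (only (w⇒On W c)))
        }
        where
        only : ∀ {u} → On W u → a ≡ u
        only (inj₁ eq) = eq
      component {suc k} W@(step _ _ first _) = inj₂ record
        { path       = edgeAt src tgt S W
        ; simplePath = record
          { chain     = edgeAt-chain src tgt S W
          ; injective = λ i j → edgeAt-injective src tgt S (out-unique F) W ∘
              Sum.[ out-unique F (edgeAt-∈ src tgt S W i) (edgeAt-∈ src tgt S W j)
                  , in-unique F (edgeAt-∈ src tgt S W i) (edgeAt-∈ src tgt S W j) ]′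
          -- A cycle would make the last edge enter a, which has no incoming edge.
          ; non-cycle = λ eq → initial _ (edgeAt-∈ src tgt S W (fromℕ k)) (trans (sym eq) first)
          }
        ; edges      = λ e → mk⇔ (λ (e∈ , c) → out-edge src tgt S (out-unique F) W e∈ (w⇒On W c))
            λ { (i , refl) → edgeAt-∈ src tgt S W i , On⇒w W (On-src W i) }
        ; vertices   = λ u → mk⇔ (λ c → on-path (w⇒On W c))
            λ { (i , inj₁ refl) → On⇒w W (On-src W i) ; (i , inj₂ refl) → On⇒w W (inj₂ (i , refl)) }
        }
        where
        on-path : ∀ {u} → On W u → ∃[ i ] (src (edgeAt src tgt S W i) ≡ u ⊎ tgt (edgeAt src tgt S W i) ≡ u)
        on-path (inj₁ refl)     = zero , inj₁ first
        on-path (inj₂ (i , eq)) = i , inj₂ eq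

  linearForest⇒multipath : Multipath G S
  linearForest⇒multipath w =
    let (a , initial , w~a) = origin (backward F w)
    in Component.component initial w~a (proj₂ (walk src tgt S (forward F a)))

-- Gluing

pattern there² x = there (there x)
pattern there⁴ x = there² (there² x)

-- Gluing (A), for edges given by src and tgt; gluing (B) is obtained by
-- exchanging the two.
module Gluing {n m : ℕ} (src tgt : Fin m → Fin n) (v t : Fin n) where

  src″ tgt″ : Fin (4 ℕ.+ m) → Fin (2 ℕ.+ n)
  src″ zero       = suc (suc t)
  src″ (suc zero) = zero
  src″ δ          = suc (suc t)
  src″ η          = suc zero
  src″ (kept e)   = suc (suc (src e))
  tgt″ zero       = suc (suc v)
  tgt″ (suc zero) = suc (suc t)
  tgt″ δ          = zero
  tgt″ η          = zero
  tgt″ (kept e)   = suc (suc (tgt e))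

  lift-inj : ∀ {u w : Fin n} → 2 Fin.↑ʳ u ≡ 2 Fin.↑ʳ w → u ≡ w
  lift-inj = Finₚ.↑ʳ-injective 2 _ _

  module _ {a b d M} (F : LinearForest src″ tgt″ (a ∷ b ∷ outside ∷ d ∷ M)) where
    private
      S S⁺ : Subset (4 ℕ.+ m)
      S  = a ∷ b ∷ outside ∷ d ∷ M
      S⁺ = a ∷ b ∷ outside ∷ inside ∷ M

      ∈S⁺ : ∀ {e} → e ∈ˢ S⁺ → e ≡ η ⊎ e ∈ˢ S
      ∈S⁺ here                 = inj₂ here
      ∈S⁺ (there here)         = inj₂ (there here)
      ∈S⁺ (there² (there here)) = inj₁ refl
      ∈S⁺ (there⁴ e∈)          = inj₂ (there⁴ e∈)

      src-η : ∀ e → src″ e ≡ suc zero → e ≡ η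
      src-η zero ()
      src-η (suc zero) ()
      src-η δ ()
      src-η η _ = refl
      src-η (kept e) ()

      -- Apart from η only δ enters t₁, and δ is not in S⁺.
      tgt-η : ∀ {e} → e ∈ˢ S⁺ → tgt″ e ≡ zero → e ≡ η
      tgt-η (there² (there here)) _ = refl

      tgt≢t₂ : ∀ e → tgt″ e ≢ suc zero
      tgt≢t₂ zero ()
      tgt≢t₂ (suc zero) ()
      tgt≢t₂ δ ()
      tgt≢t₂ η ()
      tgt≢t₂ (kept e) ()

      unique : ∀ {f : Fin (4 ℕ.+ m) → Fin (2 ℕ.+ n)} → (∀ {e} → e ∈ˢ S⁺ → f e ≡ f η → e ≡ η) →
               (∀ {e e′} → e ∈ˢ S → e′ ∈ˢ S → f e ≡ f e′ → e ≡ e′) →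
               ∀ {e e′} → e ∈ˢ S⁺ → e′ ∈ˢ S⁺ → f e ≡ f e′ → e ≡ e′
      unique only-η inj e∈ e′∈ eq with ∈S⁺ e∈ | ∈S⁺ e′∈
      ... | inj₁ refl | _         = sym (only-η e′∈ (sym eq))
      ... | inj₂ _    | inj₁ refl = only-η e∈ eq
      ... | inj₂ h    | inj₂ h′   = inj h h′ eq

      -- No edge enters t₂, so a walk starting elsewhere never meets η. Starting at t₂ is covered by
      -- `fw′`, which takes one step first.
      fw : ∀ {u} → u ≢ suc zero → Terminates src″ tgt″ S u → Terminates src″ tgt″ S⁺ u
      fw u≢ (term h) = term λ e e∈ eq →
        Sum.[ (λ { refl → ⊥-elim (u≢ (sym eq)) }) , (λ e∈S → fw (tgt≢t₂ e) (h e e∈S eq)) ]′ (∈S⁺ e∈)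

      fw′ : ∀ u → Terminates src″ tgt″ S⁺ u
      fw′ u = term λ e _ _ → fw (tgt≢t₂ e) (forward F (tgt″ e))

      bw : ∀ {u} → Terminates tgt″ src″ S u → Terminates tgt″ src″ S⁺ u
      bw (term h) = term λ e e∈ eq →
        Sum.[ (λ { refl → term λ e′ _ eq′ → ⊥-elim (tgt≢t₂ e′ eq′) }) , (λ e∈S → bw (h e e∈S eq)) ]′ (∈S⁺ e∈)

    forest-add-η : LinearForest src″ tgt″ S⁺
    forest-add-η = record
      { out-unique = unique {src″} (λ {e} _ → src-η e) (out-unique F)
      ; in-unique  = unique {tgt″} tgt-η (in-unique F)
      ; forward    = fw′
      ; backward   = λ u → bw (backward F u)
      }

  module _ {a b d M} (F : LinearForest src″ tgt″ (a ∷ b ∷ inside ∷ d ∷ M)) where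

    -- β and δ both leave t.
    β∉ : a ≡ outside
    β∉ = not-β F
      where
      not-β : ∀ {a} → LinearForest src″ tgt″ (a ∷ b ∷ inside ∷ d ∷ M) → a ≡ outside
      not-β {outside} F = refl
      not-β {inside} F with () ← out-unique F here (there² here) refl

    -- δ and γ form the cycle t → t₁ → t; running round it would descend forever in the termination
    -- proof.
    γ∉ : b ≡ outside
    γ∉ = not-γ F
      where
      not-γ : ∀ {b} → LinearForest src″ tgt″ (a ∷ b ∷ inside ∷ d ∷ M) → b ≡ outside
      not-γ {outside} F = refl
      not-γ {inside} F = ⊥-elim (cycle (forward F (suc (suc t))))
        where
        cycle : Terminates src″ tgt″ (a ∷ inside ∷ inside ∷ d ∷ M) (suc (suc t)) → ⊥
        cycle (term h) with h δ (there² here) refl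
        ... | term h′ = cycle (h′ (suc zero) (there here) refl)

    -- η and δ both enter t₁.
    η∉ : d ≡ outside
    η∉ = not-η F
      where
      not-η : ∀ {d} → LinearForest src″ tgt″ (a ∷ b ∷ inside ∷ d ∷ M) → d ≡ outside
      not-η {outside} F = refl
      not-η {inside} F with () ← in-unique F (there² here) (there² (there here)) refl

    forest-kept : LinearForest src tgt M
    forest-kept = record
      { out-unique = λ e∈ f∈ eq → kept-inj (out-unique F (there⁴ e∈) (there⁴ f∈) (cong (2 Fin.↑ʳ_) eq))
      ; in-unique  = λ e∈ f∈ eq → kept-inj (in-unique F (there⁴ e∈) (there⁴ f∈) (cong (2 Fin.↑ʳ_) eq))
      ; forward    = λ u → fw (forward F (suc (suc u)))
      ; backward   = λ u → bw (backward F (suc (suc u)))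
      }
      where
      kept-inj : ∀ {e f : Fin m} → 4 Fin.↑ʳ e ≡ 4 Fin.↑ʳ f → e ≡ f
      kept-inj = Finₚ.↑ʳ-injective 4 _ _
      fw : ∀ {u} → Terminates src″ tgt″ (a ∷ b ∷ inside ∷ d ∷ M) (suc (suc u)) → Terminates src tgt M u
      fw (term h) = term λ e e∈ eq → fw (h (kept e) (there⁴ e∈) (cong (2 Fin.↑ʳ_) eq))
      bw : ∀ {u} → Terminates tgt″ src″ (a ∷ b ∷ inside ∷ d ∷ M) (suc (suc u)) → Terminates tgt src M u
      bw (term h) = term λ e e∈ eq → bw (h (kept e) (there⁴ e∈) (cong (2 Fin.↑ʳ_) eq))

  module _ (sink : ∀ e → src e ≢ t) {M} (F : LinearForest src tgt M) where

    -- No edge of M leaves t and none touches t₁, so δ only prolongs the path that ends at t.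
    forest-cone-δ : LinearForest src″ tgt″ (δ∪ M)
    forest-cone-δ = record
      { out-unique = λ
        { (there² here) (there² here) _ → refl
        ; (there² here) (there⁴ _) eq → ⊥-elim (sink _ (sym (lift-inj eq)))
        ; (there⁴ _) (there² here) eq → ⊥-elim (sink _ (lift-inj eq))
        ; (there⁴ e∈) (there⁴ f∈) eq → cong (4 Fin.↑ʳ_) (out-unique F e∈ f∈ (lift-inj eq))
        }
      ; in-unique  = λ
        { (there² here) (there² here) _ → refl
        ; (there² here) (there⁴ _) ()
        ; (there⁴ _) (there² here) ()
        ; (there⁴ e∈) (there⁴ f∈) eq → cong (4 Fin.↑ʳ_) (in-unique F e∈ f∈ (lift-inj eq))
        }
      ; forward    = λ { zero → fw-t₁ ; (suc zero) → fw-t₂ ; (suc (suc u)) → fw (forward F u) }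
      ; backward   = λ { zero → bw-t₁ ; (suc zero) → bw-t₂ ; (suc (suc u)) → bw (backward F u) }
      }
      where
      fw-t₁ : Terminates src″ tgt″ (δ∪ M) zero
      fw-t₁ = term λ { .δ (there² here) () ; .(kept _) (there⁴ _) () }
      fw-t₂ : Terminates src″ tgt″ (δ∪ M) (suc zero)
      fw-t₂ = term λ { .δ (there² here) () ; .(kept _) (there⁴ _) () }
      fw : ∀ {u} → Terminates src tgt M u → Terminates src″ tgt″ (δ∪ M) (suc (suc u))
      fw (term h) = term λ
        { .δ (there² here) eq → fw-t₁
        ; .(kept _) (there⁴ e∈) eq → fw (h _ e∈ (lift-inj eq))
        }
      bw : ∀ {u} → Terminates tgt src M u → Terminates tgt″ src″ (δ∪ M) (suc (suc u))
      bw (term h) = term λ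
        { .δ (there² here) ()
        ; .(kept _) (there⁴ e∈) eq → bw (h _ e∈ (lift-inj eq))
        }
      bw-t₁ : Terminates tgt″ src″ (δ∪ M) zero
      bw-t₁ = term λ { .δ (there² here) _ → bw (backward F t) ; .(kept _) (there⁴ _) () }
      bw-t₂ : Terminates tgt″ src″ (δ∪ M) (suc zero)
      bw-t₂ = term λ { .δ (there² here) () ; .(kept _) (there⁴ _) () }

    forest-cone-η : LinearForest src″ tgt″ (η∪ M)
    forest-cone-η = forest-add-η (linearForest-⊆ {T = ∅ˢ {4} ++ M} (λ { (there⁴ e∈) → there⁴ e∈ }) forest-cone-δ)

Forests : ∀ {n m} → (src tgt : Fin m → Fin n) → SimplicialComplex m → Set
Forests src tgt X = ∀ M → Simplex X M ⇔ (LinearForest src tgt M × Nonempty M)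

multipath-forests : ∀ G → Forests (Digraph.src G) (Digraph.tgt G) (multipathComplex G)
multipath-forests G M = mk⇔ (λ (mp , ne) → multipath⇒linearForest G mp , ne) (λ (F , ne) → linearForest⇒multipath G F , ne)

forests-reverse : ∀ {n m} {src tgt : Fin m → Fin n} X → Forests src tgt X → Forests tgt src X
forests-reverse X X⇔ M = mk⇔ (λ s → let (F , ne) = to (X⇔ M) s in linearForest-reverse F , ne)
                           (λ (F , ne) → from (X⇔ M) (linearForest-reverse F , ne))
  where open Equivalence

forests-cong : ∀ {n m} {src tgt src′ tgt′ : Fin m → Fin n} → (∀ e → src e ≡ src′ e) → (∀ e → tgt e ≡ tgt′ e) →
  ∀ X → Forests src tgt X → Forests src′ tgt′ X
forests-cong s t X X⇔ M = mk⇔ (λ h → let (F , ne) = to (X⇔ M) h in linearForest-cong s t F , ne)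
                            (λ (F , ne) → from (X⇔ M) (linearForest-cong (sym ∘ s) (sym ∘ t) F , ne))
  where open Equivalence

module _ {n m : ℕ} (src tgt : Fin m → Fin n) (v t : Fin n) (sink : ∀ e → src e ≢ t)
  (X : SimplicialComplex m) (K : SimplicialComplex (4 ℕ.+ m)) where
  open Gluing src tgt v t
  open Equivalence

  glued-union : Forests src tgt X → Forests src″ tgt″ K → UnionOfCones X K
  glued-union X⇔ K⇔ = record
    { add-η  = λ s → from (K⇔ _) (forest-add-η (proj₁ (to (K⇔ _) s)) , η , there² (there here))
    ; link-δ = λ s → let F = proj₁ (to (K⇔ _) s) in β∉ F , γ∉ F , η∉ F , face (forest-kept F)
    ; cone-δ = λ f → from (K⇔ _) (forest-cone-δ sink (forest f) , δ , there² here)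
    ; cone-η = λ f → from (K⇔ _) (forest-cone-η sink (forest f) , η , there² (there here))
    }
    where
    forest : ∀ {M} → Face X M → LinearForest src tgt M
    forest (inj₁ refl) = linearForest-∅ src tgt
    forest (inj₂ s)    = proj₁ (to (X⇔ _) s)
    face : ∀ {M} → LinearForest src tgt M → Face X M
    face {M} F with Subₚ.nonempty? M
    ... | yes ne = inj₂ (from (X⇔ M) (F , ne))
    ... | no  ¬ne = inj₁ (Subₚ.Empty-unique ¬ne)

-- The join with two points as a union of cones

module _ {m : ℕ} (X : SimplicialComplex m) where

  private
    L : SimplicialComplex (4 ℕ.+ m)
    L = discrete η δ ⋆ shift 4 X

  -- Given as unions σ ∪ˢ τ, simplices of the join do not show their first four entries; this view
  -- lets them be matched.
  data JoinSimplex : Subset (4 ℕ.+ m) → Set where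
    base : ∀ {M} → Face X M → JoinSimplex (∅ˢ {4} ++ M)
    δ*   : ∀ {M} → Face X M → JoinSimplex (δ∪ M)
    η*   : ∀ {M} → Face X M → JoinSimplex (η∪ M)

  join-view : ∀ {ρ} → Simplex L ρ → JoinSimplex ρ
  join-view (_ , σ , τ , σ∈ , τ∈ , refl) = go σ∈ (pad-face τ∈)
    where
    pad-face : ∀ {τ} → Face (shift 4 X) τ → ∃[ M ] (Face X M × τ ≡ ∅ˢ {4} ++ M)
    pad-face (inj₁ refl)             = ∅ˢ , inj₁ refl , refl
    pad-face (inj₂ (M , M∈X , refl)) = M , inj₂ M∈X , refl
    go : ∀ {σ τ} → Face (discrete η δ) σ → ∃[ M ] (Face X M × τ ≡ ∅ˢ {4} ++ M) → JoinSimplex (σ ∪ˢ τ)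
    go (inj₁ refl) (M , f , refl) rewrite Subₚ.∪-identityˡ M = base f
    go (inj₂ (inj₁ refl)) (M , f , refl) rewrite Subₚ.∪-identityˡ M = η* f
    go (inj₂ (inj₂ refl)) (M , f , refl) rewrite Subₚ.∪-identityˡ M = δ* f

  private
    pad-face : ∀ {M} → Face X M → Face (shift 4 X) (∅ˢ {4} ++ M)
    pad-face (inj₁ refl) = inj₁ refl
    pad-face (inj₂ s)    = inj₂ (_ , s , refl)

    δ-simplex : ∀ {M} → Face X M → Simplex L (δ∪ M)
    δ-simplex {M} f = (δ , there² here) , ⁅ δ ⁆ , ∅ˢ {4} ++ M , inj₂ (inj₂ refl) , pad-face f ,
      cong δ∪ (sym (Subₚ.∪-identityˡ M))

    η-simplex : ∀ {M} → Face X M → Simplex L (η∪ M)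
    η-simplex {M} f = (η , there² (there here)) , ⁅ η ⁆ , ∅ˢ {4} ++ M , inj₂ (inj₁ refl) , pad-face f ,
      cong η∪ (sym (Subₚ.∪-identityˡ M))

  join-union : UnionOfCones X L
  join-union = record
    { add-η  = λ s → add (join-view s)
    ; link-δ = λ s → link (join-view s)
    ; cone-δ = δ-simplex
    ; cone-η = η-simplex
    }
    where
    add : ∀ {a b d M} → JoinSimplex (a ∷ b ∷ outside ∷ d ∷ M) → Simplex L (a ∷ b ∷ outside ∷ inside ∷ M)
    add (base f) = η-simplex f
    add (η* f)   = η-simplex f
    link : ∀ {a b d M} → JoinSimplex (a ∷ b ∷ inside ∷ d ∷ M) → a ≡ outside × b ≡ outside × d ≡ outside × Face X M
    link (δ* f) = refl , refl , refl , f

  -- A simplex without apex is a face of the cone with apex η; the others are the cone simplices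
  -- themselves.
  join-⊑ : ∀ {K} → UnionOfCones X K → L ⊑ K
  join-⊑ {K} U s = go (join-view s) (nonempty L s)
    where
    open UnionOfCones U
    go : ∀ {ρ} → JoinSimplex ρ → Nonempty ρ → Simplex K ρ
    go (base f) ne = down K (cone-η f) ne λ { (there⁴ i∈) → there⁴ i∈ }
    go (δ* f) _ = cone-δ f
    go (η* f) _ = cone-η f

-- The two gluings

module _ (G : Digraph) where
  open Digraph G

  -- A base point for X(G′): points of the suspension are pairs, so even the image of a pole needs a
  -- first component.
  edge-vertex : ∀ f → src f ≢ tgt f → Space.Carrier ∥ multipathComplex G ∥
  edge-vertex f no-loop = vertex (multipathComplex G)
    (linearForest⇒multipath G (linearForest-singleton src tgt f no-loop) , f , Subₚ.x∈⁅x⁆ f) (Subₚ.x∈⁅x⁆ f)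

  module _ (D : GluingA G) where
    open GluingA D

    baseA : Space.Carrier ∥ multipathComplex G ∥
    baseA = let (f , s , r) = edge in edge-vertex f λ eq → t≢v (trans (sym r) (trans (sym eq) s))

    unionA : UnionOfCones (multipathComplex G) (multipathComplex (GlueA.glued G D))
    unionA = glued-union src tgt v t sink (multipathComplex G) (multipathComplex (GlueA.glued G D)) (multipath-forests G)
      -- The ends of the glued digraph, projected from pairs, agree with `src″` and `tgt″` only edge
      -- by edge.
      (forests-cong (λ { zero → refl ; (suc zero) → refl ; δ → refl ; η → refl ; (kept e) → refl })
                    (λ { zero → refl ; (suc zero) → refl ; δ → refl ; η → refl ; (kept e) → refl })
        (multipathComplex (GlueA.glued G D)) (multipath-forests (GlueA.glued G D)))
      where
      -- The only edge at t is (v , t); an edge leaving t would have to be this one, whence t = v.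
      sink : ∀ e → src e ≢ t
      sink e eq with edge
      ... | f , f-v , f-t with refl ← unique-incident G t-valence (inj₁ eq) (inj₂ f-t) = t≢v (trans (sym eq) f-v)

  module _ (D : GluingB G) where
    open GluingB D

    baseB : Space.Carrier ∥ multipathComplex G ∥
    baseB = let (f , s , r) = edge in edge-vertex f λ eq → t≢v (trans (sym s) (trans eq r))

    unionB : UnionOfCones (multipathComplex G) (multipathComplex (GlueB.glued G D))
    unionB = glued-union tgt src v t sink (multipathComplex G) (multipathComplex (GlueB.glued G D))
      (forests-reverse (multipathComplex G) (multipath-forests G))
      (forests-cong (λ { zero → refl ; (suc zero) → refl ; δ → refl ; η → refl ; (kept e) → refl })
                    (λ { zero → refl ; (suc zero) → refl ; δ → refl ; η → refl ; (kept e) → refl })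
        (multipathComplex (GlueB.glued G D))
        (forests-reverse (multipathComplex (GlueB.glued G D)) (multipath-forests (GlueB.glued G D))))
      where
      sink : ∀ e → tgt e ≢ t
      sink e eq with edge
      ... | f , f-t , f-v with refl ← unique-incident G t-valence (inj₂ eq) (inj₁ f-t) = t≢v (trans (sym eq) f-v)

proposition2p3 : (∀ (G′ G″ : Digraph) → TOperation G′ G″ → ∥ multipathComplex G″ ∥ ≃ₕ Susp ∥ multipathComplex G′ ∥) ×
    (∀ (G′ : Digraph) (D : GluingA G′) →
    Σ (suspensionSubcomplex G′ D ⊑ multipathComplex (GlueA.glued G′ D)) λ L⊑X →
    IsHomotopyEquivalence (inclusion {L = suspensionSubcomplex G′ D} {K = multipathComplex (GlueA.glued G′ D)} L⊑X))
proposition2p3 = suspension , inclusion-case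
  where
  suspension : ∀ (G′ G″ : Digraph) → TOperation G′ G″ → ∥ multipathComplex G″ ∥ ≃ₕ Susp ∥ multipathComplex G′ ∥
  suspension G _ (gluingA D) =
    let X = multipathComplex G ; K = multipathComplex (GlueA.glued G D) in
    toSusp X K (unionA G D) (baseA G D) , susp-equivalence X K (unionA G D) (baseA G D)
  suspension G _ (gluingB D) =
    let X = multipathComplex G ; K = multipathComplex (GlueB.glued G D) in
    toSusp X K (unionB G D) (baseB G D) , susp-equivalence X K (unionB G D) (baseB G D)
  inclusion-case : ∀ (G′ : Digraph) (D : GluingA G′) →
    Σ (suspensionSubcomplex G′ D ⊑ multipathComplex (GlueA.glued G′ D)) λ L⊑X →
    IsHomotopyEquivalence (inclusion {L = suspensionSubcomplex G′ D} {K = multipathComplex (GlueA.glued G′ D)} L⊑X)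
  inclusion-case G D =
    let X = multipathComplex G ; K = multipathComplex (GlueA.glued G D) in
    join-⊑ X (unionA G D) ,
    inclusion-equivalence X (suspensionSubcomplex G D) K (baseA G D) (join-union X) (unionA G D) (join-⊑ X (unionA G D))
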